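{- The algebra $\mathbf{Baxter}$ is free (as a unital associative algebra) on the elements $\mathbf{E}_J$ (resp. $\mathbf{H}_J$) such that $J$ is a non-empty connected (resp. anti-connected) pair of twin binary trees.
   Context: $\mathbb{K}$ is a field of characteristic zero. $\mathfrak{S}$ is the set of all permutations (of all sizes $n\ge0$), seen as words; $\mathrm{std}(u)$ is the unique permutation of size $|u|$ with the same inversions as $u$. $\mathbf{FQSym}$ is the Hopf algebra over $\mathbb{K}$ with basis $\{\mathbf{F}_\sigma\}_{\sigma\in\mathfrak{S}}$, product $\mathbf{F}_\sigma\cdot\mathbf{F}_\nu = \sum_{\pi} \mathbf{F}_\pi$, where $\pi$ runs over all shuffles of $\sigma$ with the word obtained by adding $|\sigma|$ to every letter of $\nu$, and coproduct $\Delta(\mathbf{F}_\sigma) = \sum_{\sigma = uv} \mathbf{F}_{\mathrm{std}(u)} \otimes \mathbf{F}_{\mathrm{std}(v)}$. A binary tree is either a leaf (empty tree) or a node with a left and a right binary subtree. The canopy of a binary tree with $n$ nodes is the word of length $n-1$ obtained by reading its leaves from left to right except the first and the last, writing $0$ if the leaf is a right child and $1$ if it is a left child. A pair of twin binary trees is a pair of binary trees with the same number $n$ of nodes whose canopies differ at every position $1\le i\le n-1$. For a permutation $\sigma$, $\mathsf{P}(\sigma) = (T_L,T_R)$ where $T_L$ (resp. $T_R$) is the shape of the binary search tree obtained by inserting the letters of $\sigma$ from left to right (resp. right to left) with the standard binary search tree leaf insertion. $\mathbf{Baxter}$ is the Hopf subalgebra of $\mathbf{FQSym}$ with basis $\{\mathbf{P}_J\}$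 indexed by pairs of twin binary trees, where $\mathbf{P}_J = \sum_{\sigma\in\mathfrak{S},\ \mathsf{P}(\sigma) = J} \mathbf{F}_\sigma$. The permutohedron order $\leq_{\mathrm{P}}$ on permutations of size $n$ is the partial order in which $\sigma$ is covered by $\nu$ iff $\sigma = u\,ab\,v$ and $\nu = u\,ba\,v$ for some words $u,v$ and letters $a<b$. The Baxter order on pairs of twin binary trees with $n$ nodes is defined by $J_0 \leq_{\mathrm{B}} J_1$ iff there are permutations $\sigma \leq_{\mathrm{P}} \nu$ of size $n$ with $\mathsf{P}(\sigma) = J_0$ and $\mathsf{P}(\nu) = J_1$. The elementary and homogeneous families of $\mathbf{Baxter}$ are $\mathbf{E}_J := \sum_{J \leq_{\mathrm{B}} J'} \mathbf{P}_{J'}$ and $\mathbf{H}_J := \sum_{J' \leq_{\mathrm{B}} J} \mathbf{P}_{J'}$. For permutations $\sigma,\nu$, $\sigma / \nu$ is the concatenation of $\sigma$ with the letters of $\nu$ incremented by $|\sigma|$. A permutation $\sigma$ is connected if $\sigma = \nu / \pi$ implies $\nu = \sigma$ or $\pi = \sigma$; it is anti-connected if its mirror image $\sigma_n \cdots \sigma_1$ is connected. A pair of twin binary trees $J$ is connected (resp. anti-connected) if all permutations $\sigma$ such that $\mathsf{P}(\sigma) = J$ are connected (resp. anti-connected). -}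

module Defs where

open import Algebra.Bundles using (Ring; CommutativeRing)
open import Algebra.Module.Structures using (IsLeftModule)
open import Algebra.Morphism.Structures using (module RingMorphisms)
open import Algebra.Structures using (IsMonoid)
open import Data.Bool.Base using (Bool; true; false; if_then_else_)
open import Data.Empty using (⊥; ⊥-elim)
open import Data.List.Base using (List; []; _∷_; _++_; map; concatMap; filter; foldr; deduplicate; length)
open import Data.List.Membership.Propositional using (_∈_; _∉_)
open import Data.List.Membership.Propositional.Properties using (∈-++⁺ˡ; ∈-++⁺ʳ; ∈-map⁺; ∈-deduplicate⁺)
open import Data.List.Properties using (∷-injective; ++-assoc; ++-identityʳ; concatMap-++; length-++; length-map; map-++; map-cong; map-id; map-id-local; map-∘)
open import Data.List.Relation.Binary.Permutation.Propositional using (_↭_; ↭-sym)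
open import Data.List.Relation.Binary.Permutation.Propositional.Properties using (↭-length; filter-↭) renaming (map⁺ to ↭-map⁺)
open import Data.List.Relation.Unary.All as All using (All; []; _∷_)
open import Data.List.Relation.Unary.AllPairs using ([]; _∷_)
open import Data.List.Relation.Unary.Any as Any using (here; there)
open import Data.List.Relation.Unary.Unique.DecPropositional.Properties using (deduplicate-!)
open import Data.List.Relation.Unary.Unique.Propositional using (Unique)
open import Data.List.Relation.Unary.Unique.Propositional.Properties using (map⁺)
open import Data.Nat.Base using (ℕ; _≤_; _<_; _∸_) renaming (_+_ to _+ⁿ_)
open import Data.Nat.Properties using (≤-trans; ≤-reflexive; +-monoʳ-≤; _≤?_; _<?_; m+[n∸m]≡n; m+n∸m≡n; <⇒≤) renaming (+-assoc to +-assocⁿ; +-comm to +-commⁿ)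
open import Data.Product using (∃!)
open import Data.Product.Base using (∃; _×_; _,_; proj₁; proj₂)
open import Data.Refinement.Base using (Refinement-syntax; _,_; value)
open import Data.Refinement.Properties using (value-injective)
open import Function.Base using (_∘_; id)
open import Function.Bundles using (Func)
open import Level using (0ℓ; _⊔_) renaming (suc to lsuc)
open import Relation.Binary.Bundles using (Setoid)
open import Relation.Binary.Definitions using (DecidableEquality)
open import Relation.Binary.PropositionalEquality as ≡ using (_≡_)
open import Relation.Nullary using (Dec; yes; no; does)
open import Relation.Nullary.Decidable using (_×-dec_)
import Data.List.Relation.Unary.All.Properties as Allₚ
open import Algebra.Apartness.Bundles using (HeytingCommutativeRing; HeytingField)
import Algebra.Definitions.RawMonoid as RawMonoidMultiples
import Relation.Binary.Construct.On as On

module Combinatorics where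

  open import Data.Bool.Base using (Bool; true; false; not; if_then_else_)
  open import Data.Bool.Properties using () renaming (_≟_ to _≟ᵇ_; not-¬ to not-¬ᵇ)
  open import Data.Empty using (⊥; ⊥-elim)
  open import Data.Irrelevant using ([_])
  open import Data.List.Base using (List; []; _∷_; _++_; map; concatMap; filter; foldl; foldr; length; reverse; upTo; drop; cartesianProduct; cartesianProductWith)
  open import Data.List.Properties using (≡-dec; length-map; length-++; filter-all; filter-none; filter-++; map-++; unfold-reverse; reverse-foldr; reverse-map; length-reverse; ++-identityʳ; ∷-injective; filter-accept; filter-reject)
  open import Data.List.Membership.Propositional using (_∈_; _∉_; lose)
  open import Data.List.Membership.Propositional.Properties using (∈-++⁺ˡ; ∈-++⁺ʳ; ∈-++⁻; ∈-∃++; ∈-map⁺; ∈-map⁻; ∈-filter⁺; ∈-filter⁻; ∈-upTo⁺; ∈-concat⁻′; ∈-concat⁺′; ∈-cartesianProductWith⁺; ∈-cartesianProductWith⁻)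
  open import Data.List.Relation.Binary.Permutation.Propositional using (_↭_; ↭-refl; ↭-sym; ↭-trans; prep; swap; ↭⇒↭ₛ)
  open import Data.List.Relation.Binary.Permutation.Propositional.Properties using (shift; ↭-length; All-resp-↭; ∈-resp-↭; ↭-reverse) renaming (++⁺ˡ to ↭-++⁺ˡ; ++⁺ʳ to ↭-++⁺ʳ)
  open import Data.List.Relation.Binary.Permutation.Setoid.Properties using () renaming (Unique-resp-↭ to Unique-resp-↭ₛ)
  open import Data.List.Relation.Binary.Pointwise using (Pointwise; []; _∷_; Pointwise-≡⇒≡)
  open import Data.List.Relation.Binary.Subset.Propositional using (_⊆_)
  open import Data.List.Relation.Unary.All as All using (All; []; _∷_)
  import Data.List.Relation.Unary.All.Properties as Allₚ
  import Data.List.Relation.Binary.Pointwise.Properties as Pointwiseₚ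
  open import Data.List.Relation.Unary.AllPairs using (AllPairs; []; _∷_)
  import Data.List.Relation.Unary.AllPairs.Properties as AllPairsₚ
  open import Data.List.Relation.Unary.Any as Any using (Any; here; there; any?)
  open import Data.List.Relation.Unary.Linked.Properties using (AllPairs⇒Linked)
  open import Data.List.Relation.Unary.Sorted.TotalOrder.Properties using (↗↭↗⇒≋)
  open import Data.List.Relation.Unary.Unique.Propositional using (Unique)
  open import Data.List.Relation.Unary.Unique.Propositional.Properties using (map⁺; map⁻; ++⁺; upTo⁺; filter⁺; cartesianProductWith⁺)
  open import Data.List.Relation.Unary.Unique.DecPropositional using (unique?)
  open import Data.Nat.Base using (ℕ; zero; suc; _<ᵇ_; _≤ᵇ_; _≡ᵇ_; _+_; _≤_; _<_; s≤s⁻¹)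
  open import Data.Nat.ListAction using (sum)
  open import Data.Nat.Properties
  open import Data.Product.Base using (∃; ∃₂; _×_; _,_; proj₁; proj₂)
  import Data.Product.Properties as Productₚ
  open import Data.Refinement.Base using (Refinement-syntax; _,_; value)
  open import Data.Refinement.Properties using (value-injective) renaming (_≟_ to ≟-refinement)
  open import Data.Sum.Base using (_⊎_; inj₁; inj₂)
  open import Data.Tree.Binary as Tree using (Tree; leaf; node; #nodes)
  open import Data.Unit.Base using (⊤; tt)
  open import Function.Base using (_∘_)
  open import Relation.Binary.Construct.Closure.ReflexiveTransitive using (Star; ε; _◅_)
  open import Relation.Binary.Definitions using (DecidableEquality; Decidable)
  open import Relation.Binary.PropositionalEquality
  open import Relation.Nullary using (¬_; Dec; yes; no; does; ofʸ; ofⁿ; recompute)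
  open import Relation.Nullary using () renaming (proof to proofᵈ)
  open import Relation.Nullary.Decidable using (map′; _×-dec_; ¬?; dec-true; dec-false)

  module _ {a p} {A : Set a} {P : A → Set p} where

    refineAll : (xs : List A) → .(All P xs) → List [ x ∈ A ∣ P x ]
    refineAll []       _  = []
    refineAll (x ∷ xs) ps = (x , [ All.head ps ]) ∷ refineAll xs (All.tail ps)

    value-refineAll : ∀ xs .ps → map value (refineAll xs ps) ≡ xs
    value-refineAll []       _ = refl
    value-refineAll (x ∷ xs) _ = cong (x ∷_) (value-refineAll xs _)

  Word : Set
  Word = List ℕ

  _≟ʷ_ : DecidableEquality Word
  _≟ʷ_ = ≡-dec _≟_

  -- A permutation of size n is a word of length n with distinct letters in
  -- 1, …, n.  The proof component of a refinement type is irrelevant, so two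
  -- permutations are propositionally equal as soon as their words are.
  IsPermutation : Word → Set
  IsPermutation w = Unique w × All (λ a → 1 ≤ a × a ≤ length w) w

  isPermutation? : ∀ w → Dec (IsPermutation w)
  isPermutation? w = unique? _≟_ w ×-dec All.all? (λ a → 1 ≤? a ×-dec a ≤? length w) w

  Permutation : Set
  Permutation = [ w ∈ Word ∣ IsPermutation w ]

  _≟ₚ_ : DecidableEquality Permutation
  _≟ₚ_ = ≟-refinement _≟ʷ_

  isPermutation : (σ : Permutation) → IsPermutation (value σ)
  isPermutation (w , [ p ]) = recompute (isPermutation? w) p

  ∣_∣ : Permutation → ℕ
  ∣ σ ∣ = length (value σ)

  Unique-resp-↭ : ∀ {a} {A : Set a} {xs ys : List A} → xs ↭ ys → Unique xs → Unique ys
  Unique-resp-↭ {A = A} p = Unique-resp-↭ₛ (setoid A) (↭⇒↭ₛ p)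

  IsPermutation-resp-↭ : ∀ {u v} → u ↭ v → IsPermutation u → IsPermutation v
  IsPermutation-resp-↭ {u} p (d , r) =
    Unique-resp-↭ p d ,
    All-resp-↭ p (subst (λ n → All (λ a → 1 ≤ a × a ≤ n) u) (↭-length p) r)

  -- words n k lists the words of length n on the letters 1, …, k.
  words : ℕ → ℕ → List Word
  words zero    k = [] ∷ []
  words (suc n) k = cartesianProductWith _∷_ (map suc (upTo k)) (words n k)

  permutations : ℕ → List Permutation
  permutations n = refineAll (filter isPermutation? (words n n)) (Allₚ.all-filter isPermutation? (words n n))

  ∈-letters : ∀ {a k} → 1 ≤ a → a ≤ k → a ∈ map suc (upTo k)
  ∈-letters {suc a} _ a<k = ∈-map⁺ suc (∈-upTo⁺ a<k)

  ∈-words : ∀ k w → All (λ a → 1 ≤ a × a ≤ k) w → w ∈ words (length w) k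
  ∈-words k []      _               = here refl
  ∈-words k (a ∷ w) ((p , q) ∷ r) = ∈-cartesianProductWith⁺ _∷_ (∈-letters p q) (∈-words k w r)

  length-words : ∀ n k {w} → w ∈ words n k → length w ≡ n
  length-words zero    k (here refl) = refl
  length-words (suc n) k w∈ with ∈-cartesianProductWith⁻ _∷_ (map suc (upTo k)) (words n k) w∈
  ... | _ , _ , _ , v∈ , refl = cong suc (length-words n k v∈)

  words-unique : ∀ n k → Unique (words n k)
  words-unique zero    k = [] ∷ []
  words-unique (suc n) k =
    cartesianProductWith⁺ _∷_ ∷-injective (map⁺ suc-injective (upTo⁺ k)) (words-unique n k)

  value-permutations : ∀ n → map value (permutations n) ≡ filter isPermutation? (words n n)
  value-permutations n = value-refineAll _ _

  permutations-unique : ∀ n → Unique (permutations n)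
  permutations-unique n =
    map⁻ (subst Unique (sym (value-permutations n)) (filter⁺ isPermutation? (words-unique n n)))

  ∈-value⁻ : ∀ {a p} {A : Set a} {P : A → Set p} {x : [ a ∈ A ∣ P a ]} {xs} →
             value x ∈ map value xs → x ∈ xs
  ∈-value⁻ x∈ with ∈-map⁻ value x∈
  ... | y , y∈ , eq = subst (_∈ _) (sym (value-injective {v = _} {w = y} eq)) y∈

  ∈-permutations⁺ : ∀ (σ : Permutation) → σ ∈ permutations ∣ σ ∣
  ∈-permutations⁺ σ = ∈-value⁻ (subst (value σ ∈_) (sym (value-permutations ∣ σ ∣))
    (∈-filter⁺ isPermutation? (∈-words _ (value σ) (proj₂ (isPermutation σ))) (isPermutation σ)))

  ∈-permutations⁻ : ∀ {n σ} → σ ∈ permutations n → ∣ σ ∣ ≡ n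
  ∈-permutations⁻ {n} σ∈ = length-words n n
    (proj₁ (∈-filter⁻ isPermutation? (subst (_ ∈_) (value-permutations n) (∈-map⁺ value σ∈))))

  Unique-⊆⇒↭ : ∀ {xs ys : Word} → Unique xs → xs ⊆ ys → length ys ≤ length xs → xs ↭ ys
  Unique-⊆⇒↭ {[]}     {[]}    _       _   _  = ↭-refl
  Unique-⊆⇒↭ {x ∷ xs} {ys} (x∉ ∷ u) sub le with ∈-∃++ (sub (here refl))
  ... | ys₁ , ys₂ , refl = ↭-trans (prep x (Unique-⊆⇒↭ u sub′ le′)) (↭-sym (shift x ys₁ ys₂))
    where
    le′ : length (ys₁ ++ ys₂) ≤ length xs
    le′ = s≤s⁻¹ (subst (_≤ suc (length xs)) (↭-length (shift x ys₁ ys₂)) le)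
    sub′ : xs ⊆ ys₁ ++ ys₂
    sub′ {z} z∈ with ∈-resp-↭ (shift x ys₁ ys₂) (sub (there z∈))
    ... | here refl = ⊥-elim (All.lookup x∉ z∈ refl)
    ... | there z∈′ = z∈′

  permutation-↭ : ∀ {u v} → IsPermutation u → IsPermutation v → length u ≡ length v → u ↭ v
  permutation-↭ {u} {v} p q eq = ↭-trans (to p) (subst (λ n → map suc (upTo n) ↭ v) (sym eq) (↭-sym (to q)))
    where
    open import Data.List.Properties using (length-upTo)
    to : ∀ {w} → IsPermutation w → w ↭ map suc (upTo (length w))
    to {w} (d , r) = Unique-⊆⇒↭ d (λ a∈ → let (p , q) = All.lookup r a∈ in ∈-letters p q)
      (≤-reflexive (trans (length-map suc (upTo (length w))) (length-upTo (length w))))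

  -- The shuffles are listed with multiplicity.
  shuffle : ∀ {a} {A : Set a} → List A → List A → List (List A)
  shuffle []      v       = v ∷ []
  shuffle (a ∷ u) []      = (a ∷ u) ∷ []
  shuffle (a ∷ u) (b ∷ v) = map (a ∷_) (shuffle u (b ∷ v)) ++ map (b ∷_) (shuffle (a ∷ u) v)

  shuffle-↭ : ∀ {a} {A : Set a} (u v : List A) → All (_↭ (u ++ v)) (shuffle u v)
  shuffle-↭ []      v       = ↭-refl ∷ []
  shuffle-↭ (a ∷ u) []      = subst (λ w → a ∷ u ↭ a ∷ w) (sym (++-identityʳ u)) ↭-refl ∷ []
  shuffle-↭ (a ∷ u) (b ∷ v) = Allₚ.++⁺
    (Allₚ.map⁺ (All.map (prep a) (shuffle-↭ u (b ∷ v))))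
    (Allₚ.map⁺ (All.map (λ p → ↭-trans (prep b p) (↭-sym (shift b (a ∷ u) v))) (shuffle-↭ (a ∷ u) v)))

  -- The letters of the second word are incremented by the length of the first.
  infixl 7 _/_
  _/_ : Word → Word → Word
  u / v = u ++ map (length u +_) v

  /-isPermutation : ∀ {u v} → IsPermutation u → IsPermutation v → IsPermutation (u / v)
  /-isPermutation {u} {v} (du , ru) (dv , rv) =
    ++⁺ du (map⁺ (+-cancelˡ-≡ (length u) _ _) dv) disj , Allₚ.++⁺ (All.map rng₁ ru) (Allₚ.map⁺ (All.map rng₂ rv))
    where
    len : length (u / v) ≡ length u + length v
    len = trans (length-++ u) (cong (length u +_) (length-map _ v))
    disj : ∀ {a} → a ∈ u × a ∈ map (length u +_) v → ⊥
    disj (a∈u , a∈v) with ∈-map⁻ (length u +_) a∈v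
    ... | b , b∈v , refl = <⇒≱ (≤-trans (≤-reflexive (+-comm 1 (length u))) (+-monoʳ-≤ (length u) (proj₁ (All.lookup rv b∈v))))
                                (proj₂ (All.lookup ru a∈u))
    rng₁ : ∀ {a} → 1 ≤ a × a ≤ length u → 1 ≤ a × a ≤ length (u / v)
    rng₁ (p , q) = p , ≤-trans q (≤-trans (m≤m+n _ _) (≤-reflexive (sym len)))
    rng₂ : ∀ {a} → 1 ≤ a × a ≤ length v → 1 ≤ length u + a × length u + a ≤ length (u / v)
    rng₂ (p , q) = ≤-trans p (m≤n+m _ (length u)) , ≤-trans (+-monoʳ-≤ (length u) q) (≤-reflexive (sym len))

  shuffle-isPermutation : ∀ σ ν → All IsPermutation (shuffle (value σ) (map (∣ σ ∣ +_) (value ν)))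
  shuffle-isPermutation σ ν =
    All.map (λ p → IsPermutation-resp-↭ (↭-sym p) (/-isPermutation (isPermutation σ) (isPermutation ν)))
            (shuffle-↭ (value σ) (map (∣ σ ∣ +_) (value ν)))

  -- The basis elements occurring in the product 𝐅 σ · 𝐅 ν.
  shiftedShuffles : Permutation → Permutation → List Permutation
  shiftedShuffles σ ν =
    refineAll (shuffle (value σ) (map (∣ σ ∣ +_) (value ν))) (shuffle-isPermutation σ ν)

  mirror : Permutation → Permutation
  mirror σ = reverse (value σ) , [ IsPermutation-resp-↭ (↭-sym (↭-reverse (value σ))) (isPermutation σ) ]

  Connected : Permutation → Set
  Connected σ = ∀ (ν π : Permutation) → value σ ≡ value ν / value π → ν ≡ σ ⊎ π ≡ σ

  AntiConnected : Permutation → Set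
  AntiConnected σ = Connected (mirror σ)

  εₚ : Permutation
  εₚ = [] , [ [] , [] ]

  module _ (k : ℕ) where

    low high : Word → Word
    low  = filter (_≤? k)
    high = filter (k <?_)

    shuffle-low : ∀ u v {w} → All (_≤ k) u → All (k <_) v → w ∈ shuffle u v → low w ≡ u × high w ≡ v
    shuffle-low []      v       _  hv (here refl) = filter-none (_≤? k) (All.map <⇒≱ hv) , filter-all (k <?_) hv
    shuffle-low (a ∷ u) []      hu _  (here refl) = filter-all (_≤? k) hu , filter-none (k <?_) (All.map ≤⇒≯ hu)
    shuffle-low (a ∷ u) (b ∷ v) (pa ∷ hu) (pb ∷ hv) w∈ with ∈-++⁻ (map (a ∷_) (shuffle u (b ∷ v))) w∈
    ... | inj₁ w∈₁ with w , w∈₂ , refl ← ∈-map⁻ (a ∷_) w∈₁ with shuffle-low u (b ∷ v) hu (pb ∷ hv) w∈₂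
    ... | e₁ , e₂ = trans (filter-accept (_≤? k) pa) (cong (a ∷_) e₁) , trans (filter-reject (k <?_) (≤⇒≯ pa)) e₂
    shuffle-low (a ∷ u) (b ∷ v) (pa ∷ hu) (pb ∷ hv) w∈
        | inj₂ w∈₁ with w , w∈₂ , refl ← ∈-map⁻ (b ∷_) w∈₁ with shuffle-low (a ∷ u) v (pa ∷ hu) hv w∈₂
    ... | e₁ , e₂ = trans (filter-reject (_≤? k) (<⇒≱ pb)) e₁ , trans (filter-accept (k <?_) pb) (cong (b ∷_) e₂)

    ∈-shuffle-∷ˡ : ∀ {a} {u v w : Word} → w ∈ shuffle u v → a ∷ w ∈ shuffle (a ∷ u) v
    ∈-shuffle-∷ˡ {v = []}    {w} w∈ = here (cong (_ ∷_) (lem _ w∈))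
      where
      lem : ∀ u → w ∈ shuffle u [] → w ≡ u
      lem []      (here p) = p
      lem (_ ∷ _) (here p) = p
    ∈-shuffle-∷ˡ {v = b ∷ v} w∈ = ∈-++⁺ˡ (∈-map⁺ (_ ∷_) w∈)

    ∈-shuffle-∷ʳ : ∀ {b} {u v w : Word} → w ∈ shuffle u v → b ∷ w ∈ shuffle u (b ∷ v)
    ∈-shuffle-∷ʳ {u = []}    (here refl) = here refl
    ∈-shuffle-∷ʳ {u = a ∷ u} {v} w∈ = ∈-++⁺ʳ (map (a ∷_) (shuffle u (_ ∷ v))) (∈-map⁺ (_ ∷_) w∈)

    ∈-shuffle-low-high : ∀ w → w ∈ shuffle (low w) (high w)
    ∈-shuffle-low-high []      = here refl
    ∈-shuffle-low-high (a ∷ w) with a ≤? k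
    ... | yes p = subst₂ (λ x y → a ∷ w ∈ shuffle x y)
                    (sym (filter-accept (_≤? k) p)) (sym (filter-reject (k <?_) (≤⇒≯ p)))
                    (∈-shuffle-∷ˡ {u = low w} (∈-shuffle-low-high w))
    ... | no ¬p = subst₂ (λ x y → a ∷ w ∈ shuffle x y)
                    (sym (filter-reject (_≤? k) ¬p)) (sym (filter-accept (k <?_) (≰⇒> ¬p)))
                    (∈-shuffle-∷ʳ {u = low w} (∈-shuffle-low-high w))

    shuffle-unique : ∀ u v → All (_≤ k) u → All (k <_) v → Unique (shuffle u v)
    shuffle-unique []      v       _  _ = [] ∷ []
    shuffle-unique (a ∷ u) []      _  _ = [] ∷ []
    shuffle-unique (a ∷ u) (b ∷ v) (pa ∷ hu) (pb ∷ hv) = ++⁺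
      (map⁺ (proj₂ ∘ ∷-injective) (shuffle-unique u (b ∷ v) hu (pb ∷ hv)))
      (map⁺ (proj₂ ∘ ∷-injective) (shuffle-unique (a ∷ u) v (pa ∷ hu) hv))
      λ (p , q) → disj (∈-map⁻ (a ∷_) p) (∈-map⁻ (b ∷_) q)
      where
      disj : ∀ {w X Y} → ∃ (λ x → x ∈ X × w ≡ a ∷ x) → ∃ (λ y → y ∈ Y × w ≡ b ∷ y) → ⊥
      disj (_ , _ , refl) (_ , _ , eq) = <⇒≱ pb (subst (_≤ k) (proj₁ (∷-injective eq)) pa)

  BinaryTree : Set
  BinaryTree = Tree ⊤ ⊤

  shape : Tree ℕ ⊤ → BinaryTree
  shape = Tree.mapₙ (λ _ → tt)

  _≟ₜ_ : DecidableEquality BinaryTree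
  leaf _     ≟ₜ leaf _        = yes refl
  leaf _     ≟ₜ node _ _ _    = no λ ()
  node _ _ _ ≟ₜ leaf _        = no λ ()
  node l _ r ≟ₜ node l′ _ r′ =
    map′ (λ { (refl , refl) → refl }) (λ { refl → refl , refl }) (l ≟ₜ l′ ×-dec r ≟ₜ r′)

  -- leafSides b t lists the leaves of t from left to right, true (the letter 1)
  -- for a left child and false (the letter 0) for a right child, where b says
  -- on which side t itself hangs.
  leafSides : Bool → BinaryTree → List Bool
  leafSides b (leaf _)     = b ∷ []
  leafSides b (node l _ r) = leafSides true l ++ leafSides false r

  dropLast : ∀ {a} {A : Set a} → List A → List A
  dropLast []          = []
  dropLast (x ∷ [])    = []
  dropLast (x ∷ y ∷ z) = x ∷ dropLast (y ∷ z)

  -- The side given to the root only matters for the tree reduced to a leaf, and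
  -- it is then discarded together with the first leaf.
  canopy : BinaryTree → List Bool
  canopy t = dropLast (drop 1 (leafSides true t))

  TreePair : Set
  TreePair = BinaryTree × BinaryTree

  IsTwin : TreePair → Set
  IsTwin (t , t′) = #nodes t ≡ #nodes t′ × Pointwise _≢_ (canopy t) (canopy t′)

  isTwin? : ∀ p → Dec (IsTwin p)
  isTwin? (t , t′) = #nodes t ≟ #nodes t′ ×-dec Pointwiseₚ.decidable (λ b b′ → ¬? (b ≟ᵇ b′)) (canopy t) (canopy t′)

  TwinPair : Set
  TwinPair = [ p ∈ TreePair ∣ IsTwin p ]

  _≟ₘ_ : DecidableEquality TreePair
  _≟ₘ_ = Productₚ.≡-dec _≟ₜ_ _≟ₜ_

  _≟ⱼ_ : DecidableEquality TwinPair
  _≟ⱼ_ = ≟-refinement _≟ₘ_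

  size : TwinPair → ℕ
  size J = #nodes (proj₁ (value J))

  -- treesOfHeight h lists the trees of height at most h.  A tree with n nodes
  -- has height at most n.
  treesOfHeight : ℕ → List BinaryTree
  treesOfHeight zero    = leaf tt ∷ []
  treesOfHeight (suc h) = leaf tt ∷ cartesianProductWith (λ l r → node l tt r) (treesOfHeight h) (treesOfHeight h)

  trees : ℕ → List BinaryTree
  trees n = filter (λ t → #nodes t ≟ n) (treesOfHeight n)

  twinPairs : ℕ → List TwinPair
  twinPairs n = refineAll (filter isTwin? (cartesianProduct (trees n) (trees n)))
                          (Allₚ.all-filter isTwin? (cartesianProduct (trees n) (trees n)))

  insert : ℕ → Tree ℕ ⊤ → Tree ℕ ⊤
  insert a (leaf _)     = node (leaf tt) a (leaf tt)
  insert a (node l b r) = if does (a <? b) then node (insert a l) b r else node l b (insert a r)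

  insertLeftToRight insertRightToLeft : Word → Tree ℕ ⊤
  insertLeftToRight = foldl (λ t a → insert a t) (leaf tt)
  insertRightToLeft = foldr insert (leaf tt)

  insertReverse : ∀ w → insertRightToLeft (reverse w) ≡ insertLeftToRight w
  insertReverse = reverse-foldr insert (leaf tt)

  -- The shapes T_L and T_R, from a left to right and a right to left insertion.
  𝖯ʷ : Word → TreePair
  𝖯ʷ w = shape (insertLeftToRight w) , shape (insertRightToLeft w)

  labels : Tree ℕ ⊤ → Word
  labels (leaf _)     = []
  labels (node l a r) = labels l ++ a ∷ labels r

  labels-insert : ∀ a t → labels (insert a t) ↭ a ∷ labels t
  labels-insert a (leaf _)     = ↭-refl
  labels-insert a (node l b r) with a <ᵇ b | proofᵈ (a <? b)
  ... | true | ofʸ _ = ↭-++⁺ʳ (b ∷ labels r) (labels-insert a l)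
  ... | false | ofⁿ _ = ↭-trans (↭-++⁺ˡ (labels l) (↭-trans (prep b (labels-insert a r)) (swap b a ↭-refl)))
                        (shift a (labels l) (b ∷ labels r))

  labels-insertAll : ∀ w → labels (insertRightToLeft w) ↭ w
  labels-insertAll []      = ↭-refl
  labels-insertAll (a ∷ w) = ↭-trans (labels-insert a (insertRightToLeft w)) (prep a (labels-insertAll w))

  data BST : Tree ℕ ⊤ → Set where
    leaf : ∀ {x} → BST (leaf x)
    node : ∀ {l a r} → BST l → All (_< a) (labels l) → All (a ≤_) (labels r) → BST r → BST (node l a r)

  BST-insert : ∀ a {t} → BST t → BST (insert a t)
  BST-insert a leaf = node leaf [] [] leaf
  BST-insert a {node l b r} (node hl pl pr hr) with a <ᵇ b | proofᵈ (a <? b)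
  ... | true | ofʸ p = node (BST-insert a hl) (All-resp-↭ (↭-sym (labels-insert a l)) (p ∷ pl)) pr hr
  ... | false | ofⁿ ¬p = node hl pl (All-resp-↭ (↭-sym (labels-insert a r)) (≮⇒≥ ¬p ∷ pr)) (BST-insert a hr)

  BST-insertAll : ∀ w → BST (insertRightToLeft w)
  BST-insertAll []      = leaf
  BST-insertAll (a ∷ w) = BST-insert a (BST-insertAll w)

  labels-sorted : ∀ {t} → BST t → AllPairs _≤_ (labels t)
  labels-sorted leaf = []
  labels-sorted (node hl pl pr hr) =
    AllPairsₚ.++⁺ (labels-sorted hl) (pr ∷ labels-sorted hr)
      (All.map (λ p → <⇒≤ p ∷ All.map (≤-trans (<⇒≤ p)) pr) pl)

  labels-≡ : ∀ {s t} → BST s → BST t → labels s ↭ labels t → labels s ≡ labels t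
  labels-≡ hs ht p = Pointwise-≡⇒≡ (↗↭↗⇒≋ ≤-totalOrder
    (AllPairs⇒Linked (labels-sorted hs)) (AllPairs⇒Linked (labels-sorted ht)) (↭⇒↭ₛ p))

  #nodes-labels : ∀ t → #nodes (shape t) ≡ length (labels t)
  #nodes-labels (leaf _)     = refl
  #nodes-labels (node l a r) = trans (cong₂ (λ m n → m + suc n) (#nodes-labels l) (#nodes-labels r))
                                     (sym (length-++ (labels l)))

  #nodes-insertAll : ∀ w → #nodes (shape (insertRightToLeft w)) ≡ length w
  #nodes-insertAll w = trans (#nodes-labels (insertRightToLeft w)) (↭-length (labels-insertAll w))

  #nodes-insertAllʳ : ∀ w → #nodes (shape (insertLeftToRight w)) ≡ length w
  #nodes-insertAllʳ w = trans (cong (#nodes ∘ shape) (sym (insertReverse w)))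
                              (trans (#nodes-insertAll (reverse w)) (length-reverse w))

  ++-cancel-length : ∀ (u : Word) {u′ v v′} → length u ≡ length u′ → u ++ v ≡ u′ ++ v′ → u ≡ u′ × v ≡ v′
  ++-cancel-length []      {[]}     _ eq = refl , eq
  ++-cancel-length (a ∷ u) {b ∷ u′} l eq with ∷-injective eq
  ... | refl , eq′ with ++-cancel-length u {u′} (suc-injective l) eq′
  ... | refl , e = refl , e

  node-injective : ∀ {l r l′ r′ : BinaryTree} {x y} → node l x r ≡ node l′ y r′ → l ≡ l′ × r ≡ r′
  node-injective refl = refl , refl

  tree-≡ : ∀ s t → shape s ≡ shape t → labels s ≡ labels t → s ≡ t
  tree-≡ (leaf _)     (leaf _)       _  _  = refl
  tree-≡ (node l a r) (node l′ b r′) es el with node-injective es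
  ... | el′ , er′ with ++-cancel-length (labels l) {labels l′} {a ∷ labels r} {b ∷ labels r′}
        (trans (sym (#nodes-labels l)) (trans (cong #nodes el′) (#nodes-labels l′))) el
  ... | e₁ , e₂ with ∷-injective e₂
  ... | refl , e₃ = cong₂ (λ l r → node l a r) (tree-≡ l l′ el′ e₁) (tree-≡ r r′ er′ e₃)

  insertAll-≡ : ∀ {u v} → u ↭ v → shape (insertRightToLeft u) ≡ shape (insertRightToLeft v) →
                insertRightToLeft u ≡ insertRightToLeft v
  insertAll-≡ {u} {v} p eq = tree-≡ _ _ eq (labels-≡ (BST-insertAll u) (BST-insertAll v)
    (↭-trans (labels-insertAll u) (↭-trans p (↭-sym (labels-insertAll v)))))

  module _ (k : ℕ) where

    -- Inserting only the letters of an initial or final interval amounts to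
    -- pruning the binary search tree, so the shape of the latter determines the
    -- shape of the former.
    lowTree highTree : Tree ℕ ⊤ → Tree ℕ ⊤
    lowTree  (leaf x)     = leaf x
    lowTree  (node l a r) = if does (a ≤? k) then node (lowTree l) a (lowTree r) else lowTree l
    highTree (leaf x)     = leaf x
    highTree (node l a r) = if does (k <? a) then node (highTree l) a (highTree r) else highTree r

    lowTree-accept : ∀ {a} → a ≤ k → ∀ t → lowTree (insert a t) ≡ insert a (lowTree t)
    lowTree-accept {a} p (leaf _) rewrite dec-true (a ≤? k) p = refl
    lowTree-accept {a} p (node l b r) with a <ᵇ b in eq | proofᵈ (a <? b) | b ≤ᵇ k in eq′ | proofᵈ (b ≤? k)
    ... | true | ofʸ q | true | ofʸ _ rewrite eq′ | eq = cong (λ t → node t b (lowTree r)) (lowTree-accept p l)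
    ... | true | ofʸ q | false | ofⁿ _ rewrite eq′ = lowTree-accept p l
    ... | false | ofⁿ q | true | ofʸ _ rewrite eq′ | eq = cong (node (lowTree l) b) (lowTree-accept p r)
    ... | false | ofⁿ ¬q | false | ofⁿ ¬r = ⊥-elim (¬r (≤-trans (≮⇒≥ ¬q) p))

    lowTree-reject : ∀ {a} → ¬ a ≤ k → ∀ t → lowTree (insert a t) ≡ lowTree t
    lowTree-reject {a} ¬p (leaf _) rewrite dec-false (a ≤? k) ¬p = refl
    lowTree-reject {a} ¬p (node l b r) with a <ᵇ b | proofᵈ (a <? b) | b ≤ᵇ k in eq′ | proofᵈ (b ≤? k)
    ... | true | ofʸ q | true | ofʸ r′ = ⊥-elim (¬p (≤-trans (<⇒≤ q) r′))
    ... | true | ofʸ q | false | ofⁿ _ rewrite eq′ = lowTree-reject ¬p l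
    ... | false | ofⁿ q | true | ofʸ _ rewrite eq′ = cong (node (lowTree l) b) (lowTree-reject ¬p r)
    ... | false | ofⁿ q | false | ofⁿ _ rewrite eq′ = refl

    highTree-accept : ∀ {a} → k < a → ∀ t → highTree (insert a t) ≡ insert a (highTree t)
    highTree-accept {a} p (leaf _) rewrite dec-true (k <? a) p = refl
    highTree-accept {a} p (node l b r) with a <ᵇ b in eq | proofᵈ (a <? b) | k <ᵇ b in eq′ | proofᵈ (k <? b)
    ... | true | ofʸ q | true | ofʸ _ rewrite eq′ | eq = cong (λ t → node t b (highTree r)) (highTree-accept p l)
    ... | true | ofʸ q | false | ofⁿ ¬r = ⊥-elim (¬r (<-trans p q))
    ... | false | ofⁿ q | true | ofʸ _ rewrite eq′ | eq = cong (node (highTree l) b) (highTree-accept p r)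
    ... | false | ofⁿ q | false | ofⁿ _ rewrite eq′ = highTree-accept p r

    highTree-reject : ∀ {a} → ¬ k < a → ∀ t → highTree (insert a t) ≡ highTree t
    highTree-reject {a} ¬p (leaf _) rewrite dec-false (k <? a) ¬p = refl
    highTree-reject {a} ¬p (node l b r) with a <ᵇ b | proofᵈ (a <? b) | k <ᵇ b in eq′ | proofᵈ (k <? b)
    ... | true | ofʸ q | true | ofʸ _ rewrite eq′ = cong (λ t → node t b (highTree r)) (highTree-reject ¬p l)
    ... | true | ofʸ q | false | ofⁿ _ rewrite eq′ = refl
    ... | false | ofⁿ ¬q | true | ofʸ r′ = ⊥-elim (¬p (≤-trans r′ (≮⇒≥ ¬q)))
    ... | false | ofⁿ q | false | ofⁿ _ rewrite eq′ = highTree-reject ¬p r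

    insertAll-low : ∀ w → insertRightToLeft (low k w) ≡ lowTree (insertRightToLeft w)
    insertAll-low []      = refl
    insertAll-low (a ∷ w) with a ≤? k
    ... | yes p rewrite filter-accept (_≤? k) {xs = w} p =
          trans (cong (insert a) (insertAll-low w)) (sym (lowTree-accept p (insertRightToLeft w)))
    ... | no ¬p rewrite filter-reject (_≤? k) {xs = w} ¬p =
          trans (insertAll-low w) (sym (lowTree-reject ¬p (insertRightToLeft w)))

    insertAll-high : ∀ w → insertRightToLeft (high k w) ≡ highTree (insertRightToLeft w)
    insertAll-high []      = refl
    insertAll-high (a ∷ w) with k <? a
    ... | yes p rewrite filter-accept (k <?_) {xs = w} p =
          trans (cong (insert a) (insertAll-high w)) (sym (highTree-accept p (insertRightToLeft w)))
    ... | no ¬p rewrite filter-reject (k <?_) {xs = w} ¬p =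
          trans (insertAll-high w) (sym (highTree-reject ¬p (insertRightToLeft w)))

    insert-shift : ∀ a t → insert (k + a) (Tree.mapₙ (k +_) t) ≡ Tree.mapₙ (k +_) (insert a t)
    insert-shift a (leaf _) = refl
    insert-shift a (node l b r) with a <ᵇ b | proofᵈ (a <? b)
    ... | true | ofʸ p rewrite dec-true (k + a <? k + b) (+-monoʳ-< k p) = cong (λ t → node t (k + b) _) (insert-shift a l)
    ... | false | ofⁿ ¬p rewrite dec-false (k + a <? k + b) (¬p ∘ +-cancelˡ-< k a b) = cong (node _ (k + b)) (insert-shift a r)

    insertAll-shift : ∀ w → insertRightToLeft (map (k +_) w) ≡ Tree.mapₙ (k +_) (insertRightToLeft w)
    insertAll-shift []      = refl
    insertAll-shift (a ∷ w) = trans (cong (insert (k + a)) (insertAll-shift w)) (insert-shift a (insertRightToLeft w))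

    shape-shift : ∀ t → shape (Tree.mapₙ (k +_) t) ≡ shape t
    shape-shift (leaf _)     = refl
    shape-shift (node l a r) = cong₂ (λ l r → node l tt r) (shape-shift l) (shape-shift r)

  filter-reverse : ∀ {p} {P : ℕ → Set p} (P? : ∀ a → Dec (P a)) w → filter P? (reverse w) ≡ reverse (filter P? w)
  filter-reverse P? []      = refl
  filter-reverse P? (a ∷ w)
    rewrite unfold-reverse a w | filter-++ P? (reverse w) (a ∷ []) | filter-reverse P? w with does (P? a)
  ... | true  = sym (unfold-reverse a (filter P? w))
  ... | false = ++-identityʳ _

  𝖯ʷ-low : ∀ k {u v} → u ↭ v → 𝖯ʷ u ≡ 𝖯ʷ v → 𝖯ʷ (low k u) ≡ 𝖯ʷ (low k v)
  𝖯ʷ-low k {u} {v} p eq with Productₚ.,-injective eq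
  ... | e₁ , e₂ = cong₂ _,_ (trans (sym (lemma u)) (trans (one (↭-trans (↭-reverse u) (↭-trans p (↭-sym (↭-reverse v))))
          (trans (cong shape (insertReverse u)) (trans e₁ (cong shape (sym (insertReverse v)))))) (lemma v)))
        (one p e₂)
    where
    one : ∀ {u v} → u ↭ v → shape (insertRightToLeft u) ≡ shape (insertRightToLeft v) →
          shape (insertRightToLeft (low k u)) ≡ shape (insertRightToLeft (low k v))
    one {u} {v} p e = cong shape (trans (insertAll-low k u) (trans (cong (lowTree k) (insertAll-≡ p e)) (sym (insertAll-low k v))))
    lemma : ∀ u → shape (insertRightToLeft (low k (reverse u))) ≡ shape (insertLeftToRight (low k u))
    lemma u = cong shape (trans (cong insertRightToLeft (filter-reverse (_≤? k) u)) (insertReverse (low k u)))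

  𝖯ʷ-high : ∀ k {u v} → u ↭ v → 𝖯ʷ u ≡ 𝖯ʷ v → 𝖯ʷ (high k u) ≡ 𝖯ʷ (high k v)
  𝖯ʷ-high k {u} {v} p eq with Productₚ.,-injective eq
  ... | e₁ , e₂ = cong₂ _,_ (trans (sym (lemma u)) (trans (one (↭-trans (↭-reverse u) (↭-trans p (↭-sym (↭-reverse v))))
          (trans (cong shape (insertReverse u)) (trans e₁ (cong shape (sym (insertReverse v)))))) (lemma v)))
        (one p e₂)
    where
    one : ∀ {u v} → u ↭ v → shape (insertRightToLeft u) ≡ shape (insertRightToLeft v) →
          shape (insertRightToLeft (high k u)) ≡ shape (insertRightToLeft (high k v))
    one {u} {v} p e = cong shape (trans (insertAll-high k u) (trans (cong (highTree k) (insertAll-≡ p e)) (sym (insertAll-high k v))))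
    lemma : ∀ u → shape (insertRightToLeft (high k (reverse u))) ≡ shape (insertLeftToRight (high k u))
    lemma u = cong shape (trans (cong insertRightToLeft (filter-reverse (k <?_) u)) (insertReverse (high k u)))

  𝖯ʷ-shift : ∀ k w → 𝖯ʷ (map (k +_) w) ≡ 𝖯ʷ w
  𝖯ʷ-shift k w = cong₂ _,_
    (trans (cong shape (sym (insertReverse (map (k +_) w))))
      (trans (cong (shape ∘ insertRightToLeft) (sym (reverse-map (k +_) w)))
        (trans (one (reverse w)) (cong shape (insertReverse w)))))
    (one w)
    where
    one : ∀ w → shape (insertRightToLeft (map (k +_) w)) ≡ shape (insertRightToLeft w)
    one w = trans (cong shape (insertAll-shift k w)) (shape-shift k (insertRightToLeft w))

  Annotated : Set
  Annotated = List (ℕ × Bool)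

  -- The in-order list of the letters of a tree, each with the side of the leaf
  -- that follows it; the side of the first leaf comes apart.
  annotate : Bool → Tree ℕ ⊤ → Bool × Annotated
  annotate d (leaf _)     = d , []
  annotate d (node l a r) =
    proj₁ (annotate true l) , proj₂ (annotate true l) ++ (a , proj₁ (annotate false r)) ∷ proj₂ (annotate false r)

  leafSides-annotate : ∀ d t → leafSides d (shape t) ≡ proj₁ (annotate d t) ∷ map proj₂ (proj₂ (annotate d t))
  leafSides-annotate d (leaf _)     = refl
  leafSides-annotate d (node l a r)
    rewrite leafSides-annotate true l | leafSides-annotate false r
          | map-++ proj₂ (proj₂ (annotate true l)) ((a , proj₁ (annotate false r)) ∷ proj₂ (annotate false r)) = refl

  labels-annotate : ∀ d t → map proj₁ (proj₂ (annotate d t)) ≡ labels t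
  labels-annotate d (leaf _)     = refl
  labels-annotate d (node l a r)
    rewrite map-++ proj₁ (proj₂ (annotate true l)) ((a , proj₁ (annotate false r)) ∷ proj₂ (annotate false r))
          | labels-annotate true l | labels-annotate false r = refl

  insertₐ : ℕ → Bool → Annotated → Bool × Annotated
  insertₐ z d []          = true , (z , false) ∷ []
  insertₐ z d ((a , e) ∷ s) =
    if does (z <? a) then (true , (z , false) ∷ (a , e) ∷ s)
                     else (d , (a , proj₁ (insertₐ z e s)) ∷ proj₂ (insertₐ z e s))

  insertₐ-left : ∀ {z a} → z < a → ∀ d s e s′ →
    insertₐ z d (s ++ (a , e) ∷ s′) ≡ (proj₁ (insertₐ z d s) , proj₂ (insertₐ z d s) ++ (a , e) ∷ s′)
  insertₐ-left {z} {a} p d [] e s′ rewrite dec-true (z <? a) p = refl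
  insertₐ-left {z} p d ((b , e₁) ∷ s) e s′ with z <ᵇ b | proofᵈ (z <? b)
  ... | true | ofʸ _ = refl
  ... | false | ofⁿ _ rewrite insertₐ-left p e₁ s e s′ = refl

  insertₐ-right : ∀ {z a} → ¬ z < a → ∀ d s e s′ → All (_< a) (map proj₁ s) →
    insertₐ z d (s ++ (a , e) ∷ s′) ≡ (d , s ++ (a , proj₁ (insertₐ z e s′)) ∷ proj₂ (insertₐ z e s′))
  insertₐ-right {z} {a} ¬p d [] e s′ _ rewrite dec-false (z <? a) ¬p = refl
  insertₐ-right {z} {a} ¬p d ((b , e₁) ∷ s) e s′ (q ∷ qs)
    rewrite dec-false (z <? b) (λ z<b → ¬p (<-trans z<b q)) | insertₐ-right ¬p e₁ s e s′ qs = refl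

  annotate-insert : ∀ z d {t} → BST t → annotate d (insert z t) ≡ insertₐ z (proj₁ (annotate d t)) (proj₂ (annotate d t))
  annotate-insert z d leaf = refl
  annotate-insert z d {node l a r} (node hl pl pr hr) with z <ᵇ a | proofᵈ (z <? a)
  ... | true | ofʸ p rewrite annotate-insert z true hl = sym (insertₐ-left p _ (proj₂ (annotate true l)) _ _)
  ... | false | ofⁿ ¬p rewrite annotate-insert z false hr =
        sym (insertₐ-right ¬p _ (proj₂ (annotate true l)) _ _ (subst (All (_< a)) (sym (labels-annotate true l)) pl))

  -- Whether the first occurrence of y or x in w is one of y.
  before : ℕ → ℕ → Word → Bool
  before y x []      = false
  before y x (c ∷ w) = if does (c ≟ y) then true else if does (c ≟ x) then false else before y x w

  -- In a tree obtained by inserting w from right to left, the leaf between two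
  -- consecutive letters x and y is a left child iff y occurs before x in w.
  Adjacent : Word → Annotated → Set
  Adjacent w []                          = ⊤
  Adjacent w (_ ∷ [])                    = ⊤
  Adjacent w ((x , d) ∷ (y , e) ∷ s) = d ≡ before y x w × Adjacent w ((y , e) ∷ s)

  before-skip : ∀ {z y x} w → z ≢ x → z ≢ y → before y x (z ∷ w) ≡ before y x w
  before-skip {z} {y} {x} w p q rewrite dec-false (z ≟ y) q | dec-false (z ≟ x) p = refl

  Adjacent-weaken : ∀ {z w} s → All (z ≢_) (map proj₁ s) → Adjacent w s → Adjacent (z ∷ w) s
  Adjacent-weaken []       _ _ = tt
  Adjacent-weaken (_ ∷ []) _ _ = tt
  Adjacent-weaken {z} {w} ((x , d) ∷ (y , e) ∷ s) (p ∷ q ∷ r) (eq , h)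
    = trans eq (sym (before-skip w p q)) , Adjacent-weaken ((y , e) ∷ s) (q ∷ r) h

  Adjacent-insert∷ : ∀ {z w} x d s → ¬ z < x → All (z ≢_) (x ∷ map proj₁ s) → Adjacent w ((x , d) ∷ s) →
    Adjacent (z ∷ w) ((x , proj₁ (insertₐ z d s)) ∷ proj₂ (insertₐ z d s))
  Adjacent-insert∷ {z} x d [] _ _ _ rewrite dec-true (z ≟ z) refl = refl , tt
  Adjacent-insert∷ {z} {w} x d ((y , e) ∷ s) ¬p (px ∷ py ∷ ps) (eq , h) with z <ᵇ y | proofᵈ (z <? y)
  ... | false | ofⁿ ¬q =
        trans eq (sym (before-skip w px py)) , Adjacent-insert∷ y e s ¬q (py ∷ ps) h
  ... | true | ofʸ q = eq₁ , eq₂ , Adjacent-weaken ((y , e) ∷ s) (py ∷ ps) h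
    where
    eq₁ : true ≡ before z x (z ∷ w)
    eq₁ rewrite dec-true (z ≟ z) refl = refl
    eq₂ : false ≡ before y z (z ∷ w)
    eq₂ rewrite dec-false (z ≟ y) py | dec-true (z ≟ z) refl = refl

  Adjacent-insert : ∀ {z w} d s → All (z ≢_) (map proj₁ s) → Adjacent w s → Adjacent (z ∷ w) (proj₂ (insertₐ z d s))
  Adjacent-insert d [] _ _ = tt
  Adjacent-insert {z} {w} d ((x , e) ∷ s) (px ∷ ps) h with z <ᵇ x | proofᵈ (z <? x)
  ... | true | ofʸ p = eq , Adjacent-weaken ((x , e) ∷ s) (px ∷ ps) h
    where
    eq : false ≡ before x z (z ∷ w)
    eq rewrite dec-false (z ≟ x) px | dec-true (z ≟ z) refl = refl
  ... | false | ofⁿ ¬p = Adjacent-insert∷ x e s ¬p (px ∷ ps) h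

  Adjacent-insertAll : ∀ d w → Unique w → Adjacent w (proj₂ (annotate d (insertRightToLeft w)))
  Adjacent-insertAll d []      _        = tt
  Adjacent-insertAll d (z ∷ w) (z∉ ∷ u) rewrite annotate-insert z d (BST-insertAll w) =
    Adjacent-insert (proj₁ (annotate d (insertRightToLeft w))) _
      (subst (All (z ≢_)) (sym (labels-annotate d (insertRightToLeft w))) (All-resp-↭ (↭-sym (labels-insertAll w)) z∉))
      (Adjacent-insertAll d w u)

  before-∉ˡ : ∀ {y x} w → y ∉ w → before y x w ≡ false
  before-∉ˡ [] _ = refl
  before-∉ˡ {y} {x} (c ∷ w) y∉ with c ≡ᵇ y | proofᵈ (c ≟ y) | c ≡ᵇ x | proofᵈ (c ≟ x)
  ... | true | ofʸ refl | _ | _ = ⊥-elim (y∉ (here refl))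
  ... | false | ofⁿ _ | true | ofʸ _ = refl
  ... | false | ofⁿ _ | false | ofⁿ _ = before-∉ˡ w (y∉ ∘ there)

  before-∉ʳ : ∀ {y x} w → x ∉ w → y ∈ w → before y x w ≡ true
  before-∉ʳ {y} {x} (c ∷ w) x∉ y∈ with c ≡ᵇ y | proofᵈ (c ≟ y) | c ≡ᵇ x | proofᵈ (c ≟ x)
  before-∉ʳ {y} {x} (c ∷ w) x∉ y∈           | true | ofʸ _ | _ | _ = refl
  before-∉ʳ {y} {x} (c ∷ w) x∉ y∈           | false | ofⁿ _ | true | ofʸ refl = ⊥-elim (x∉ (here refl))
  before-∉ʳ {y} {x} (c ∷ w) x∉ (here refl)  | false | ofⁿ ¬p | false | ofⁿ _ = ⊥-elim (¬p refl)
  before-∉ʳ {y} {x} (c ∷ w) x∉ (there y∈)   | false | ofⁿ _ | false | ofⁿ _ = before-∉ʳ w (x∉ ∘ there) y∈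

  before-++ : ∀ {y x} u v → y ∈ u ⊎ x ∈ u → before y x (u ++ v) ≡ before y x u
  before-++ [] v (inj₁ ())
  before-++ [] v (inj₂ ())
  before-++ {y} {x} (c ∷ u) v h with c ≡ᵇ y | proofᵈ (c ≟ y) | c ≡ᵇ x | proofᵈ (c ≟ x)
  ... | true | ofʸ _ | _ | _ = refl
  ... | false | ofⁿ _ | true | ofʸ _ = refl
  before-++ {y} {x} (c ∷ u) v (inj₁ (here refl)) | false | ofⁿ p | false | ofⁿ _ = ⊥-elim (p refl)
  before-++ {y} {x} (c ∷ u) v (inj₂ (here refl)) | false | ofⁿ _ | false | ofⁿ p = ⊥-elim (p refl)
  before-++ {y} {x} (c ∷ u) v (inj₁ (there h))   | false | ofⁿ _ | false | ofⁿ _ = before-++ u v (inj₁ h)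
  before-++ {y} {x} (c ∷ u) v (inj₂ (there h))   | false | ofⁿ _ | false | ofⁿ _ = before-++ u v (inj₂ h)

  before-reverse : ∀ {y x} w → Unique w → y ≢ x → y ∈ w → x ∈ w → before y x (reverse w) ≡ not (before y x w)
  before-reverse {y} {x} (c ∷ w) (c∉ ∷ u) y≢x y∈ x∈ rewrite unfold-reverse c w with c ≡ᵇ y | proofᵈ (c ≟ y) | c ≡ᵇ x | proofᵈ (c ≟ x)
  before-reverse {y} {x} (c ∷ w) (c∉ ∷ u) y≢x y∈ (here refl) | true | ofʸ refl | _ | _ = ⊥-elim (y≢x refl)
  before-reverse {y} {x} (c ∷ w) (c∉ ∷ u) y≢x y∈ (there x∈)  | true | ofʸ refl | _ | _ =
    trans (before-++ (reverse w) (y ∷ []) (inj₂ (∈-resp-↭ (↭-sym (↭-reverse w)) x∈)))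
          (before-∉ˡ (reverse w) (λ y∈ → All.lookup c∉ (∈-resp-↭ (↭-reverse w) y∈) refl))
  before-reverse {y} {x} (c ∷ w) (c∉ ∷ u) y≢x (here refl) x∈ | false | ofⁿ p | _ | _ = ⊥-elim (p refl)
  before-reverse {y} {x} (c ∷ w) (c∉ ∷ u) y≢x (there y∈) x∈ | false | ofⁿ _ | true | ofʸ refl =
    trans (before-++ (reverse w) (x ∷ []) (inj₁ (∈-resp-↭ (↭-sym (↭-reverse w)) y∈)))
          (before-∉ʳ (reverse w) (λ x∈ → All.lookup c∉ (∈-resp-↭ (↭-reverse w) x∈) refl)
                                 (∈-resp-↭ (↭-sym (↭-reverse w)) y∈))
  before-reverse {y} {x} (c ∷ w) (c∉ ∷ u) y≢x (there y∈) (here refl) | false | ofⁿ _ | false | ofⁿ p = ⊥-elim (p refl)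
  before-reverse {y} {x} (c ∷ w) (c∉ ∷ u) y≢x (there y∈) (there x∈) | false | ofⁿ _ | false | ofⁿ _ =
    trans (before-++ (reverse w) (c ∷ []) (inj₁ (∈-resp-↭ (↭-sym (↭-reverse w)) y∈)))
          (before-reverse w u y≢x y∈ x∈)

  Adjacent-≢ : ∀ {w} → Unique w → ∀ s s′ → map proj₁ s ≡ map proj₁ s′ → Unique (map proj₁ s) →
    All (_∈ w) (map proj₁ s) → Adjacent (reverse w) s → Adjacent w s′ →
    Pointwise _≢_ (dropLast (map proj₂ s)) (dropLast (map proj₂ s′))
  Adjacent-≢ u []       []       _ _ _ _ _ = []
  Adjacent-≢ u (_ ∷ []) (_ ∷ []) _ _ _ _ _ = []
  Adjacent-≢ {w} u ((x , d) ∷ (y , e) ∷ s) ((x′ , d′) ∷ (y′ , e′) ∷ s′) eq ((x≢y ∷ _) ∷ us) (x∈ ∷ y∈ ∷ all) (p , h) (p′ , h′)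
    with ∷-injective eq
  ... | refl , eq′ with ∷-injective eq′
  ... | refl , _ = ne ∷ Adjacent-≢ u ((y , e) ∷ s) ((y , e′) ∷ s′) eq′ us (y∈ ∷ all) h h′
    where
    ne : d ≢ d′
    ne d≡d′ = not-¬ᵇ {before y x w} refl
      (trans (trans (sym p′) (trans (sym d≡d′) p)) (before-reverse w u (≢-sym x≢y) y∈ x∈))
  Adjacent-≢ u [] (_ ∷ _) () _ _ _ _
  Adjacent-≢ u (_ ∷ []) (_ ∷ _ ∷ _) () _ _ _ _
  Adjacent-≢ u (_ ∷ _ ∷ _) (_ ∷ []) () _ _ _ _

  𝖯ʷ-twin : ∀ w → Unique w → IsTwin (𝖯ʷ w)
  𝖯ʷ-twin w u = trans (#nodes-insertAllʳ w) (sym (#nodes-insertAll w)) ,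
    subst₂ (Pointwise _≢_) (trans (canopy-annotate tˡ) (cong (canopy ∘ shape) (insertReverse w))) (canopy-annotate tʳ)
      (Adjacent-≢ u (proj₂ (annotate true tˡ)) (proj₂ (annotate true tʳ))
        (trans (labels-annotate true tˡ) (trans same (sym (labels-annotate true tʳ))))
        (subst Unique (sym (labels-annotate true tˡ)) (Unique-resp-↭ (↭-sym perm) u))
        (subst (All (_∈ w)) (sym (labels-annotate true tˡ)) (All.tabulate (∈-resp-↭ perm)))
        (Adjacent-insertAll true (reverse w) (Unique-resp-↭ (↭-sym (↭-reverse w)) u))
        (Adjacent-insertAll true w u))
    where
    tˡ tʳ : Tree ℕ ⊤
    tˡ = insertRightToLeft (reverse w)
    tʳ = insertRightToLeft w
    perm : labels tˡ ↭ w
    perm = ↭-trans (labels-insertAll (reverse w)) (↭-reverse w)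
    same : labels tˡ ≡ labels tʳ
    same = labels-≡ (BST-insertAll (reverse w)) (BST-insertAll w) (↭-trans perm (↭-sym (labels-insertAll w)))
    canopy-annotate : ∀ t → dropLast (map proj₂ (proj₂ (annotate true t))) ≡ canopy (shape t)
    canopy-annotate t rewrite leafSides-annotate true t = refl

  𝖯 : Permutation → TwinPair
  𝖯 σ = 𝖯ʷ (value σ) , [ 𝖯ʷ-twin (value σ) (proj₁ (isPermutation σ)) ]

  size-𝖯 : ∀ σ → size (𝖯 σ) ≡ ∣ σ ∣
  size-𝖯 σ = #nodes-insertAllʳ (value σ)

  NonEmpty ConnectedPair AntiConnectedPair : TwinPair → Set
  NonEmpty J          = 0 < size J
  ConnectedPair J     = ∀ σ → 𝖯 σ ≡ J → Connected σ
  AntiConnectedPair J = ∀ σ → 𝖯 σ ≡ J → AntiConnected σ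

  data _⋖_ : Word → Word → Set where
    swap : ∀ u {a b} v → a < b → (u ++ a ∷ b ∷ v) ⋖ (u ++ b ∷ a ∷ v)

  _≤ₚ_ : Permutation → Permutation → Set
  σ ≤ₚ ν = Star _⋖_ (value σ) (value ν)

  -- Both σ and ν have the common number of nodes of J₀ and J₁ as their size:
  -- _⋖_ preserves the length, and 𝖯 sends size to number of nodes.
  _≤ᴮ_ : TwinPair → TwinPair → Set
  J₀ ≤ᴮ J₁ = ∃₂ λ σ ν → σ ≤ₚ ν × 𝖯 σ ≡ J₀ × 𝖯 ν ≡ J₁

  covers : Word → List Word
  covers []          = []
  covers (a ∷ [])    = []
  covers (a ∷ b ∷ v) = (if does (a <? b) then (b ∷ a ∷ v) ∷ [] else []) ++ map (a ∷_) (covers (b ∷ v))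

  ⋖-∷ : ∀ {a u v} → u ⋖ v → (a ∷ u) ⋖ (a ∷ v)
  ⋖-∷ {a} (swap u v p) = swap (a ∷ u) v p

  ∈-covers⁺ : ∀ {u v} → u ⋖ v → v ∈ covers u
  ∈-covers⁺ (swap [] {a} {b} v p) rewrite dec-true (a <? b) p = here refl
  ∈-covers⁺ (swap (c ∷ []) {a} v p) =
    ∈-++⁺ʳ (if does (c <? a) then _ else []) (∈-map⁺ (c ∷_) (∈-covers⁺ (swap [] v p)))
  ∈-covers⁺ (swap (c ∷ d ∷ u) v p) =
    ∈-++⁺ʳ (if does (c <? d) then _ else []) (∈-map⁺ (c ∷_) (∈-covers⁺ (swap (d ∷ u) v p)))

  ∈-covers⁻ : ∀ u {v} → v ∈ covers u → u ⋖ v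
  ∈-covers⁻ (a ∷ b ∷ u) v∈ with a <ᵇ b | proofᵈ (a <? b)
  ∈-covers⁻ (a ∷ b ∷ u) (here refl) | true | ofʸ p = swap [] u p
  ∈-covers⁻ (a ∷ b ∷ u) (there v∈)  | true | ofʸ p with _ , w∈ , refl ← ∈-map⁻ (a ∷_) v∈ = ⋖-∷ (∈-covers⁻ (b ∷ u) w∈)
  ∈-covers⁻ (a ∷ b ∷ u) v∈          | false | ofⁿ _  with _ , w∈ , refl ← ∈-map⁻ (a ∷_) v∈ = ⋖-∷ (∈-covers⁻ (b ∷ u) w∈)

  -- A quantity that decreases strictly along _⋖_, which makes the
  -- reachability relation decidable.
  weight : Word → ℕ
  weight []      = 0
  weight (a ∷ w) = sum (a ∷ w) + weight w

  ⋖-sum : ∀ {u v} → u ⋖ v → sum u ≡ sum v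
  ⋖-sum (swap []      {a} {b} v p) = trans (sym (+-assoc a b (sum v))) (trans (cong (_+ sum v) (+-comm a b)) (+-assoc b a (sum v)))
  ⋖-sum (swap (c ∷ u) v p) = cong (c +_) (⋖-sum (swap u v p))

  ⋖-weight : ∀ {u v} → u ⋖ v → weight v < weight u
  ⋖-weight (swap []      {a} {b} v p) = +-mono-≤-< (≤-reflexive (sym (⋖-sum (swap [] v p)))) (+-monoˡ-< (weight v) (+-monoˡ-< (sum v) p))
  ⋖-weight (swap (c ∷ u) v p) = +-mono-≤-< (≤-reflexive (cong (c +_) (sym (⋖-sum (swap u v p))))) (⋖-weight (swap u v p))

  above : ℕ → Word → List Word
  above zero    u = u ∷ []
  above (suc n) u = u ∷ concatMap (above n) (covers u)

  ∈-above⁻ : ∀ n u {v} → v ∈ above n u → Star _⋖_ u v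
  ∈-above⁻ zero    u (here refl) = ε
  ∈-above⁻ (suc n) u (here refl) = ε
  ∈-above⁻ (suc n) u (there v∈) with ∈-concat⁻′ (map (above n) (covers u)) v∈
  ... | _ , v∈′ , c∈ with _ , c∈′ , refl ← ∈-map⁻ (above n) c∈ = ∈-covers⁻ u c∈′ ◅ ∈-above⁻ n _ v∈′

  ∈-above⁺ : ∀ n {u v} → weight u ≤ n → Star _⋖_ u v → v ∈ above n u
  ∈-above⁺ zero    p ε       = here refl
  ∈-above⁺ (suc n) p ε       = here refl
  ∈-above⁺ zero    p (c ◅ s) = ⊥-elim (n≮0 (≤-trans (⋖-weight c) p))
  ∈-above⁺ (suc n) p (c ◅ s) = there (∈-concat⁺′ (∈-above⁺ n (s≤s⁻¹ (≤-trans (⋖-weight c) p)) s) (∈-map⁺ (above n) (∈-covers⁺ c)))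

  _≤ₚ?_ : Decidable _≤ₚ_
  σ ≤ₚ? ν = map′ (∈-above⁻ _ (value σ)) (∈-above⁺ _ ≤-refl) (value ν ∈? above (weight (value σ)) (value σ))
    where open import Data.List.Membership.DecPropositional _≟ʷ_ using (_∈?_)

  any₂⁻ : ∀ {a b} {A : Set a} {Q : A → A → Set b} {xs ys} → Any (λ x → Any (Q x) ys) xs → ∃₂ Q
  any₂⁻ p = let (x , q) = Any.satisfied p ; (y , r) = Any.satisfied q in x , y , r

  ∈-permutations-size : ∀ σ {J} → 𝖯 σ ≡ J → σ ∈ permutations (size J)
  ∈-permutations-size σ {J} eq =
    subst (λ n → σ ∈ permutations n) (trans (sym (size-𝖯 σ)) (cong size eq)) (∈-permutations⁺ σ)

  _≤ᴮ?_ : Decidable _≤ᴮ_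
  J₀ ≤ᴮ? J₁ = map′ any₂⁻
    (λ (σ , ν , r) → lose (∈-permutations-size σ (proj₁ (proj₂ r))) (lose (∈-permutations-size ν (proj₂ (proj₂ r))) r))
    (any? (λ σ → any? (λ ν → σ ≤ₚ? ν ×-dec 𝖯 σ ≟ⱼ J₀ ×-dec 𝖯 ν ≟ⱼ J₁) (permutations (size J₁))) (permutations (size J₀)))

  fibre : TwinPair → List Permutation
  fibre J = filter (λ σ → 𝖯 σ ≟ⱼ J) (permutations (size J))

  fibre-unique : ∀ J → Unique (fibre J)
  fibre-unique J = filter⁺ (λ σ → 𝖯 σ ≟ⱼ J) (permutations-unique (size J))

  ∈-fibre⁺ : ∀ σ J → 𝖯 σ ≡ J → σ ∈ fibre J
  ∈-fibre⁺ σ J eq = ∈-filter⁺ (λ σ → 𝖯 σ ≟ⱼ J) (∈-permutations-size σ eq) eq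

  ∈-fibre⁻ : ∀ {σ} J → σ ∈ fibre J → 𝖯 σ ≡ J
  ∈-fibre⁻ J σ∈ = proj₂ (∈-filter⁻ (λ σ → 𝖯 σ ≟ⱼ J) {xs = permutations (size J)} σ∈)

  ∣fibre∣ : ∀ {σ} J → σ ∈ fibre J → ∣ σ ∣ ≡ size J
  ∣fibre∣ {σ} J σ∈ = trans (sym (size-𝖯 σ)) (cong size (∈-fibre⁻ J σ∈))

  fibre-words-resp : ∀ J {u v} → u ↭ v → 𝖯ʷ u ≡ 𝖯ʷ v → u ∈ map value (fibre J) → v ∈ map value (fibre J)
  fibre-words-resp J {u} {v} p eq u∈ =
    let (σ , σ∈ , eq′) = ∈-map⁻ value u∈
        perm = IsPermutation-resp-↭ (subst (_↭ v) eq′ p) (isPermutation σ)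
        τ = _,_ {P = IsPermutation} v [ perm ]
    in ∈-map⁺ value {x = τ} (∈-fibre⁺ τ J
         (trans (value-injective {v = 𝖯 τ} {w = 𝖯 σ} (trans (sym eq) (cong 𝖯ʷ eq′))) (∈-fibre⁻ J σ∈)))

open Combinatorics public

record AssociativeAlgebra {c ℓ} (R : CommutativeRing c ℓ) a ℓᵃ : Set (c ⊔ ℓ ⊔ lsuc (a ⊔ ℓᵃ)) where
  private module R = CommutativeRing R
  field
    ring : Ring a ℓᵃ
  open Ring ring public
  infixr 7 _•_
  field
    _•_          : R.Carrier → Carrier → Carrier
    isLeftModule : IsLeftModule R.ring _≈_ _+_ 0# -_ _•_
    •-*-assoc    : ∀ k x y → (k • x) * y ≈ k • (x * y)
    •-*-comm     : ∀ k x y → x * (k • y) ≈ k • (x * y)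

module _ {c ℓ} {R : CommutativeRing c ℓ} where

  sumᴬ : ∀ {a ℓᵃ} (A : AssociativeAlgebra R a ℓᵃ) →
         List (AssociativeAlgebra.Carrier A) → AssociativeAlgebra.Carrier A
  sumᴬ A = foldr _+_ 0#
    where open AssociativeAlgebra A using (_+_; 0#)

  record IsAlgebraHomomorphism {a ℓᵃ b ℓᵇ} (A : AssociativeAlgebra R a ℓᵃ) (B : AssociativeAlgebra R b ℓᵇ)
           (φ : AssociativeAlgebra.Carrier A → AssociativeAlgebra.Carrier B) : Set (c ⊔ a ⊔ ℓᵃ ⊔ ℓᵇ) where
    private
      module A = AssociativeAlgebra A
      module B = AssociativeAlgebra B
    open RingMorphisms A.rawRing B.rawRing using (IsRingHomomorphism)
    field
      isRingHomomorphism : IsRingHomomorphism φ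
      •-homo             : ∀ k x → φ (k A.• x) B.≈ k B.• φ x

  -- A is free on the family ι: every map from X to an algebra B extends along ι
  -- to a unique algebra homomorphism from A to B.
  FreeOn : ∀ {a ℓᵃ x ℓˣ} b ℓᵇ (A : AssociativeAlgebra R a ℓᵃ) (X : Setoid x ℓˣ) →
           (Setoid.Carrier X → AssociativeAlgebra.Carrier A) → Set (c ⊔ ℓ ⊔ a ⊔ ℓᵃ ⊔ x ⊔ ℓˣ ⊔ lsuc (b ⊔ ℓᵇ))
  FreeOn b ℓᵇ A X ι =
    ∀ (B : AssociativeAlgebra R b ℓᵇ) (f : Func X (AssociativeAlgebra.setoid B)) →
    ∃! (λ φ ψ → ∀ x → AssociativeAlgebra._≈_ B (φ x) (ψ x)) λ φ → IsAlgebraHomomorphism A B φ × (∀ i → AssociativeAlgebra._≈_ B (φ (ι i)) (Func.to f i))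

  record IsSubalgebra {a ℓᵃ p} (A : AssociativeAlgebra R a ℓᵃ) (P : AssociativeAlgebra.Carrier A → Set p) :
                      Set (c ⊔ a ⊔ p) where
    open AssociativeAlgebra A hiding (_-_)
    field
      +-closed : ∀ {x y} → P x → P y → P (x + y)
      0-closed : P 0#
      -‿closed : ∀ {x} → P x → P (- x)
      *-closed : ∀ {x y} → P x → P y → P (x * y)
      1-closed : P 1#
      •-closed : ∀ k {x} → P x → P (k • x)

  subalgebra : ∀ {a ℓᵃ p} (A : AssociativeAlgebra R a ℓᵃ) {P : AssociativeAlgebra.Carrier A → Set p} →
               IsSubalgebra A P → AssociativeAlgebra R (a ⊔ p) ℓᵃ
  subalgebra A {P} sub = record
    { ring = record
      { Carrier = ∃ P
      ; _≈_ = λ x y → proj₁ x ≈ proj₁ y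
      ; _+_ = λ (x , p) (y , q) → x + y , +-closed p q
      ; _*_ = λ (x , p) (y , q) → x * y , *-closed p q
      ; -_ = λ (x , p) → - x , -‿closed p
      ; 0# = 0# , 0-closed
      ; 1# = 1# , 1-closed
      ; isRing = record
        { +-isAbelianGroup = record
          { isGroup = record
            { isMonoid = record
              { isSemigroup = record
                { isMagma = record
                  { isEquivalence = record { refl = refl ; sym = sym ; trans = trans }
                  ; ∙-cong = +-cong }
                ; assoc = λ x y z → +-assoc _ _ _ }
              ; identity = (λ x → +-identityˡ _) , (λ x → +-identityʳ _) }
            ; inverse = (λ x → -‿inverseˡ _) , (λ x → -‿inverseʳ _)
            ; ⁻¹-cong = -‿cong }
          ; comm = λ x y → +-comm _ _ }
        ; *-cong = *-cong
        ; *-assoc = λ x y z → *-assoc _ _ _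
        ; *-identity = (λ x → *-identityˡ _) , (λ x → *-identityʳ _)
        ; distrib = (λ x y z → distribˡ _ _ _) , (λ x y z → distribʳ _ _ _) } }
    ; _•_ = λ k (x , p) → k • x , •-closed k p
    ; isLeftModule = record
      { isLeftSemimodule = record
        { +ᴹ-isCommutativeMonoid = record
          { isMonoid = record
            { isSemigroup = record
              { isMagma = record
                { isEquivalence = record { refl = refl ; sym = sym ; trans = trans }
                ; ∙-cong = +-cong }
              ; assoc = λ x y z → +-assoc _ _ _ }
            ; identity = (λ x → +-identityˡ _) , (λ x → +-identityʳ _) }
          ; comm = λ x y → +-comm _ _ }
        ; isPreleftSemimodule = record
          { *ₗ-cong = M.*ₗ-cong
          ; *ₗ-zeroˡ = λ x → M.*ₗ-zeroˡ _
          ; *ₗ-distribʳ = λ x k l → M.*ₗ-distribʳ _ _ _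
          ; *ₗ-identityˡ = λ x → M.*ₗ-identityˡ _
          ; *ₗ-assoc = λ k l x → M.*ₗ-assoc _ _ _
          ; *ₗ-zeroʳ = λ k → M.*ₗ-zeroʳ _
          ; *ₗ-distribˡ = λ k x y → M.*ₗ-distribˡ _ _ _ } }
      ; -ᴹ‿cong = -‿cong
      ; -ᴹ‿inverse = (λ x → -‿inverseˡ _) , (λ x → -‿inverseʳ _) }
    ; •-*-assoc = λ k x y → •-*-assoc _ _ _
    ; •-*-comm = λ k x y → •-*-comm _ _ _
    }
    where
    open AssociativeAlgebra A hiding (_-_)
    open IsSubalgebra sub
    module M = IsLeftModule isLeftModule

module Sums {c ℓ} (R : CommutativeRing c ℓ) where
  open CommutativeRing R hiding (_-_)
  open import Relation.Binary.Reasoning.Setoid setoid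
  open import Algebra.Properties.CommutativeSemigroup +-commutativeSemigroup using (interchange)

  ∑ : ∀ {a} {A : Set a} → (A → Carrier) → List A → Carrier
  ∑ f []       = 0#
  ∑ f (x ∷ xs) = f x + ∑ f xs

  ind : ∀ {p} {P : Set p} → Dec P → Carrier
  ind d = if does d then 1# else 0#

  module _ {a} {A : Set a} where

    ∑-cong-∈ : ∀ {f g : A → Carrier} xs → (∀ {x} → x ∈ xs → f x ≈ g x) → ∑ f xs ≈ ∑ g xs
    ∑-cong-∈ []       h = refl
    ∑-cong-∈ (x ∷ xs) h = +-cong (h (here ≡.refl)) (∑-cong-∈ xs (h ∘ there))

    ∑-cong : ∀ {f g : A → Carrier} xs → (∀ x → f x ≈ g x) → ∑ f xs ≈ ∑ g xs
    ∑-cong xs h = ∑-cong-∈ xs (λ {x} _ → h x)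

    ∑-++ : ∀ (f : A → Carrier) xs ys → ∑ f (xs ++ ys) ≈ ∑ f xs + ∑ f ys
    ∑-++ f []       ys = sym (+-identityˡ _)
    ∑-++ f (x ∷ xs) ys = trans (+-congˡ (∑-++ f xs ys)) (sym (+-assoc _ _ _))

    ∑-0 : ∀ (xs : List A) → ∑ (λ _ → 0#) xs ≈ 0#
    ∑-0 []       = refl
    ∑-0 (x ∷ xs) = trans (+-identityˡ _) (∑-0 xs)

    ∑-+ : ∀ (f g : A → Carrier) xs → ∑ (λ x → f x + g x) xs ≈ ∑ f xs + ∑ g xs
    ∑-+ f g []       = sym (+-identityˡ _)
    ∑-+ f g (x ∷ xs) = trans (+-congˡ (∑-+ f g xs)) (interchange _ _ _ _)

    ∑-*ˡ : ∀ k (f : A → Carrier) xs → ∑ (λ x → k * f x) xs ≈ k * ∑ f xs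
    ∑-*ˡ k f []       = sym (zeroʳ k)
    ∑-*ˡ k f (x ∷ xs) = trans (+-congˡ (∑-*ˡ k f xs)) (sym (distribˡ _ _ _))

    ∑-*ʳ : ∀ k (f : A → Carrier) xs → ∑ (λ x → f x * k) xs ≈ ∑ f xs * k
    ∑-*ʳ k f xs = trans (∑-cong xs (λ x → *-comm _ _)) (trans (∑-*ˡ k f xs) (*-comm _ _))

  module _ {a b} {A : Set a} {B : Set b} where

    ∑-map : ∀ (f : B → Carrier) (g : A → B) xs → ∑ f (map g xs) ≡ ∑ (f ∘ g) xs
    ∑-map f g []       = ≡.refl
    ∑-map f g (x ∷ xs) = ≡.cong (f (g x) +_) (∑-map f g xs)

    ∑-concatMap : ∀ (f : B → Carrier) (g : A → List B) xs → ∑ f (concatMap g xs) ≈ ∑ (λ x → ∑ f (g x)) xs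
    ∑-concatMap f g []       = refl
    ∑-concatMap f g (x ∷ xs) = trans (∑-++ f (g x) (concatMap g xs)) (+-congˡ (∑-concatMap f g xs))

    ∑-swap : ∀ (f : A → B → Carrier) xs ys → ∑ (λ x → ∑ (f x) ys) xs ≈ ∑ (λ y → ∑ (λ x → f x y) xs) ys
    ∑-swap f []       ys = sym (∑-0 ys)
    ∑-swap f (x ∷ xs) ys = trans (+-congˡ (∑-swap f xs ys)) (sym (∑-+ (f x) (λ y → ∑ (λ x → f x y) xs) ys))

  ind-⇔ : ∀ {p q} {P : Set p} {Q : Set q} (d : Dec P) (e : Dec Q) → (P → Q) → (Q → P) → ind d ≡ ind e
  ind-⇔ (yes p) (yes q) f g = ≡.refl
  ind-⇔ (yes p) (no ¬q) f g = ⊥-elim (¬q (f p))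
  ind-⇔ (no ¬p) (yes q) f g = ⊥-elim (¬p (g q))
  ind-⇔ (no ¬p) (no ¬q) f g = ≡.refl

  ind-¬ : ∀ {p} {P : Set p} (d : Dec P) → (P → ⊥) → ind d ≈ 0#
  ind-¬ (yes p) ¬p = ⊥-elim (¬p p)
  ind-¬ (no  _) _  = refl

  ind-× : ∀ {p q} {P : Set p} {Q : Set q} (d : Dec P) (e : Dec Q) → ind (d ×-dec e) ≈ ind d * ind e
  ind-× (yes p) (yes q) = sym (*-identityˡ _)
  ind-× (yes p) (no ¬q) = sym (*-identityˡ _)
  ind-× (no ¬p) e       = sym (zeroˡ _)

  if-* : ∀ (b : Bool) k → (if b then k else 0#) ≈ k * (if b then 1# else 0#)
  if-* true  k = sym (*-identityʳ k)
  if-* false k = sym (zeroʳ k)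

  ∑-ind-∉ : ∀ {a} {A : Set a} (_≟_ : DecidableEquality A) x xs → x ∉ xs → ∑ (λ y → ind (x ≟ y)) xs ≈ 0#
  ∑-ind-∉ _≟_ x []       _  = refl
  ∑-ind-∉ _≟_ x (y ∷ ys) x∉ with x ≟ y
  ... | yes eq = ⊥-elim (x∉ (here eq))
  ... | no  _  = trans (+-identityˡ _) (∑-ind-∉ _≟_ x ys (x∉ ∘ there))

  ∑-ind-∈ : ∀ {a} {A : Set a} (_≟_ : DecidableEquality A) x xs → Unique xs → x ∈ xs → ∑ (λ y → ind (x ≟ y)) xs ≈ 1#
  ∑-ind-∈ _≟_ x (y ∷ ys) (y∉ ∷ u) x∈ with x ≟ y
  ... | yes ≡.refl = trans (+-congˡ (∑-ind-∉ _≟_ x ys (λ x∈ → All.lookup y∉ x∈ ≡.refl))) (+-identityʳ _)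
  ∑-ind-∈ _≟_ x (y ∷ ys) (y∉ ∷ u) (here eq)  | no ne = ⊥-elim (ne eq)
  ∑-ind-∈ _≟_ x (y ∷ ys) (y∉ ∷ u) (there x∈) | no ne = trans (+-identityˡ _) (∑-ind-∈ _≟_ x ys u x∈)

  ∑-ind : ∀ {a p} {A : Set a} {P : Set p} (_≟_ : DecidableEquality A) x xs → Unique xs →
          (d : Dec P) → (P → x ∈ xs) → (x ∈ xs → P) → ∑ (λ y → ind (x ≟ y)) xs ≈ ind d
  ∑-ind _≟_ x xs u (yes p) f g = ∑-ind-∈ _≟_ x xs u (f p)
  ∑-ind _≟_ x xs u (no ¬p) f g = ∑-ind-∉ _≟_ x xs (¬p ∘ g)

  ∑-pick : ∀ {a} {A : Set a} (_≟_ : DecidableEquality A) (f : A → Carrier) x xs → Unique xs → x ∈ xs →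
           ∑ (λ y → ind (x ≟ y) * f y) xs ≈ f x
  ∑-pick _≟_ f x xs u x∈ = trans (∑-cong xs lemma) (trans (∑-*ʳ (f x) (λ y → ind (x ≟ y)) xs)
    (trans (*-congʳ (∑-ind-∈ _≟_ x xs u x∈)) (*-identityˡ _)))
    where
    lemma : ∀ y → ind (x ≟ y) * f y ≈ ind (x ≟ y) * f x
    lemma y with x ≟ y
    ... | yes ≡.refl = refl
    ... | no  _      = trans (zeroˡ _) (sym (zeroˡ _))

-- The free module on a set with decidable equality: formal linear
-- combinations, two of them being identified when all coefficients agree

module FreeModule {c ℓ} (R : CommutativeRing c ℓ) {B : Set} (_≟_ : DecidableEquality B) where
  open CommutativeRing R hiding (_-_)
  open Sums R
  open import Algebra.Properties.Ring ring using (-0#≈0#; -‿distribˡ-*; -‿+-comm)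
  open import Algebra.Properties.CommutativeSemigroup *-commutativeSemigroup using (x∙yz≈y∙xz)
  open import Relation.Binary.Reasoning.Setoid setoid

  LinearCombination : Set c
  LinearCombination = List (Carrier × B)

  coeff : B → LinearCombination → Carrier
  coeff b = ∑ (λ (k , b′) → if does (b ≟ b′) then k else 0#)

  infix 4 _≋_
  _≋_ : LinearCombination → LinearCombination → Set ℓ
  x ≋ y = ∀ b → coeff b x ≈ coeff b y

  infixr 7 _⊛_
  _⊛_ : Carrier → LinearCombination → LinearCombination
  k ⊛ x = map (λ (l , b) → k * l , b) x

  ⊝_ : LinearCombination → LinearCombination
  ⊝_ = map (λ (k , b) → - k , b)

  -- The linear functional extending h
  eval : (B → Carrier) → LinearCombination → Carrier
  eval h = ∑ (λ (k , b) → k * h b)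

  δ : B → B → Carrier
  δ b b′ = ind (b ≟ b′)

  coeff≈eval : ∀ b x → coeff b x ≈ eval (δ b) x
  coeff≈eval b x = ∑-cong x (λ (k , b′) → if-* (does (b ≟ b′)) k)

  ≋-eval : ∀ {x y} → (∀ b → eval (δ b) x ≈ eval (δ b) y) → x ≋ y
  ≋-eval {x} {y} h b = trans (coeff≈eval b x) (trans (h b) (sym (coeff≈eval b y)))

  eval-congʰ : ∀ {g h : B → Carrier} x → (∀ b → g b ≈ h b) → eval g x ≈ eval h x
  eval-congʰ x eq = ∑-cong x (λ (k , b) → *-congˡ (eq b))

  eval-support : ∀ h x L → Unique L → (∀ {p} → p ∈ x → proj₂ p ∈ L) → eval h x ≈ ∑ (λ b → coeff b x * h b) L
  eval-support h []            L u sub = sym (trans (∑-cong L (λ b → zeroˡ _)) (∑-0 L))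
  eval-support h ((k , b) ∷ x) L u sub = begin
    k * h b + eval h x
      ≈⟨ +-cong (sym (∑-pick _≟_ (λ b′ → k * h b′) b L u (sub (here ≡.refl)))) (eval-support h x L u (sub ∘ there)) ⟩
    ∑ (λ b′ → ind (b ≟ b′) * (k * h b′)) L + ∑ (λ b′ → coeff b′ x * h b′) L
      ≈⟨ ∑-+ _ _ L ⟨
    ∑ (λ b′ → ind (b ≟ b′) * (k * h b′) + coeff b′ x * h b′) L
      ≈⟨ ∑-cong L (λ b′ → trans (+-congʳ (lemma b′)) (sym (distribʳ _ _ _))) ⟩
    ∑ (λ b′ → coeff b′ ((k , b) ∷ x) * h b′) L ∎
    where
    lemma : ∀ b′ → ind (b ≟ b′) * (k * h b′) ≈ (if does (b′ ≟ b) then k else 0#) * h b′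
    lemma b′ = begin
      ind (b ≟ b′) * (k * h b′)   ≡⟨ ≡.cong (_* (k * h b′)) (ind-⇔ (b ≟ b′) (b′ ≟ b) ≡.sym ≡.sym) ⟩
      ind (b′ ≟ b) * (k * h b′)   ≈⟨ *-assoc _ _ _ ⟨
      (ind (b′ ≟ b) * k) * h b′   ≈⟨ *-congʳ (trans (*-comm _ _) (sym (if-* (does (b′ ≟ b)) k))) ⟩
      (if does (b′ ≟ b) then k else 0#) * h b′ ∎

  eval-cong : ∀ h {x y} → x ≋ y → eval h x ≈ eval h y
  eval-cong h {x} {y} eq = begin
    eval h x                     ≈⟨ eval-support h x L u (λ p∈ → ∈-deduplicate⁺ _≟_ (∈-++⁺ˡ (∈-map⁺ proj₂ p∈))) ⟩
    ∑ (λ b → coeff b x * h b) L  ≈⟨ ∑-cong L (λ b → *-congʳ (eq b)) ⟩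
    ∑ (λ b → coeff b y * h b) L  ≈⟨ eval-support h y L u (λ p∈ → ∈-deduplicate⁺ _≟_ (∈-++⁺ʳ (map proj₂ x) (∈-map⁺ proj₂ p∈))) ⟨
    eval h y ∎
    where
    L : List B
    L = deduplicate _≟_ (map proj₂ x ++ map proj₂ y)
    u : Unique L
    u = deduplicate-! _≟_ (map proj₂ x ++ map proj₂ y)

  coeff-∉ : ∀ b x → b ∉ map proj₂ x → coeff b x ≈ 0#
  coeff-∉ b []            _  = refl
  coeff-∉ b ((k , b′) ∷ x) b∉ with b ≟ b′
  ... | yes eq = ⊥-elim (b∉ (here eq))
  ... | no  _  = trans (+-identityˡ _) (coeff-∉ b x (b∉ ∘ there))

  eval-++ : ∀ h x y → eval h (x ++ y) ≈ eval h x + eval h y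
  eval-++ h x y = ∑-++ _ x y

  eval-⊛ : ∀ h k x → eval h (k ⊛ x) ≈ k * eval h x
  eval-⊛ h k x = trans (reflexive (∑-map _ _ x)) (trans (∑-cong x (λ _ → *-assoc _ _ _)) (∑-*ˡ k _ x))

  eval-⊝ : ∀ h x → eval h (⊝ x) ≈ - eval h x
  eval-⊝ h []            = sym -0#≈0#
  eval-⊝ h ((k , b) ∷ x) = trans (+-cong (sym (-‿distribˡ-* k (h b))) (eval-⊝ h x)) (-‿+-comm _ _)

  eval-+ʰ : ∀ (g h : B → Carrier) x → eval (λ b → g b + h b) x ≈ eval g x + eval h x
  eval-+ʰ g h x = trans (∑-cong x (λ _ → distribˡ _ _ _)) (∑-+ _ _ x)

  eval-*ʰ : ∀ k (h : B → Carrier) x → eval (λ b → k * h b) x ≈ k * eval h x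
  eval-*ʰ k h x = trans (∑-cong x (λ (l , b) → x∙yz≈y∙xz l k (h b))) (∑-*ˡ k _ x)

  eval-0ʰ : ∀ x → eval (λ _ → 0#) x ≈ 0#
  eval-0ʰ x = trans (∑-cong x (λ _ → zeroʳ _)) (∑-0 x)

  eval-∑ʰ : ∀ {a} {A : Set a} (h : A → B → Carrier) x ys → eval (λ b → ∑ (λ y → h y b) ys) x ≈ ∑ (λ y → eval (h y) x) ys
  eval-∑ʰ h x []       = eval-0ʰ x
  eval-∑ʰ h x (y ∷ ys) = trans (eval-+ʰ (h y) (λ b → ∑ (λ y → h y b) ys) x) (+-congˡ (eval-∑ʰ h x ys))

  ≋-++-cong : ∀ {x x′ y y′} → x ≋ x′ → y ≋ y′ → x ++ y ≋ x′ ++ y′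
  ≋-++-cong {x} {x′} {y} {y′} p q b =
    trans (∑-++ _ x y) (trans (+-cong (p b) (q b)) (sym (∑-++ _ x′ y′)))

  -- The algebra structure given by a product of basis elements, each of
  -- which is a sum of basis elements

  module Multiplication
    (_∙_ : B → B → List B) (e : B)
    (∙-identityˡ : ∀ a → e ∙ a ≡ a ∷ [])
    (∙-identityʳ : ∀ a → a ∙ e ≡ a ∷ [])
    (∙-assoc : ∀ π a b c → ∑ (λ p → ∑ (δ π) (p ∙ c)) (a ∙ b) ≈ ∑ (λ q → ∑ (δ π) (a ∙ q)) (b ∙ c))
    where

    infixl 7 _⊙_
    _⊙_ : LinearCombination → LinearCombination → LinearCombination
    x ⊙ y = concatMap (λ (k , a) → concatMap (λ (l , b) → map (k * l ,_) (a ∙ b)) y) x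

    eval-⊙ : ∀ h x y → eval h (x ⊙ y) ≈ eval (λ a → eval (λ b → ∑ h (a ∙ b)) y) x
    eval-⊙ h x y = trans (∑-concatMap _ _ x) (∑-cong x (λ (k , a) → begin
      ∑ (λ (k , b) → k * h b) (concatMap (λ (l , b) → map (k * l ,_) (a ∙ b)) y)
        ≈⟨ ∑-concatMap _ _ y ⟩
      ∑ (λ (l , b) → ∑ (λ (k , b) → k * h b) (map (k * l ,_) (a ∙ b))) y
        ≈⟨ ∑-cong y (λ (l , b) → trans (reflexive (∑-map _ _ (a ∙ b)))
                     (trans (∑-*ˡ (k * l) h (a ∙ b)) (*-assoc _ _ _))) ⟩
      ∑ (λ (l , b) → k * (l * ∑ h (a ∙ b))) y
        ≈⟨ ∑-*ˡ k _ y ⟩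
      k * eval (λ b → ∑ h (a ∙ b)) y ∎))

    algebra : AssociativeAlgebra R c ℓ
    algebra = record
      { ring = record
        { Carrier = LinearCombination
        ; _≈_ = _≋_
        ; _+_ = _++_
        ; _*_ = _⊙_
        ; -_ = ⊝_
        ; 0# = []
        ; 1# = (1# , e) ∷ []
        ; isRing = record
          { +-isAbelianGroup = record
            { isGroup = record
              { isMonoid = isMonoid
              ; inverse = inverse
              ; ⁻¹-cong = λ {x} {y} → ⊝-cong {x} {y} }
            ; comm = comm }
          ; *-cong = λ {x} {x′} {y} {y′} p q → ≋-eval {x ⊙ y} {x′ ⊙ y′} λ π → begin
              eval (δ π) (x ⊙ y)                                ≈⟨ eval-⊙ (δ π) x y ⟩
              eval (λ a → eval (λ b → ∑ (δ π) (a ∙ b)) y) x     ≈⟨ eval-congʰ x (λ a → eval-cong _ {y} {y′} q) ⟩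
              eval (λ a → eval (λ b → ∑ (δ π) (a ∙ b)) y′) x    ≈⟨ eval-cong _ {x} {x′} p ⟩
              eval (λ a → eval (λ b → ∑ (δ π) (a ∙ b)) y′) x′   ≈⟨ eval-⊙ (δ π) x′ y′ ⟨
              eval (δ π) (x′ ⊙ y′) ∎
          ; *-assoc = λ x y z → ≋-eval {(x ⊙ y) ⊙ z} {x ⊙ (y ⊙ z)} λ π → begin
              eval (δ π) ((x ⊙ y) ⊙ z)
                ≈⟨ eval-⊙ (δ π) (x ⊙ y) z ⟩
              eval (λ p → eval (λ c → ∑ (δ π) (p ∙ c)) z) (x ⊙ y)
                ≈⟨ eval-⊙ _ x y ⟩
              eval (λ a → eval (λ b → ∑ (λ p → eval (λ c → ∑ (δ π) (p ∙ c)) z) (a ∙ b)) y) x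
                ≈⟨ eval-congʰ x (λ a → eval-congʰ y λ b → begin
                     ∑ (λ p → eval (λ c → ∑ (δ π) (p ∙ c)) z) (a ∙ b)   ≈⟨ eval-∑ʰ (λ p c → ∑ (δ π) (p ∙ c)) z (a ∙ b) ⟨
                     eval (λ c → ∑ (λ p → ∑ (δ π) (p ∙ c)) (a ∙ b)) z   ≈⟨ eval-congʰ z (∙-assoc π a b) ⟩
                     eval (λ c → ∑ (λ q → ∑ (δ π) (a ∙ q)) (b ∙ c)) z ∎) ⟩
              eval (λ a → eval (λ b → eval (λ c → ∑ (λ q → ∑ (δ π) (a ∙ q)) (b ∙ c)) z) y) x
                ≈⟨ eval-congʰ x (λ a → sym (eval-⊙ _ y z)) ⟩
              eval (λ a → eval (λ q → ∑ (δ π) (a ∙ q)) (y ⊙ z)) x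
                ≈⟨ eval-⊙ (δ π) x (y ⊙ z) ⟨
              eval (δ π) (x ⊙ (y ⊙ z)) ∎
          ; *-identity =
              (λ x → ≋-eval {((1# , e) ∷ []) ⊙ x} {x} λ π → begin
                eval (δ π) (((1# , e) ∷ []) ⊙ x)                ≈⟨ eval-⊙ (δ π) ((1# , e) ∷ []) x ⟩
                1# * eval (λ b → ∑ (δ π) (e ∙ b)) x + 0#        ≈⟨ trans (+-identityʳ _) (*-identityˡ _) ⟩
                eval (λ b → ∑ (δ π) (e ∙ b)) x                  ≈⟨ eval-congʰ x (λ b → trans (reflexive (≡.cong (∑ (δ π)) (∙-identityˡ b))) (+-identityʳ _)) ⟩
                eval (δ π) x ∎)
            , (λ x → ≋-eval {x ⊙ ((1# , e) ∷ [])} {x} λ π → begin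
                eval (δ π) (x ⊙ ((1# , e) ∷ []))                ≈⟨ eval-⊙ (δ π) x ((1# , e) ∷ []) ⟩
                eval (λ a → 1# * ∑ (δ π) (a ∙ e) + 0#) x        ≈⟨ eval-congʰ x (λ a → trans (+-identityʳ _) (trans (*-identityˡ _)
                                                                    (trans (reflexive (≡.cong (∑ (δ π)) (∙-identityʳ a))) (+-identityʳ _)))) ⟩
                eval (δ π) x ∎)
          ; distrib =
              (λ x y z → ≋-eval {x ⊙ (y ++ z)} {x ⊙ y ++ x ⊙ z} λ π → begin
                eval (δ π) (x ⊙ (y ++ z))                       ≈⟨ eval-⊙ (δ π) x (y ++ z) ⟩
                eval (λ a → eval _ (y ++ z)) x                  ≈⟨ eval-congʰ x (λ a → eval-++ _ y z) ⟩
                eval (λ a → eval _ y + eval _ z) x              ≈⟨ eval-+ʰ _ _ x ⟩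
                eval _ x + eval _ x                             ≈⟨ +-cong (eval-⊙ (δ π) x y) (eval-⊙ (δ π) x z) ⟨
                eval (δ π) (x ⊙ y) + eval (δ π) (x ⊙ z)         ≈⟨ eval-++ (δ π) (x ⊙ y) (x ⊙ z) ⟨
                eval (δ π) (x ⊙ y ++ x ⊙ z) ∎)
            , (λ x y z → ≋-eval {(y ++ z) ⊙ x} {y ⊙ x ++ z ⊙ x} λ π → begin
                eval (δ π) ((y ++ z) ⊙ x)                       ≈⟨ eval-⊙ (δ π) (y ++ z) x ⟩
                eval _ (y ++ z)                                 ≈⟨ eval-++ _ y z ⟩
                eval _ y + eval _ z                             ≈⟨ +-cong (eval-⊙ (δ π) y x) (eval-⊙ (δ π) z x) ⟨
                eval (δ π) (y ⊙ x) + eval (δ π) (z ⊙ x)         ≈⟨ eval-++ (δ π) (y ⊙ x) (z ⊙ x) ⟨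
                eval (δ π) (y ⊙ x ++ z ⊙ x) ∎) } }
      ; _•_ = _⊛_
      ; isLeftModule = record
        { isLeftSemimodule = record
          { +ᴹ-isCommutativeMonoid = record { isMonoid = isMonoid ; comm = comm }
          ; isPreleftSemimodule = record
            { *ₗ-cong = λ {k} {l} {x} {y} k≈l x≋y → ≋-eval {k ⊛ x} {l ⊛ y} λ π →
                trans (eval-⊛ (δ π) k x) (trans (*-cong k≈l (eval-cong (δ π) {x} {y} x≋y)) (sym (eval-⊛ (δ π) l y)))
            ; *ₗ-zeroˡ = λ x → ≋-eval {0# ⊛ x} {[]} λ π → trans (eval-⊛ (δ π) 0# x) (zeroˡ _)
            ; *ₗ-distribʳ = λ x k l → ≋-eval {(k + l) ⊛ x} {k ⊛ x ++ l ⊛ x} λ π →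
                trans (eval-⊛ (δ π) (k + l) x) (trans (distribʳ _ _ _)
                  (trans (sym (+-cong (eval-⊛ (δ π) k x) (eval-⊛ (δ π) l x))) (sym (eval-++ (δ π) (k ⊛ x) (l ⊛ x)))))
            ; *ₗ-identityˡ = λ x → ≋-eval {1# ⊛ x} {x} λ π → trans (eval-⊛ (δ π) 1# x) (*-identityˡ _)
            ; *ₗ-assoc = λ k l x → ≋-eval {(k * l) ⊛ x} {k ⊛ (l ⊛ x)} λ π →
                trans (eval-⊛ (δ π) (k * l) x) (trans (*-assoc _ _ _)
                  (sym (trans (eval-⊛ (δ π) k (l ⊛ x)) (*-congˡ (eval-⊛ (δ π) l x)))))
            ; *ₗ-zeroʳ = λ k b → refl
            ; *ₗ-distribˡ = λ k x y → ≋-eval {k ⊛ (x ++ y)} {k ⊛ x ++ k ⊛ y} λ π →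
                trans (eval-⊛ (δ π) k (x ++ y)) (trans (*-congˡ (eval-++ (δ π) x y)) (trans (distribˡ _ _ _)
                  (trans (sym (+-cong (eval-⊛ (δ π) k x) (eval-⊛ (δ π) k y))) (sym (eval-++ (δ π) (k ⊛ x) (k ⊛ y)))))) } }
        ; -ᴹ‿cong = λ {x} {y} → ⊝-cong {x} {y}
        ; -ᴹ‿inverse = inverse }
      ; •-*-assoc = λ k x y → ≋-eval {(k ⊛ x) ⊙ y} {k ⊛ (x ⊙ y)} λ π → begin
          eval (δ π) ((k ⊛ x) ⊙ y)        ≈⟨ eval-⊙ (δ π) (k ⊛ x) y ⟩
          eval _ (k ⊛ x)                  ≈⟨ eval-⊛ _ k x ⟩
          k * eval _ x                    ≈⟨ *-congˡ (eval-⊙ (δ π) x y) ⟨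
          k * eval (δ π) (x ⊙ y)          ≈⟨ eval-⊛ (δ π) k (x ⊙ y) ⟨
          eval (δ π) (k ⊛ (x ⊙ y)) ∎
      ; •-*-comm = λ k x y → ≋-eval {x ⊙ (k ⊛ y)} {k ⊛ (x ⊙ y)} λ π → begin
          eval (δ π) (x ⊙ (k ⊛ y))        ≈⟨ eval-⊙ (δ π) x (k ⊛ y) ⟩
          eval (λ a → eval _ (k ⊛ y)) x   ≈⟨ eval-congʰ x (λ a → eval-⊛ _ k y) ⟩
          eval (λ a → k * eval _ y) x     ≈⟨ eval-*ʰ k _ x ⟩
          k * eval _ x                    ≈⟨ *-congˡ (eval-⊙ (δ π) x y) ⟨
          k * eval (δ π) (x ⊙ y)          ≈⟨ eval-⊛ (δ π) k (x ⊙ y) ⟨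
          eval (δ π) (k ⊛ (x ⊙ y)) ∎
      }
      where
      isMonoid : IsMonoid _≋_ _++_ []
      isMonoid = record
        { isSemigroup = record
          { isMagma = record
            { isEquivalence = record { refl = λ _ → refl ; sym = λ p b → sym (p b) ; trans = λ p q b → trans (p b) (q b) }
            ; ∙-cong = λ {x} {x′} {y} {y′} → ≋-++-cong {x} {x′} {y} {y′} }
          ; assoc = λ x y z b → reflexive (≡.cong (coeff b) (++-assoc x y z)) }
        ; identity = (λ x b → refl) , (λ x b → reflexive (≡.cong (coeff b) (++-identityʳ x))) }
      comm : ∀ x y → x ++ y ≋ y ++ x
      comm x y b = trans (∑-++ _ x y) (trans (+-comm _ _) (sym (∑-++ _ y x)))
      ⊝-cong : ∀ {x y} → x ≋ y → ⊝ x ≋ ⊝ y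
      ⊝-cong {x} {y} p = ≋-eval {⊝ x} {⊝ y} λ π →
        trans (eval-⊝ (δ π) x) (trans (-‿cong (eval-cong (δ π) {x} {y} p)) (sym (eval-⊝ (δ π) y)))
      inverse : (∀ x → ⊝ x ++ x ≋ []) × (∀ x → x ++ ⊝ x ≋ [])
      inverse = (λ x → ≋-eval {⊝ x ++ x} {[]} λ π → trans (eval-++ (δ π) (⊝ x) x) (trans (+-congʳ (eval-⊝ (δ π) x)) (-‿inverseˡ _)))
              , (λ x → ≋-eval {x ++ ⊝ x} {[]} λ π → trans (eval-++ (δ π) x (⊝ x)) (trans (+-congˡ (eval-⊝ (δ π) x)) (-‿inverseʳ _)))

unshift-shift : ∀ k w → map (k +ⁿ_) (map (_∸ k) (high k w)) ≡ high k w
unshift-shift k w = ≡.trans (≡.sym (map-∘ (high k w)))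
  (map-id-local (All.map (λ p → m+[n∸m]≡n (<⇒≤ p)) (Allₚ.all-filter (k <?_) w)))

shift-unshift : ∀ k w → map (_∸ k) (map (k +ⁿ_) w) ≡ w
shift-unshift k w = ≡.trans (≡.sym (map-∘ w)) (≡.trans (map-cong (m+n∸m≡n k) w) (map-id w))

value-map-injective : ∀ {a p} {A : Set a} {P : A → Set p} (xs ys : List [ a ∈ A ∣ P a ]) →
                      map value xs ≡ map value ys → xs ≡ ys
value-map-injective []       []       _  = ≡.refl
value-map-injective (x ∷ xs) (y ∷ ys) eq =
  ≡.cong₂ _∷_ (value-injective {v = x} {w = y} (proj₁ (∷-injective eq))) (value-map-injective xs ys (proj₂ (∷-injective eq)))

shuffle-map : ∀ {a b} {A : Set a} {B : Set b} (f : A → B) u v → shuffle (map f u) (map f v) ≡ map (map f) (shuffle u v)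
shuffle-map f []      v       = ≡.refl
shuffle-map f (a ∷ u) []      = ≡.refl
shuffle-map f (a ∷ u) (b ∷ v)
  rewrite shuffle-map f u (b ∷ v) | shuffle-map f (a ∷ u) v
        | map-++ (map f) (map (a ∷_) (shuffle u (b ∷ v))) (map (b ∷_) (shuffle (a ∷ u) v)) =
  ≡.cong₂ _++_
    (≡.trans (≡.sym (map-∘ (shuffle u (b ∷ v)))) (map-∘ (shuffle u (b ∷ v))))
    (≡.trans (≡.sym (map-∘ (shuffle (a ∷ u) v))) (map-∘ (shuffle (a ∷ u) v)))

shuffle-[] : ∀ {a} {A : Set a} (u : List A) → shuffle u [] ≡ u ∷ []
shuffle-[] []      = ≡.refl
shuffle-[] (_ ∷ _) = ≡.refl

module HopfAlgebras {c ℓ} (R : CommutativeRing c ℓ) where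
  open CommutativeRing R hiding (_-_)
  open Sums R
  open FreeModule R _≟ₚ_ public
  open import Relation.Binary.Reasoning.Setoid setoid

  shuffle-assoc : ∀ {a} {A : Set a} (h : List A → Carrier) u v w →
    ∑ (λ p → ∑ h (shuffle p w)) (shuffle u v) ≈ ∑ (λ q → ∑ h (shuffle u q)) (shuffle v w)
  shuffle-assoc h []      v       w  = trans (+-identityʳ _) (∑-cong (shuffle v w) (λ q → sym (+-identityʳ _)))
  shuffle-assoc h (a ∷ u) []      w  = refl
  shuffle-assoc h (a ∷ u) (b ∷ v) [] =
    trans (∑-cong (shuffle (a ∷ u) (b ∷ v)) (λ p → trans (reflexive (≡.cong (∑ h) (shuffle-[] p))) (+-identityʳ _)))
          (sym (+-identityʳ _))
  shuffle-assoc {A = A} h (a ∷ u) (b ∷ v) (c ∷ w) = begin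
    L h (a ∷ u) (b ∷ v) (c ∷ w)
      ≈⟨ ∑-++ _ (map (a ∷_) (shuffle u (b ∷ v))) _ ⟩
    ∑ (λ p → ∑ h (shuffle p (c ∷ w))) (map (a ∷_) (shuffle u (b ∷ v))) +
    ∑ (λ p → ∑ h (shuffle p (c ∷ w))) (map (b ∷_) (shuffle (a ∷ u) v))
      ≈⟨ +-cong (left a (shuffle u (b ∷ v))) (left b (shuffle (a ∷ u) v)) ⟩
    (L (h ∘ (a ∷_)) u (b ∷ v) (c ∷ w) + X) + (L (h ∘ (b ∷_)) (a ∷ u) v (c ∷ w) + Y)
      ≈⟨ interchange _ _ _ _ ⟩
    (L (h ∘ (a ∷_)) u (b ∷ v) (c ∷ w) + L (h ∘ (b ∷_)) (a ∷ u) v (c ∷ w)) + (X + Y)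
      ≈⟨ +-congˡ (sym (trans (∑-++ _ (map (a ∷_) (shuffle u (b ∷ v))) _)
           (reflexive (≡.cong₂ _+_ (∑-map _ (a ∷_) (shuffle u (b ∷ v))) (∑-map _ (b ∷_) (shuffle (a ∷ u) v)))))) ⟩
    (L (h ∘ (a ∷_)) u (b ∷ v) (c ∷ w) + L (h ∘ (b ∷_)) (a ∷ u) v (c ∷ w)) + L (h ∘ (c ∷_)) (a ∷ u) (b ∷ v) w
      ≈⟨ +-cong (+-cong (shuffle-assoc (h ∘ (a ∷_)) u (b ∷ v) (c ∷ w)) (shuffle-assoc (h ∘ (b ∷_)) (a ∷ u) v (c ∷ w)))
                (shuffle-assoc (h ∘ (c ∷_)) (a ∷ u) (b ∷ v) w) ⟩
    (r (h ∘ (a ∷_)) u (b ∷ v) (c ∷ w) + r (h ∘ (b ∷_)) (a ∷ u) v (c ∷ w)) + r (h ∘ (c ∷_)) (a ∷ u) (b ∷ v) w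
      ≈⟨ +-congʳ (+-congʳ (trans (∑-++ _ (map (b ∷_) (shuffle v (c ∷ w))) _)
           (reflexive (≡.cong₂ _+_ (∑-map _ (b ∷_) (shuffle v (c ∷ w))) (∑-map _ (c ∷_) (shuffle (b ∷ v) w)))))) ⟩
    ((X′ + Y′) + r (h ∘ (b ∷_)) (a ∷ u) v (c ∷ w)) + r (h ∘ (c ∷_)) (a ∷ u) (b ∷ v) w
      ≈⟨ trans (+-congʳ (xy∙z≈xz∙y _ _ _)) (+-assoc _ _ _) ⟩
    (X′ + r (h ∘ (b ∷_)) (a ∷ u) v (c ∷ w)) + (Y′ + r (h ∘ (c ∷_)) (a ∷ u) (b ∷ v) w)
      ≈⟨ +-cong (right b (shuffle v (c ∷ w))) (right c (shuffle (b ∷ v) w)) ⟨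
    ∑ (λ q → ∑ h (shuffle (a ∷ u) q)) (map (b ∷_) (shuffle v (c ∷ w))) +
    ∑ (λ q → ∑ h (shuffle (a ∷ u) q)) (map (c ∷_) (shuffle (b ∷ v) w))
      ≈⟨ ∑-++ _ (map (b ∷_) (shuffle v (c ∷ w))) _ ⟨
    r h (a ∷ u) (b ∷ v) (c ∷ w) ∎
    where
    open import Algebra.Properties.CommutativeSemigroup +-commutativeSemigroup using (interchange; xy∙z≈xz∙y)
    L r : (List A → Carrier) → List A → List A → List A → Carrier
    L h u v w = ∑ (λ p → ∑ h (shuffle p w)) (shuffle u v)
    r h u v w = ∑ (λ q → ∑ h (shuffle u q)) (shuffle v w)
    X Y X′ Y′ : Carrier
    X = ∑ (λ p → ∑ (h ∘ (c ∷_)) (shuffle (a ∷ p) w)) (shuffle u (b ∷ v))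
    Y = ∑ (λ p → ∑ (h ∘ (c ∷_)) (shuffle (b ∷ p) w)) (shuffle (a ∷ u) v)
    X′ = ∑ (λ q → ∑ (h ∘ (a ∷_)) (shuffle u (b ∷ q))) (shuffle v (c ∷ w))
    Y′ = ∑ (λ q → ∑ (h ∘ (a ∷_)) (shuffle u (c ∷ q))) (shuffle (b ∷ v) w)
    split : ∀ d e u v → ∑ h (shuffle (d ∷ u) (e ∷ v)) ≈
            ∑ (h ∘ (d ∷_)) (shuffle u (e ∷ v)) + ∑ (h ∘ (e ∷_)) (shuffle (d ∷ u) v)
    split d e u v = trans (∑-++ h (map (d ∷_) (shuffle u (e ∷ v))) _)
      (reflexive (≡.cong₂ _+_ (∑-map h (d ∷_) (shuffle u (e ∷ v))) (∑-map h (e ∷_) (shuffle (d ∷ u) v))))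
    left : ∀ d ps → ∑ (λ p → ∑ h (shuffle p (c ∷ w))) (map (d ∷_) ps) ≈
           ∑ (λ p → ∑ (h ∘ (d ∷_)) (shuffle p (c ∷ w))) ps + ∑ (λ p → ∑ (h ∘ (c ∷_)) (shuffle (d ∷ p) w)) ps
    left d ps = trans (reflexive (∑-map _ (d ∷_) ps)) (trans (∑-cong ps (λ p → split d c p w)) (∑-+ _ _ ps))
    right : ∀ d qs → ∑ (λ q → ∑ h (shuffle (a ∷ u) q)) (map (d ∷_) qs) ≈
            ∑ (λ q → ∑ (h ∘ (a ∷_)) (shuffle u (d ∷ q))) qs + ∑ (λ q → ∑ (h ∘ (d ∷_)) (shuffle (a ∷ u) q)) qs
    right d qs = trans (reflexive (∑-map _ (d ∷_) qs)) (trans (∑-cong qs (λ q → split a d u q)) (∑-+ _ _ qs))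

  ∑-refineAll : ∀ {a p} {A : Set a} {P : A → Set p} (g : A → Carrier) xs .(ps : All P xs) →
                ∑ (λ x → g (value x)) (refineAll xs ps) ≡ ∑ g xs
  ∑-refineAll g xs ps = ≡.trans (≡.sym (∑-map g value (refineAll xs ps))) (≡.cong (∑ g) (value-refineAll xs ps))

  ∑-shiftedShuffles : ∀ (g : Word → Carrier) σ ν →
    ∑ (λ π → g (value π)) (shiftedShuffles σ ν) ≡ ∑ g (shuffle (value σ) (map (∣ σ ∣ +ⁿ_) (value ν)))
  ∑-shiftedShuffles g σ ν = ∑-refineAll {P = IsPermutation} g (shuffle (value σ) (map (∣ σ ∣ +ⁿ_) (value ν))) (shuffle-isPermutation σ ν)

  shiftedShuffles-identityˡ : ∀ σ → shiftedShuffles εₚ σ ≡ σ ∷ []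
  shiftedShuffles-identityˡ σ = value-map-injective _ (σ ∷ [])
    (≡.trans (value-refineAll (shuffle [] (map (0 +ⁿ_) (value σ))) (shuffle-isPermutation εₚ σ)) (≡.cong (_∷ []) (map-id (value σ))))

  shiftedShuffles-identityʳ : ∀ σ → shiftedShuffles σ εₚ ≡ σ ∷ []
  shiftedShuffles-identityʳ σ = value-map-injective _ (σ ∷ [])
    (≡.trans (value-refineAll (shuffle (value σ) []) (shuffle-isPermutation σ εₚ)) (shuffle-[] (value σ)))

  shiftedShuffles-assoc : ∀ π σ ν τ →
    ∑ (λ p → ∑ (δ π) (shiftedShuffles p τ)) (shiftedShuffles σ ν) ≈
    ∑ (λ q → ∑ (δ π) (shiftedShuffles σ q)) (shiftedShuffles ν τ)
  shiftedShuffles-assoc π σ ν τ = begin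
    ∑ (λ p → ∑ (δ π) (shiftedShuffles p τ)) (shiftedShuffles σ ν)
      ≈⟨ ∑-cong (shiftedShuffles σ ν) (λ p → reflexive (∑-shiftedShuffles g p τ)) ⟩
    ∑ (λ p → ∑ g (shuffle (value p) (map (∣ p ∣ +ⁿ_) w))) (shiftedShuffles σ ν)
      ≡⟨ ∑-shiftedShuffles (λ p → ∑ g (shuffle p (map (length p +ⁿ_) w))) σ ν ⟩
    ∑ (λ p → ∑ g (shuffle p (map (length p +ⁿ_) w))) (shuffle u (map (m +ⁿ_) v))
      ≈⟨ ∑-cong-∈ (shuffle u (map (m +ⁿ_) v)) (λ {p} p∈ → reflexive (≡.cong (λ z → ∑ g (shuffle p z)) (shifts p p∈))) ⟩
    ∑ (λ p → ∑ g (shuffle p (map (m +ⁿ_) (map (n +ⁿ_) w)))) (shuffle u (map (m +ⁿ_) v))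
      ≈⟨ shuffle-assoc g u (map (m +ⁿ_) v) (map (m +ⁿ_) (map (n +ⁿ_) w)) ⟩
    ∑ (λ q → ∑ g (shuffle u q)) (shuffle (map (m +ⁿ_) v) (map (m +ⁿ_) (map (n +ⁿ_) w)))
      ≡⟨ ≡.cong (∑ (λ q → ∑ g (shuffle u q))) (shuffle-map (m +ⁿ_) v (map (n +ⁿ_) w)) ⟩
    ∑ (λ q → ∑ g (shuffle u q)) (map (map (m +ⁿ_)) (shuffle v (map (n +ⁿ_) w)))
      ≡⟨ ∑-map _ (map (m +ⁿ_)) (shuffle v (map (n +ⁿ_) w)) ⟩
    ∑ (λ q → ∑ g (shuffle u (map (m +ⁿ_) q))) (shuffle v (map (n +ⁿ_) w))
      ≡⟨ ∑-shiftedShuffles (λ q → ∑ g (shuffle u (map (m +ⁿ_) q))) ν τ ⟨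
    ∑ (λ q → ∑ g (shuffle u (map (m +ⁿ_) (value q)))) (shiftedShuffles ν τ)
      ≈⟨ ∑-cong (shiftedShuffles ν τ) (λ q → reflexive (≡.sym (∑-shiftedShuffles g σ q))) ⟩
    ∑ (λ q → ∑ (δ π) (shiftedShuffles σ q)) (shiftedShuffles ν τ) ∎
    where
    u v w : Word
    u = value σ
    v = value ν
    w = value τ
    m n : ℕ
    m = length u
    n = length v
    g : Word → Carrier
    g z = ind (value π ≟ʷ z)
    shifts : ∀ p → p ∈ shuffle u (map (m +ⁿ_) v) → map (length p +ⁿ_) w ≡ map (m +ⁿ_) (map (n +ⁿ_) w)
    shifts p p∈ = ≡.trans (map-cong (λ a → ≡.trans (≡.cong (_+ⁿ a) len) (+-assocⁿ m n a)) w) (map-∘ w)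
      where
      len : length p ≡ m +ⁿ n
      len = ≡.trans (↭-length (All.lookup (shuffle-↭ u (map (m +ⁿ_) v)) p∈))
              (≡.trans (length-++ u) (≡.cong (m +ⁿ_) (length-map (m +ⁿ_) v)))

  open Multiplication shiftedShuffles εₚ shiftedShuffles-identityˡ shiftedShuffles-identityʳ shiftedShuffles-assoc public

  -- The basis element 𝐅 σ is (1# , σ) ∷ [].
  FQSym : AssociativeAlgebra R c ℓ
  FQSym = algebra

  -- The sum of the 𝐅 σ over all σ with 𝖯 σ = J.
  𝐏 : TwinPair → LinearCombination
  𝐏 J = map (1# ,_) (fibre J)

  -- The value of a formal combination Σ k J of the 𝐏 J.
  combination : List (Carrier × TwinPair) → LinearCombination
  combination = concatMap (λ (k , J) → k ⊛ 𝐏 J)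

  Spanned : LinearCombination → Set (c ⊔ ℓ)
  Spanned x = ∃ λ t → x ≋ combination t

  FibreConstant : LinearCombination → Set ℓ
  FibreConstant x = ∀ σ τ → 𝖯 σ ≡ 𝖯 τ → coeff σ x ≈ coeff τ x

  count : Word → TwinPair → Carrier
  count w J = ∑ (λ σ → ind (w ≟ʷ value σ)) (fibre J)

  fibre-words-unique : ∀ J → Unique (map value (fibre J))
  fibre-words-unique J = map⁺ (λ {σ} {τ} → value-injective {v = σ} {w = τ}) (fibre-unique J)

  count-resp : ∀ J {u v} → u ↭ v → 𝖯ʷ u ≡ 𝖯ʷ v → count u J ≈ count v J
  count-resp J {u} {v} p eq = begin
    count u J                                    ≡⟨ ∑-map (λ y → ind (u ≟ʷ y)) value (fibre J) ⟨
    ∑ (λ y → ind (u ≟ʷ y)) (map value (fibre J)) ≈⟨ ∑-ind _≟ʷ_ u _ (fibre-words-unique J) (v ∈? map value (fibre J))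
                                                      (fibre-words-resp J (↭-sym p) (≡.sym eq)) (fibre-words-resp J p eq) ⟩
    ind (v ∈? map value (fibre J))               ≈⟨ ∑-ind _≟ʷ_ v _ (fibre-words-unique J) (v ∈? map value (fibre J)) id id ⟨
    ∑ (λ y → ind (v ≟ʷ y)) (map value (fibre J)) ≡⟨ ∑-map (λ y → ind (v ≟ʷ y)) value (fibre J) ⟩
    count v J ∎
    where open import Data.List.Membership.DecPropositional _≟ʷ_ using (_∈?_)

  𝖯-↭ : ∀ σ τ → 𝖯 σ ≡ 𝖯 τ → value σ ↭ value τ
  𝖯-↭ σ τ eq = permutation-↭ (isPermutation σ) (isPermutation τ)
    (≡.trans (≡.sym (size-𝖯 σ)) (≡.trans (≡.cong size eq) (size-𝖯 τ)))

  eval-𝐏 : ∀ h J → eval h (𝐏 J) ≈ ∑ h (fibre J)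
  eval-𝐏 h J = trans (reflexive (∑-map _ (1# ,_) (fibre J))) (∑-cong (fibre J) (λ _ → *-identityˡ _))

  eval-combination : ∀ h t → eval h (combination t) ≈ ∑ (λ (k , J) → k * eval h (𝐏 J)) t
  eval-combination h t = trans (∑-concatMap _ _ t) (∑-cong t (λ (k , J) → eval-⊛ h k (𝐏 J)))

  coeff-shiftedShuffles : ∀ π {J J′ σ ν} → σ ∈ fibre J → ν ∈ fibre J′ →
    ∑ (δ π) (shiftedShuffles σ ν) ≈
    ind (low (size J) (value π) ≟ʷ value σ) * ind (map (_∸ size J) (high (size J) (value π)) ≟ʷ value ν)
  coeff-shiftedShuffles π {J} {J′} {σ} {ν} σ∈ ν∈ = begin
    ∑ (δ π) (shiftedShuffles σ ν)
      ≡⟨ ∑-shiftedShuffles (λ z → ind (value π ≟ʷ z)) σ ν ⟩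
    ∑ (λ z → ind (value π ≟ʷ z)) (shuffle (value σ) (map (∣ σ ∣ +ⁿ_) (value ν)))
      ≡⟨ ≡.cong (λ k → ∑ (λ z → ind (value π ≟ʷ z)) (shuffle (value σ) (map (k +ⁿ_) (value ν)))) (∣fibre∣ J σ∈) ⟩
    ∑ (λ z → ind (value π ≟ʷ z)) (shuffle (value σ) (map (k +ⁿ_) (value ν)))
      ≈⟨ ∑-ind _≟ʷ_ (value π) _ (shuffle-unique k _ _ σ≤ ν>) (d₁ ×-dec d₂) to from ⟩
    ind (d₁ ×-dec d₂)
      ≈⟨ ind-× d₁ d₂ ⟩
    ind d₁ * ind d₂ ∎
    where
    k : ℕ
    k = size J
    d₁ : Dec (low k (value π) ≡ value σ)
    d₁ = low k (value π) ≟ʷ value σ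
    d₂ : Dec (map (_∸ k) (high k (value π)) ≡ value ν)
    d₂ = map (_∸ k) (high k (value π)) ≟ʷ value ν
    σ≤ : All (_≤ k) (value σ)
    σ≤ = All.map (λ p → ≤-trans (proj₂ p) (≤-reflexive (∣fibre∣ J σ∈))) (proj₂ (isPermutation σ))
    ν> : All (k <_) (map (k +ⁿ_) (value ν))
    ν> = Allₚ.map⁺ (All.map (λ p → ≤-trans (≤-reflexive (+-commⁿ 1 k)) (+-monoʳ-≤ k (proj₁ p))) (proj₂ (isPermutation ν)))
    to : low k (value π) ≡ value σ × map (_∸ k) (high k (value π)) ≡ value ν →
         value π ∈ shuffle (value σ) (map (k +ⁿ_) (value ν))
    to (e₁ , e₂) = ≡.subst₂ (λ x y → value π ∈ shuffle x y) e₁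
      (≡.trans (≡.sym (unshift-shift k (value π))) (≡.cong (map (k +ⁿ_)) e₂)) (∈-shuffle-low-high k (value π))
    from : value π ∈ shuffle (value σ) (map (k +ⁿ_) (value ν)) →
           low k (value π) ≡ value σ × map (_∸ k) (high k (value π)) ≡ value ν
    from π∈ = let (e₁ , e₂) = shuffle-low k (value σ) _ σ≤ ν> π∈ in
      e₁ , ≡.trans (≡.cong (map (_∸ k)) e₂) (shift-unshift k (value ν))

  coeff-𝐏⊙𝐏 : ∀ π J J′ → eval (δ π) (𝐏 J ⊙ 𝐏 J′) ≈
    count (low (size J) (value π)) J * count (map (_∸ size J) (high (size J) (value π))) J′
  coeff-𝐏⊙𝐏 π J J′ = begin
    eval (δ π) (𝐏 J ⊙ 𝐏 J′)
      ≈⟨ eval-⊙ (δ π) (𝐏 J) (𝐏 J′) ⟩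
    eval (λ σ → eval (λ ν → ∑ (δ π) (shiftedShuffles σ ν)) (𝐏 J′)) (𝐏 J)
      ≈⟨ eval-𝐏 _ J ⟩
    ∑ (λ σ → eval (λ ν → ∑ (δ π) (shiftedShuffles σ ν)) (𝐏 J′)) (fibre J)
      ≈⟨ ∑-cong (fibre J) (λ σ → eval-𝐏 _ J′) ⟩
    ∑ (λ σ → ∑ (λ ν → ∑ (δ π) (shiftedShuffles σ ν)) (fibre J′)) (fibre J)
      ≈⟨ ∑-cong-∈ (fibre J) (λ σ∈ → ∑-cong-∈ (fibre J′) (λ ν∈ → coeff-shiftedShuffles π {J} {J′} σ∈ ν∈)) ⟩
    ∑ (λ σ → ∑ (λ ν → f σ * g ν) (fibre J′)) (fibre J)
      ≈⟨ ∑-cong (fibre J) (λ σ → ∑-*ˡ (f σ) g (fibre J′)) ⟩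
    ∑ (λ σ → f σ * ∑ g (fibre J′)) (fibre J)
      ≈⟨ ∑-*ʳ _ f (fibre J) ⟩
    ∑ f (fibre J) * ∑ g (fibre J′) ∎
    where
    f g : Permutation → Carrier
    f σ = ind (low (size J) (value π) ≟ʷ value σ)
    g ν = ind (map (_∸ size J) (high (size J) (value π)) ≟ʷ value ν)

  𝐏⊙𝐏-constant : ∀ J J′ π ρ → 𝖯 π ≡ 𝖯 ρ → eval (δ π) (𝐏 J ⊙ 𝐏 J′) ≈ eval (δ ρ) (𝐏 J ⊙ 𝐏 J′)
  𝐏⊙𝐏-constant J J′ π ρ eq = trans (coeff-𝐏⊙𝐏 π J J′) (trans
    (*-cong (count-resp J (filter-↭ (_≤? k) p) (𝖯ʷ-low k p e))
            (count-resp J′ (↭-map⁺ (_∸ k) (filter-↭ (k <?_) p))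
              (≡.trans (unshift π) (≡.trans (𝖯ʷ-high k p e) (≡.sym (unshift ρ))))))
    (sym (coeff-𝐏⊙𝐏 ρ J J′)))
    where
    k : ℕ
    k = size J
    p : value π ↭ value ρ
    p = 𝖯-↭ π ρ eq
    e : 𝖯ʷ (value π) ≡ 𝖯ʷ (value ρ)
    e = ≡.cong value eq
    unshift : ∀ π → 𝖯ʷ (map (_∸ k) (high k (value π))) ≡ 𝖯ʷ (high k (value π))
    unshift π = ≡.trans (≡.sym (𝖯ʷ-shift k (map (_∸ k) (high k (value π))))) (≡.cong 𝖯ʷ (unshift-shift k (value π)))

  combination-⊙ : ∀ h s t → eval h (combination s ⊙ combination t) ≈
    ∑ (λ (k , J) → k * ∑ (λ (l , J′) → l * eval h (𝐏 J ⊙ 𝐏 J′)) t) s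
  combination-⊙ h s t = begin
    eval h (combination s ⊙ combination t)
      ≈⟨ eval-⊙ h (combination s) (combination t) ⟩
    eval (λ σ → eval (m σ) (combination t)) (combination s)
      ≈⟨ eval-combination _ s ⟩
    ∑ (λ (k , J) → k * eval (λ σ → eval (m σ) (combination t)) (𝐏 J)) s
      ≈⟨ ∑-cong s (λ (k , J) → *-congˡ (begin
           eval (λ σ → eval (m σ) (combination t)) (𝐏 J)
             ≈⟨ eval-congʰ (𝐏 J) (λ σ → eval-combination (m σ) t) ⟩
           eval (λ σ → ∑ (λ (l , J′) → l * eval (m σ) (𝐏 J′)) t) (𝐏 J)
             ≈⟨ eval-∑ʰ (λ (l , J′) σ → l * eval (m σ) (𝐏 J′)) (𝐏 J) t ⟩
           ∑ (λ (l , J′) → eval (λ σ → l * eval (m σ) (𝐏 J′)) (𝐏 J)) t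
             ≈⟨ ∑-cong t (λ (l , J′) → trans (eval-*ʰ l _ (𝐏 J)) (*-congˡ (sym (eval-⊙ h (𝐏 J) (𝐏 J′))))) ⟩
           ∑ (λ (l , J′) → l * eval h (𝐏 J ⊙ 𝐏 J′)) t ∎)) ⟩
    ∑ (λ (k , J) → k * ∑ (λ (l , J′) → l * eval h (𝐏 J ⊙ 𝐏 J′)) t) s ∎
    where
    m : Permutation → Permutation → Carrier
    m σ ν = ∑ h (shiftedShuffles σ ν)

  coeff-𝐏 : ∀ π J → eval (δ π) (𝐏 J) ≈ ind (𝖯 π ≟ⱼ J)
  coeff-𝐏 π J = trans (eval-𝐏 (δ π) J)
    (∑-ind _≟ₚ_ π (fibre J) (fibre-unique J) (𝖯 π ≟ⱼ J) (∈-fibre⁺ π J) (∈-fibre⁻ J))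

  constant⇒spanned : ∀ x → FibreConstant x → Spanned x
  constant⇒spanned x const = map (λ J → κ J (fibre J) , J) L , ≋-eval {x} {combination (map (λ J → κ J (fibre J) , J) L)} λ π → sym (begin
      eval (δ π) (combination (map (λ J → κ J (fibre J) , J) L))
        ≈⟨ eval-combination (δ π) (map (λ J → κ J (fibre J) , J) L) ⟩
      ∑ (λ (k , J) → k * eval (δ π) (𝐏 J)) (map (λ J → κ J (fibre J) , J) L)
        ≡⟨ ∑-map _ (λ J → κ J (fibre J) , J) L ⟩
      ∑ (λ J → κ J (fibre J) * eval (δ π) (𝐏 J)) L
        ≈⟨ ∑-cong L (λ J → trans (*-congˡ (coeff-𝐏 π J)) (*-comm _ _)) ⟩
      ∑ (λ J → ind (𝖯 π ≟ⱼ J) * κ J (fibre J)) L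
        ≈⟨ final π ⟩
      coeff π x
        ≈⟨ coeff≈eval π x ⟩
      eval (δ π) x ∎)
    where
    open import Data.List.Membership.DecPropositional _≟ⱼ_ using (_∈?_)
    L : List TwinPair
    L = deduplicate _≟ⱼ_ (map 𝖯 (map proj₂ x))
    κ : TwinPair → List Permutation → Carrier
    κ J []      = 0#
    κ J (σ ∷ _) = coeff σ x
    κ-fibre : ∀ π σs → π ∈ σs → (∀ {σ} → σ ∈ σs → 𝖯 σ ≡ 𝖯 π) → κ (𝖯 π) σs ≈ coeff π x
    κ-fibre π (σ ∷ σs) _ h = const σ π (h (here ≡.refl))
    final : ∀ π → ∑ (λ J → ind (𝖯 π ≟ⱼ J) * κ J (fibre J)) L ≈ coeff π x
    final π = go (𝖯 π ∈? L)
      where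
      go : Dec (𝖯 π ∈ L) → ∑ (λ J → ind (𝖯 π ≟ⱼ J) * κ J (fibre J)) L ≈ coeff π x
      go (yes π∈) = trans (∑-pick _≟ⱼ_ (λ J → κ J (fibre J)) (𝖯 π) L (deduplicate-! _≟ⱼ_ (map 𝖯 (map proj₂ x))) π∈)
        (κ-fibre π (fibre (𝖯 π)) (∈-fibre⁺ π (𝖯 π) ≡.refl) (∈-fibre⁻ (𝖯 π)))
      go (no π∉) = trans (trans (∑-cong-∈ L (λ {J} J∈ → trans (*-congʳ (vanish J J∈)) (zeroˡ _))) (∑-0 L))
        (sym (coeff-∉ π x (λ π∈ → π∉ (∈-deduplicate⁺ _≟ⱼ_ (∈-map⁺ 𝖯 π∈)))))
        where
        vanish : ∀ J → J ∈ L → ind (𝖯 π ≟ⱼ J) ≈ 0#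
        vanish J J∈ = ind-¬ (𝖯 π ≟ⱼ J) (λ eq → π∉ (≡.subst (_∈ L) (≡.sym eq) J∈))

  spanned-isSubalgebra : IsSubalgebra FQSym Spanned
  spanned-isSubalgebra = record
    { +-closed = λ {x} {y} (s , p) (t , q) → s ++ t , λ b →
        trans (≋-++-cong {x} {combination s} {y} {combination t} p q b)
              (reflexive (≡.cong (coeff b) (≡.sym (concatMap-++ _ s t))))
    ; 0-closed = [] , λ b → refl
    ; -‿closed = λ {x} p → constant⇒spanned (⊝ x) (linear x (⊝ x) (λ h → - h) -‿cong (λ π → eval-⊝ (δ π) x) p)
    ; *-closed = λ {x} {y} (s , p) (t , q) → constant⇒spanned (x ⊙ y) λ π ρ eq → begin
        coeff π (x ⊙ y)                                ≈⟨ AssociativeAlgebra.*-cong FQSym {x} {combination s} {y} {combination t} p q π ⟩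
        coeff π (combination s ⊙ combination t)        ≈⟨ coeff≈eval π (combination s ⊙ combination t) ⟩
        eval (δ π) (combination s ⊙ combination t)     ≈⟨ combination-⊙ (δ π) s t ⟩
        ∑ (λ (k , J) → k * ∑ (λ (l , J′) → l * eval (δ π) (𝐏 J ⊙ 𝐏 J′)) t) s
          ≈⟨ ∑-cong s (λ (k , J) → *-congˡ (∑-cong t (λ (l , J′) → *-congˡ (𝐏⊙𝐏-constant J J′ π ρ eq)))) ⟩
        ∑ (λ (k , J) → k * ∑ (λ (l , J′) → l * eval (δ ρ) (𝐏 J ⊙ 𝐏 J′)) t) s
          ≈⟨ combination-⊙ (δ ρ) s t ⟨
        eval (δ ρ) (combination s ⊙ combination t)     ≈⟨ coeff≈eval ρ (combination s ⊙ combination t) ⟨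
        coeff ρ (combination s ⊙ combination t)        ≈⟨ AssociativeAlgebra.*-cong FQSym {x} {combination s} {y} {combination t} p q ρ ⟨
        coeff ρ (x ⊙ y) ∎
    ; 1-closed = (1# , 𝖯 εₚ) ∷ [] , λ b → +-congʳ (if-cong (does (b ≟ₚ εₚ)) (sym (*-identityˡ 1#)))
    ; •-closed = λ k {x} p → constant⇒spanned (k ⊛ x) (linear x (k ⊛ x) (k *_) *-congˡ (λ π → eval-⊛ (δ π) k x) p)
    }
    where
    if-cong : ∀ b {k l} → k ≈ l → (if b then k else 0#) ≈ (if b then l else 0#)
    if-cong true  p = p
    if-cong false p = refl
    spanned⇒constant : ∀ x → Spanned x → FibreConstant x
    spanned⇒constant x (t , p) π ρ eq = trans (value-at π) (trans
      (∑-cong t (λ (k , J) → *-congˡ (trans (coeff-𝐏 π J) (trans (reflexive (≡.cong (λ K → ind (K ≟ⱼ J)) eq)) (sym (coeff-𝐏 ρ J))))))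
      (sym (value-at ρ)))
      where
      value-at : ∀ π → coeff π x ≈ ∑ (λ (k , J) → k * eval (δ π) (𝐏 J)) t
      value-at π = trans (p π) (trans (coeff≈eval π (combination t)) (eval-combination (δ π) t))
    linear : ∀ x y (f : Carrier → Carrier) → (∀ {k l} → k ≈ l → f k ≈ f l) →
             (∀ π → eval (δ π) y ≈ f (eval (δ π) x)) → Spanned x → FibreConstant y
    linear x y f f-cong h p π ρ eq = trans (at π) (trans (f-cong (spanned⇒constant x p π ρ eq)) (sym (at ρ)))
      where
      at : ∀ π → coeff π y ≈ f (coeff π x)
      at π = trans (coeff≈eval π y) (trans (h π) (f-cong (sym (coeff≈eval π x))))

  -- The span of the 𝐏 J inside FQSym; the coproduct plays no role here.
  Baxter : AssociativeAlgebra R (c ⊔ ℓ) ℓ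
  Baxter = subalgebra FQSym spanned-isSubalgebra

  𝐏ᴮ : TwinPair → AssociativeAlgebra.Carrier Baxter
  𝐏ᴮ J = 𝐏 J , (1# , J) ∷ [] , ≋-eval {𝐏 J} {combination ((1# , J) ∷ [])} λ π →
    sym (trans (eval-combination (δ π) ((1# , J) ∷ [])) (trans (+-identityʳ _) (*-identityˡ _)))

  -- Pairs comparable for _≤ᴮ_ have the same number of nodes, so the sums range
  -- over all J′ above, respectively below, J.
  𝐄 𝐇 : TwinPair → AssociativeAlgebra.Carrier Baxter
  𝐄 J = sumᴬ Baxter (map 𝐏ᴮ (filter (J ≤ᴮ?_) (twinPairs (size J))))
  𝐇 J = sumᴬ Baxter (map 𝐏ᴮ (filter (_≤ᴮ? J) (twinPairs (size J))))

-- Equality of generators ignores the proof of P.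

generators : (TwinPair → Set) → Setoid 0ℓ 0ℓ
generators P = On.setoid (≡.setoid TwinPair) (proj₁ {B = P})

-- The library's fields carry an apartness relation; every field in the
-- classical sense is one, with the negation of equality as apartness.

fieldRing : ∀ {c ℓ₁ ℓ₂} → HeytingField c ℓ₁ ℓ₂ → CommutativeRing c ℓ₁
fieldRing K = HeytingCommutativeRing.commutativeRing (HeytingField.heytingCommutativeRing K)

CharacteristicZero : ∀ {c ℓ} → CommutativeRing c ℓ → Set ℓ
CharacteristicZero R = ∀ n → n · 1# ≈ 0# → n ≡ 0
  where
  open CommutativeRing R using (_≈_; 0#; 1#; +-rawMonoid)
  open RawMonoidMultiples +-rawMonoid using () renaming (_×_ to _·_)

{-# OPTIONS --safe #-}

-- To a pair of trees attach the in-order sequences of the left subtree sizes of its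
-- first tree and of the right subtree sizes of its second tree.  Along the Baxter
-- order these sequences grow pointwise (a cover of the permutohedron rotates the
-- search trees), and they determine the pair.  A coefficient of 𝐄 J · 𝐄 K at π is the
-- product of the coefficients at the restrictions of π to its small and to its large
-- letters; since pruning a search tree only decreases subtree sizes, 𝐄 J · 𝐄 K is
-- 𝐏 (J ∙ K) plus terms with larger sequences, where ∙ grafts first trees to the right
-- and second trees to the left.  As every pair of twin binary trees comes from a
-- permutation, ∙ makes these pairs a monoid, which is free on the nonempty connected
-- pairs by Levi's lemma.  So the monomials in the 𝐄 J with J connected are
-- unitriangular over the basis 𝐏, whence freeness.  Reversing permutations is an
-- automorphism of FQSym that exchanges 𝐄 and 𝐇, and connected with anti-connected.

module Submission where

open import Defs
open import Algebra.Apartness.Bundles using (HeytingField)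
open import Algebra.Bundles using (CommutativeRing)
open import Algebra.Module.Structures using (IsLeftModule)
import Algebra.Morphism.Construct.Composition as Composition
open import Algebra.Morphism.Structures using (module RingMorphisms)
open import Data.Empty using (⊥-elim)
open import Data.List.Base using (List; []; _∷_; _++_; map; foldr; concatMap; deduplicate; filter; length; reverse)
open import Data.List.Membership.Propositional using (_∈_)
open import Data.List.Membership.Propositional.Properties using (∈-map⁺; ∈-deduplicate⁺; ∈-filter⁺; ∈-filter⁻)
open import Data.List.Properties using (∷-injective; filter-++; filter-all; filter-none; length-reverse; map-++; map-∘; reverse-involutive; reverse-map; ++-identityʳ)
open import Data.List.Relation.Binary.Pointwise as Pointwise using (Pointwise; []; _∷_)
open import Data.List.Relation.Unary.All as All using (All; []; _∷_)
import Data.List.Relation.Unary.All.Properties as Allₚ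
open import Data.List.Relation.Unary.Any using (here; there)
open import Data.List.Relation.Unary.Unique.DecPropositional.Properties using (deduplicate-!)
open import Data.List.Relation.Unary.Unique.Propositional using (Unique)
open import Data.List.Relation.Unary.Unique.Propositional.Properties using (filter⁺)
open import Data.Nat.Base using (ℕ; suc; z≤n; s≤s; s≤s⁻¹; _≤_; _<_; _∸_) renaming (_+_ to _+ⁿ_)
open import Data.Nat.Properties using (≤-refl; ≤-trans; m≤n⇒m≤1+n; <-≤-trans; n<1+n; _≤?_; _<?_; <⇒≱; ≤⇒≯; m<m+n)
open import Data.Product.Base using (∃; _×_; _,_; proj₁; proj₂)
open import Data.Refinement.Base using (value)
open import Data.Refinement.Properties using (value-injective)
open import Function.Base using (_∘_)
open import Function.Bundles using (Func)
open import Relation.Binary.Bundles using (Setoid)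
open import Relation.Binary.Construct.Closure.ReflexiveTransitive using (ε)
open import Relation.Binary.Definitions using (DecidableEquality)
open import Relation.Binary.PropositionalEquality as ≡ using (_≡_; _≢_)
open import Relation.Nullary using (¬_; Dec; yes; no)
open import Relation.Nullary.Decidable using (_×-dec_)

-- The relation `≤ᴮ` asserts the existence of two comparable permutations, so comparisons of the two
-- restrictions of a permutation with `J` and `K` cannot be glued directly: the witnesses need not
-- match. The coarser relation `⊑` is transitive and monotone for `⋄` by its very form, and a
-- partial order containing `≤ᴮ`, with finite ranks, is enough for a unitriangular matrix. Its rank
-- and corank are the two recursion measures: a combination of monomials is shown to vanish from
-- small sequences up, and a basis element is solved for from large sequences down. That every twin
-- pair is attained has three uses: it shows that `∙` preserves twin pairs, it turns connectedness
-- of all permutations of a fibre into irreducibility in the monoid, and it lets coordinates over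
-- `𝐏` be read off as coefficients in FQSym. Unique factorisation puts words in the generators in
-- bijection with twin pairs. Rows and columns of the matrix thus share an index set with decidable
-- equality, which words of generators carrying proofs of connectedness do not readily provide.

module TreeCombinatorics where

  open import Data.Bool.Base using (Bool; true; false)
  open import Data.Empty using (⊥-elim)
  open import Data.Irrelevant using ([_])
  open import Data.List.Base using (List; []; _∷_; _++_; map; foldr; reverse; length; drop; filter; upTo; concatMap; cartesianProduct; cartesianProductWith)
  open import Data.List.Membership.Propositional using (_∈_; lose)
  open import Data.List.Membership.Propositional.Properties using (∈-filter⁺; ∈-cartesianProductWith⁺; ∈-cartesianProductWith⁻; ∈-cartesianProduct⁺; ∈-concat⁺′; ∈-map⁺; ∈-upTo⁺)
  open import Data.List.Properties using (++-assoc; ++-identityʳ; reverse-++; reverse-involutive; reverse-injective; unfold-reverse; length-++; length-map; length-reverse; map-id; ∷-injective)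
  open import Data.List.Relation.Binary.Permutation.Propositional using (↭-sym)
  open import Data.List.Relation.Binary.Permutation.Propositional.Properties using (All-resp-↭; ↭-reverse; shift)
  open import Data.List.Relation.Binary.Pointwise as Pointwise using (Pointwise; []; _∷_)
  open import Data.List.Relation.Unary.All as All using (All; []; _∷_)
  import Data.List.Relation.Unary.All.Properties as Allₚ
  open import Data.List.Relation.Unary.AllPairs using ([]; _∷_)
  open import Data.List.Relation.Unary.Any as Any using (here; there; any?)
  open import Data.List.Relation.Unary.Unique.Propositional using (Unique)
  open import Data.List.Relation.Unary.Unique.Propositional.Properties using (map⁻; filter⁺; cartesianProductWith⁺; cartesianProduct⁺)
  open import Data.Nat.Base using (ℕ; zero; suc; _+_; _*_; _∸_; _≤_; _<_; z≤n; s≤s; s≤s⁻¹)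
  open import Data.Nat.ListAction using (sum)
  open import Data.Nat.Properties
  open import Data.Product.Base using (∃; ∃₂; _×_; _,_; proj₁; proj₂) renaming (swap to swap×)
  open import Data.Product.Properties using (,-injective)
  open import Data.Refinement.Base using (value; _,_)
  open import Data.Refinement.Properties using (value-injective)
  open import Data.Sum.Base as Sum using (_⊎_; inj₁; inj₂)
  open import Data.Tree.Binary using (Tree; leaf; node; #nodes)
  open import Data.Unit.Base using (⊤; tt)
  open import Function.Base using (_∘_)
  open import Relation.Binary.Construct.Closure.ReflexiveTransitive using (Star; ε; _◅_; _◅◅_)
  open import Relation.Binary.PropositionalEquality
  open import Relation.Nullary using (¬_; Dec; yes; no; does; recompute)
  open import Relation.Nullary.Decidable using (_×-dec_; dec-true; dec-false; map′)

  -- Sequences of subtree sizes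

  lefts rights : BinaryTree → List ℕ
  lefts  (leaf _)     = []
  lefts  (node l _ r) = lefts l ++ #nodes l ∷ lefts r
  rights (leaf _)     = []
  rights (node l _ r) = rights l ++ #nodes r ∷ rights r

  infix 4 _≼_ _⊑_
  _≼_ : List ℕ → List ℕ → Set
  _≼_ = Pointwise _≤_

  ≼-refl : ∀ {xs} → xs ≼ xs
  ≼-refl = Pointwise.refl ≤-refl

  ≼-trans : ∀ {xs ys zs} → xs ≼ ys → ys ≼ zs → xs ≼ zs
  ≼-trans = Pointwise.transitive ≤-trans

  -- The product of two Tamari orders (the one on left trees reversed), read off the
  -- in-order sequences of subtree sizes.  It contains the Baxter order, and unlike
  -- the latter it can be compared with products by pruning the trees.
  record _⊑_ (p q : TreePair) : Set where
    constructor _,_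
    field
      lefts-≼  : lefts (proj₁ p) ≼ lefts (proj₁ q)
      rights-≼ : rights (proj₂ p) ≼ rights (proj₂ q)

  _⊑?_ : ∀ p q → Dec (p ⊑ q)
  (s , s′) ⊑? (t , t′) = map′ (λ (h , h′) → h , h′) (λ (h , h′) → h , h′)
    (Pointwise.decidable _≤?_ (lefts s) (lefts t) ×-dec Pointwise.decidable _≤?_ (rights s′) (rights t′))

  ⊑-refl : ∀ {p} → p ⊑ p
  ⊑-refl = ≼-refl , ≼-refl

  ⊑-trans : ∀ {p q r} → p ⊑ q → q ⊑ r → p ⊑ r
  ⊑-trans (a , b) (c , d) = ≼-trans a c , ≼-trans b d

  -- Search trees along the permutohedron order

  insert-< : ∀ {a b l r} → a < b → insert a (node l b r) ≡ node (insert a l) b r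
  insert-< {a} {b} p rewrite dec-true (a <? b) p = refl

  insert-≥ : ∀ {a b l r} → b ≤ a → insert a (node l b r) ≡ node l b (insert a r)
  insert-≥ {a} {b} p rewrite dec-false (a <? b) (≤⇒≯ p) = refl

  infix 4 _↷_
  -- At most one rotation. `stay` covers two letters that part at some node, where their order of
  -- insertion is immaterial. The inequality between the rotated labels is what sends a later letter
  -- into the same one of `x`, `y`, `z` on both sides.
  data _↷_ : Tree ℕ ⊤ → Tree ℕ ⊤ → Set where
    stay   : ∀ {t} → t ↷ t
    rotate : ∀ {x y z a b} → a < b → node (node x a y) b z ↷ node x a (node y b z)
    inˡ    : ∀ {l l′ a r} → l ↷ l′ → node l a r ↷ node l′ a r
    inʳ    : ∀ {l a r r′} → r ↷ r′ → node l a r ↷ node l a r′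

  insert-↷ : ∀ c {s t} → s ↷ t → insert c s ↷ insert c t
  insert-↷ c stay = stay
  insert-↷ c (rotate {x} {y} {z} {a} {b} a<b) with <-≤-connex c b
  ... | inj₂ b≤c rewrite insert-≥ {l = node x a y} {z} b≤c | insert-≥ {l = x} {node y b z} (<⇒≤ (<-≤-trans a<b b≤c))
                       | insert-≥ {l = y} {z} b≤c = rotate a<b
  ... | inj₁ c<b with <-≤-connex c a
  ...   | inj₁ c<a rewrite insert-< {l = node x a y} {z} c<b | insert-< {l = x} {y} c<a | insert-< {l = x} {node y b z} c<a = rotate a<b
  ...   | inj₂ a≤c rewrite insert-< {l = node x a y} {z} c<b | insert-≥ {l = x} {y} a≤c | insert-≥ {l = x} {node y b z} a≤c
                         | insert-< {l = y} {z} c<b = rotate a<b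
  insert-↷ c (inˡ {l} {l′} {a} {r} p) with <-≤-connex c a
  ... | inj₁ c<a rewrite insert-< {l = l} {r} c<a | insert-< {l = l′} {r} c<a = inˡ (insert-↷ c p)
  ... | inj₂ a≤c rewrite insert-≥ {l = l} {r} a≤c | insert-≥ {l = l′} {r} a≤c = inˡ p
  insert-↷ c (inʳ {l} {a} {r} {r′} p) with <-≤-connex c a
  ... | inj₁ c<a rewrite insert-< {l = l} {r} c<a | insert-< {l = l} {r′} c<a = inʳ p
  ... | inj₂ a≤c rewrite insert-≥ {l = l} {r} a≤c | insert-≥ {l = l} {r′} a≤c = inʳ (insert-↷ c p)

  -- The two letters descend together until a node separates them, after which both orders give the
  -- same tree, or until they reach a leaf, where the second becomes a child of the first and the
  -- two orders differ by a rotation.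
  insert-swap-↷ : ∀ {a b} → a < b → ∀ t → insert a (insert b t) ↷ insert b (insert a t)
  insert-swap-↷ {a} {b} a<b (leaf tt) rewrite insert-< {l = leaf tt} {leaf tt} a<b | insert-≥ {l = leaf tt} {leaf tt} (<⇒≤ a<b) = rotate a<b
  insert-swap-↷ {a} {b} a<b (node l c r) with <-≤-connex a c | <-≤-connex b c
  ... | inj₁ a<c | inj₁ b<c rewrite insert-< {l = l} {r} a<c | insert-< {l = l} {r} b<c
                                  | insert-< {l = insert b l} {r} a<c | insert-< {l = insert a l} {r} b<c = inˡ (insert-swap-↷ a<b l)
  ... | inj₁ a<c | inj₂ c≤b rewrite insert-< {l = l} {r} a<c | insert-≥ {l = l} {r} c≤b
                                  | insert-< {l = l} {insert b r} a<c | insert-≥ {l = insert a l} {r} c≤b = stay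
  ... | inj₂ c≤a | inj₂ c≤b rewrite insert-≥ {l = l} {r} c≤a | insert-≥ {l = l} {r} c≤b
                                  | insert-≥ {l = l} {insert b r} c≤a | insert-≥ {l = l} {insert a r} c≤b = inʳ (insert-swap-↷ a<b r)
  ... | inj₂ c≤a | inj₁ b<c with () ← <⇒≱ (<-trans a<b b<c) c≤a

  ⋖⇒↷ : ∀ {u v} → u ⋖ v → insertRightToLeft u ↷ insertRightToLeft v
  ⋖⇒↷ (swap []      v a<b) = insert-swap-↷ a<b (insertRightToLeft v)
  ⋖⇒↷ (swap (c ∷ u) v a<b) = insert-↷ c (⋖⇒↷ (swap u v a<b))

  #nodes-↷ : ∀ {s t} → s ↷ t → #nodes (shape s) ≡ #nodes (shape t)
  #nodes-↷ stay = refl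
  #nodes-↷ (rotate {x} {y} {z} _) = trans (+-assoc (#nodes (shape x)) _ _) refl
  #nodes-↷ (inˡ p) = cong (_+ _) (#nodes-↷ p)
  #nodes-↷ (inʳ {l} p) = cong (λ n → #nodes (shape l) + suc n) (#nodes-↷ p)

  -- At the rotation one entry moves: the right subtree of `a` grows from `y` to `y` together with
  -- `b` and `z`. In `lefts-↷` the left subtree of `b` loses `x` and `a`, whence the opposite
  -- direction there.
  rights-↷ : ∀ {s t} → s ↷ t → rights (shape s) ≼ rights (shape t)
  rights-↷ stay = ≼-refl
  rights-↷ (rotate {x} {y} {z} _)
    rewrite ++-assoc (rights (shape x)) (#nodes (shape y) ∷ rights (shape y)) (#nodes (shape z) ∷ rights (shape z)) =
    Pointwise.++⁺ (≼-refl {rights (shape x)}) (m≤m+n _ _ ∷ ≼-refl)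
  rights-↷ (inˡ p) = Pointwise.++⁺ (rights-↷ p) ≼-refl
  rights-↷ (inʳ {l} p) = Pointwise.++⁺ (≼-refl {rights (shape l)}) (≤-reflexive (#nodes-↷ p) ∷ rights-↷ p)

  lefts-↷ : ∀ {s t} → s ↷ t → lefts (shape t) ≼ lefts (shape s)
  lefts-↷ stay = ≼-refl
  lefts-↷ (rotate {x} {y} {z} _)
    rewrite ++-assoc (lefts (shape x)) (#nodes (shape x) ∷ lefts (shape y)) (#nodes (shape (node x 0 y)) ∷ lefts (shape z)) =
    Pointwise.++⁺ (≼-refl {lefts (shape x)}) (≤-refl ∷ Pointwise.++⁺ (≼-refl {lefts (shape y)}) (≤-trans (n≤1+n _) (m≤n+m _ (#nodes (shape x))) ∷ ≼-refl))
  lefts-↷ (inˡ p) = Pointwise.++⁺ (lefts-↷ p) (≤-reflexive (sym (#nodes-↷ p)) ∷ ≼-refl)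
  lefts-↷ (inʳ {l} p) = Pointwise.++⁺ (≼-refl {lefts (shape l)}) (≤-refl ∷ lefts-↷ p)

  𝖯ʷ-reverseˡ : ∀ w → proj₁ (𝖯ʷ w) ≡ shape (insertRightToLeft (reverse w))
  𝖯ʷ-reverseˡ w = cong shape (sym (insertReverse w))

  𝖯ʷ-reverse : ∀ w → 𝖯ʷ (reverse w) ≡ swap× (𝖯ʷ w)
  𝖯ʷ-reverse w = cong₂ _,_
    (trans (𝖯ʷ-reverseˡ (reverse w)) (cong (shape ∘ insertRightToLeft) (reverse-involutive w)))
    (cong shape (insertReverse w))

  ⋖-reverse : ∀ {u v} → u ⋖ v → reverse v ⋖ reverse u
  ⋖-reverse (swap u {a} {b} v a<b) = subst₂ _⋖_ (sym (lemma b a)) (sym (lemma a b)) (swap (reverse v) (reverse u) a<b)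
    where
    lemma : ∀ a b → reverse (u ++ a ∷ b ∷ v) ≡ reverse v ++ b ∷ a ∷ reverse u
    lemma a b = trans (reverse-++ u (a ∷ b ∷ v))
      (trans (cong (_++ reverse u) (reverse-++ (a ∷ b ∷ []) v)) (++-assoc (reverse v) (b ∷ a ∷ []) (reverse u)))

  -- The first tree comes from the reversed word, and reversal turns a cover around; combined with
  -- the decrease in `lefts-↷`, both sequences grow.
  ⋖⇒⊑ : ∀ {u v} → u ⋖ v → 𝖯ʷ u ⊑ 𝖯ʷ v
  ⋖⇒⊑ {u} {v} p = subst₂ (λ s t → lefts s ≼ lefts t) (sym (𝖯ʷ-reverseˡ u)) (sym (𝖯ʷ-reverseˡ v)) (lefts-↷ (⋖⇒↷ (⋖-reverse p)))
                , rights-↷ (⋖⇒↷ p)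

  ≤ₚ⇒⊑ : ∀ {u v} → Star _⋖_ u v → 𝖯ʷ u ⊑ 𝖯ʷ v
  ≤ₚ⇒⊑ ε       = ⊑-refl
  ≤ₚ⇒⊑ (p ◅ s) = ⊑-trans (⋖⇒⊑ p) (≤ₚ⇒⊑ s)

  ≤ᴮ⇒⊑ : ∀ {J J′} → J ≤ᴮ J′ → value J ⊑ value J′
  ≤ᴮ⇒⊑ (_ , _ , σ≤ν , refl , refl) = ≤ₚ⇒⊑ σ≤ν

  -- Grafting

  infixr 5 _over_ _under_
  -- Both graftings concatenate the in-order readings. They differ in the root that stays on top:
  -- that of the left factor for `over`, that of the right factor for `under`.
  _over_ _under_ : {N : Set} → Tree N ⊤ → Tree N ⊤ → Tree N ⊤
  leaf _     over s = s
  node l a r over s = node l a (r over s)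
  t under leaf _     = t
  t under node l a r = node (t under l) a r

  leaf-under : {N : Set} (s : Tree N ⊤) → leaf tt under s ≡ s
  leaf-under (leaf _)     = refl
  leaf-under (node l a r) = cong (λ l → node l a r) (leaf-under l)

  over-leaf : {N : Set} (s : Tree N ⊤) → s over leaf tt ≡ s
  over-leaf (leaf _)     = refl
  over-leaf (node l a r) = cong (node l a) (over-leaf r)

  over-assoc : ∀ (s t u : BinaryTree) → (s over t) over u ≡ s over (t over u)
  over-assoc (leaf _)     t u = refl
  over-assoc (node l a r) t u = cong (node l a) (over-assoc r t u)

  under-assoc : ∀ (s t u : BinaryTree) → (s under t) under u ≡ s under (t under u)
  under-assoc s t (leaf _)     = refl
  under-assoc s t (node l a r) = cong (λ l → node l a r) (under-assoc s t l)

  shape-over : ∀ s t → shape (s over t) ≡ shape s over shape t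
  shape-over (leaf _)     t = refl
  shape-over (node l a r) t = cong (node (shape l) tt) (shape-over r t)

  shape-under : ∀ s t → shape (s under t) ≡ shape s under shape t
  shape-under s (leaf _)     = refl
  shape-under s (node l a r) = cong (λ l → node l tt (shape r)) (shape-under s l)

  #nodes-over : ∀ (s t : BinaryTree) → #nodes (s over t) ≡ #nodes s + #nodes t
  #nodes-over (leaf _)     t = refl
  #nodes-over (node l a r) t = trans (cong (λ n → #nodes l + suc n) (#nodes-over r t)) (sym (+-assoc (#nodes l) (suc (#nodes r)) _))

  #nodes-under : ∀ (s t : BinaryTree) → #nodes (s under t) ≡ #nodes s + #nodes t
  #nodes-under s (leaf _)     = sym (+-identityʳ _)
  #nodes-under s (node l a r) = trans (cong (_+ _) (#nodes-under s l)) (+-assoc (#nodes s) (#nodes l) _)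

  -- Grafting at the rightmost leaf enlarges right subtrees only, so left subtree sizes merely
  -- concatenate; `rights-under` is the symmetric fact. This is why `⊑` reads left sizes on first
  -- trees and right sizes on second trees.
  lefts-over : ∀ s t → lefts (s over t) ≡ lefts s ++ lefts t
  lefts-over (leaf _)     t = refl
  lefts-over (node l a r) t = trans (cong (λ xs → lefts l ++ #nodes l ∷ xs) (lefts-over r t)) (sym (++-assoc (lefts l) _ (lefts t)))

  rights-under : ∀ s t → rights (s under t) ≡ rights s ++ rights t
  rights-under s (leaf _)     = sym (++-identityʳ _)
  rights-under s (node l a r) = trans (cong (_++ _) (rights-under s l)) (++-assoc (rights s) (rights l) _)

  infixr 5 _⋄_
  _⋄_ : TreePair → TreePair → TreePair
  (s , s′) ⋄ (t , t′) = s over t , s′ under t′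

  insert-over : ∀ {a} t s → All (_≤ a) (labels t) → insert a (t over s) ≡ t over insert a s
  insert-over (leaf _)     s _ = refl
  insert-over (node l b r) s h with Allₚ.++⁻ʳ (labels l) h
  ... | b≤a ∷ h′ = trans (insert-≥ {l = l} b≤a) (cong (node l b) (insert-over r s h′))

  insert-under : ∀ {a} t s → All (a <_) (labels s) → insert a (t under s) ≡ insert a t under s
  insert-under t (leaf _)     _ = refl
  insert-under t (node l b r) h with Allₚ.++⁻ (labels l) h
  ... | h′ , a<b ∷ _ = trans (insert-< {r = r} a<b) (cong (λ l → node l b r) (insert-under t l h′))

  insertAll-under : ∀ u v → All (λ a → All (a <_) v) u → insertRightToLeft (u ++ v) ≡ insertRightToLeft u under insertRightToLeft v
  insertAll-under []      v _        = sym (leaf-under (insertRightToLeft v))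
  insertAll-under (a ∷ u) v (h ∷ hs) = trans (cong (insert a) (insertAll-under u v hs))
    (insert-under (insertRightToLeft u) (insertRightToLeft v) (All-resp-↭ (↭-sym (labels-insertAll v)) h))

  insertAll-over : ∀ v u → All (λ b → All (_≤ b) u) v → insertRightToLeft (v ++ u) ≡ insertRightToLeft u over insertRightToLeft v
  insertAll-over []      u _        = sym (over-leaf (insertRightToLeft u))
  insertAll-over (b ∷ v) u (h ∷ hs) = trans (cong (insert b) (insertAll-over v u hs))
    (insert-over (insertRightToLeft u) (insertRightToLeft v) (All-resp-↭ (↭-sym (labels-insertAll u)) h))

  𝖯ʷ-++ : ∀ k {u v} → All (_≤ k) u → All (k <_) v → 𝖯ʷ (u ++ v) ≡ 𝖯ʷ u ⋄ 𝖯ʷ v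
  𝖯ʷ-++ k {u} {v} hu hv = cong₂ _,_
    (begin
      shape (insertLeftToRight (u ++ v))                                                 ≡⟨ 𝖯ʷ-reverseˡ (u ++ v) ⟩
      shape (insertRightToLeft (reverse (u ++ v)))                                       ≡⟨ cong (shape ∘ insertRightToLeft) (reverse-++ u v) ⟩
      shape (insertRightToLeft (reverse v ++ reverse u))                                 ≡⟨ cong shape (insertAll-over (reverse v) (reverse u) big) ⟩
      shape (insertRightToLeft (reverse u) over insertRightToLeft (reverse v))           ≡⟨ shape-over (insertRightToLeft (reverse u)) _ ⟩
      shape (insertRightToLeft (reverse u)) over shape (insertRightToLeft (reverse v))   ≡⟨ cong₂ _over_ (𝖯ʷ-reverseˡ u) (𝖯ʷ-reverseˡ v) ⟨
      shape (insertLeftToRight u) over shape (insertLeftToRight v)                       ∎)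
    (trans (cong shape (insertAll-under u v (All.map (λ a≤k → All.map (≤-<-trans a≤k) hv) hu))) (shape-under (insertRightToLeft u) (insertRightToLeft v)))
    where
    open ≡-Reasoning
    big : All (λ b → All (_≤ b) (reverse u)) (reverse v)
    big = All-resp-↭ (↭-sym (↭-reverse v))
      (All.map (λ k<b → All-resp-↭ (↭-sym (↭-reverse u)) (All.map (λ a≤k → ≤-trans a≤k (<⇒≤ k<b)) hu)) hv)

  𝖯ʷ-/ : ∀ {u} v → IsPermutation u → IsPermutation v → 𝖯ʷ (u / v) ≡ 𝖯ʷ u ⋄ 𝖯ʷ v
  𝖯ʷ-/ {u} v (_ , ru) (_ , rv) = trans
    (𝖯ʷ-++ (length u) (All.map proj₂ ru) (Allₚ.map⁺ (All.map (λ p → m<m+n (length u) (proj₁ p)) rv)))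
    (cong (𝖯ʷ u ⋄_) (𝖯ʷ-shift (length u) v))

  -- Pruning search trees to their small or large letters

  module _ (k : ℕ) where

    lowTree-all : ∀ t → All (_≤ k) (labels t) → lowTree k t ≡ t
    lowTree-all (leaf _)     _ = refl
    lowTree-all (node l a r) h with Allₚ.++⁻ (labels l) h
    ... | hl , p ∷ hr rewrite dec-true (a ≤? k) p = cong₂ (λ l r → node l a r) (lowTree-all l hl) (lowTree-all r hr)

    highTree-all : ∀ t → All (k <_) (labels t) → highTree k t ≡ t
    highTree-all (leaf _)     _ = refl
    highTree-all (node l a r) h with Allₚ.++⁻ (labels l) h
    ... | hl , p ∷ hr rewrite dec-true (k <? a) p = cong₂ (λ l r → node l a r) (highTree-all l hl) (highTree-all r hr)

    lowTree-accept-node : ∀ {l a r} → a ≤ k → lowTree k (node l a r) ≡ node (lowTree k l) a (lowTree k r)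
    lowTree-accept-node {a = a} p rewrite dec-true (a ≤? k) p = refl

    lowTree-reject-node : ∀ {l a r} → k < a → lowTree k (node l a r) ≡ lowTree k l
    lowTree-reject-node {a = a} p rewrite dec-false (a ≤? k) (<⇒≱ p) = refl

    highTree-accept-node : ∀ {l a r} → k < a → highTree k (node l a r) ≡ node (highTree k l) a (highTree k r)
    highTree-accept-node {a = a} p rewrite dec-true (k <? a) p = refl

    highTree-reject-node : ∀ {l a r} → a ≤ k → highTree k (node l a r) ≡ highTree k r
    highTree-reject-node {a = a} p rewrite dec-false (k <? a) (≤⇒≯ p) = refl

    #nodes-lowTree : ∀ t → #nodes (shape (lowTree k t)) ≤ #nodes (shape t)
    #nodes-lowTree (leaf _)     = ≤-refl
    #nodes-lowTree (node l a r) with ≤-<-connex a k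
    ... | inj₁ a≤k rewrite lowTree-accept-node {l} {r = r} a≤k = +-mono-≤ (#nodes-lowTree l) (s≤s (#nodes-lowTree r))
    ... | inj₂ k<a rewrite lowTree-reject-node {l} {r = r} k<a = ≤-trans (#nodes-lowTree l) (m≤m+n _ _)

    #nodes-highTree : ∀ t → #nodes (shape (highTree k t)) ≤ #nodes (shape t)
    #nodes-highTree (leaf _)     = ≤-refl
    #nodes-highTree (node l a r) with ≤-<-connex a k
    ... | inj₂ k<a rewrite highTree-accept-node {l} {r = r} k<a = +-mono-≤ (#nodes-highTree l) (s≤s (#nodes-highTree r))
    ... | inj₁ a≤k rewrite highTree-reject-node {l} {r = r} a≤k = ≤-trans (#nodes-highTree r) (≤-trans (n≤1+n _) (m≤n+m _ _))

    -- The root and one of its subtrees lie on the same side of `k`, so only the other subtree is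
    -- split. The root's own entry drops at most: a root above `k` loses the small letters of its
    -- left subtree.
    lefts-low-high : ∀ {t} → BST t → lefts (shape (lowTree k t)) ++ lefts (shape (highTree k t)) ≼ lefts (shape t)
    lefts-low-high leaf = []
    lefts-low-high (node {l} {a} {r} hl pl pr hr) with ≤-<-connex a k
    ... | inj₁ a≤k rewrite lowTree-accept-node {l} {r = r} a≤k | highTree-reject-node {l} {r = r} a≤k
        | lowTree-all l (All.map (λ p → <⇒≤ (<-≤-trans p a≤k)) pl)
        | ++-assoc (lefts (shape l)) (#nodes (shape l) ∷ lefts (shape (lowTree k r))) (lefts (shape (highTree k r))) =
        Pointwise.++⁺ (≼-refl {lefts (shape l)}) (≤-refl ∷ lefts-low-high hr)
    ... | inj₂ k<a rewrite lowTree-reject-node {l} {r = r} k<a | highTree-accept-node {l} {r = r} k<a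
        | highTree-all r (All.map (<-≤-trans k<a) pr)
        | sym (++-assoc (lefts (shape (lowTree k l))) (lefts (shape (highTree k l))) (#nodes (shape (highTree k l)) ∷ lefts (shape r))) =
        Pointwise.++⁺ (lefts-low-high hl) (#nodes-highTree l ∷ ≼-refl)

    rights-low-high : ∀ {t} → BST t → rights (shape (lowTree k t)) ++ rights (shape (highTree k t)) ≼ rights (shape t)
    rights-low-high leaf = []
    rights-low-high (node {l} {a} {r} hl pl pr hr) with ≤-<-connex a k
    ... | inj₁ a≤k rewrite lowTree-accept-node {l} {r = r} a≤k | highTree-reject-node {l} {r = r} a≤k
        | lowTree-all l (All.map (λ p → <⇒≤ (<-≤-trans p a≤k)) pl)
        | ++-assoc (rights (shape l)) (#nodes (shape (lowTree k r)) ∷ rights (shape (lowTree k r))) (rights (shape (highTree k r))) =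
        Pointwise.++⁺ (≼-refl {rights (shape l)}) (#nodes-lowTree r ∷ rights-low-high hr)
    ... | inj₂ k<a rewrite lowTree-reject-node {l} {r = r} k<a | highTree-accept-node {l} {r = r} k<a
        | highTree-all r (All.map (<-≤-trans k<a) pr)
        | sym (++-assoc (rights (shape (lowTree k l))) (rights (shape (highTree k l))) (#nodes (shape r) ∷ rights (shape r))) =
        Pointwise.++⁺ (rights-low-high hl) (≤-refl ∷ ≼-refl)

    -- This bounds the support of a product: pairs below the two restrictions of `w` are, once
    -- grafted, below the pair of `w`.
    ⋄-low-high-⊑ : ∀ w → 𝖯ʷ (low k w) ⋄ 𝖯ʷ (high k w) ⊑ 𝖯ʷ w
    ⋄-low-high-⊑ w =
      subst₂ _≼_
        (trans (cong₂ (λ s t → lefts (shape s) ++ lefts (shape t))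
                      (pruned low (lowTree k) (insertAll-low k) (filter-reverse (_≤? k)))
                      (pruned high (highTree k) (insertAll-high k) (filter-reverse (k <?_))))
               (sym (lefts-over (shape (insertLeftToRight (low k w))) (shape (insertLeftToRight (high k w))))))
        (cong lefts (sym (𝖯ʷ-reverseˡ w)))
        (lefts-low-high (BST-insertAll (reverse w)))
      , subst (_≼ rights (shape (insertRightToLeft w)))
        (trans (sym (cong₂ (λ s t → rights (shape s) ++ rights (shape t)) (insertAll-low k w) (insertAll-high k w)))
               (sym (rights-under (shape (insertRightToLeft (low k w))) (shape (insertRightToLeft (high k w))))))
        (rights-low-high (BST-insertAll w))
      where
      pruned : ∀ (f : ℕ → Word → Word) (g : Tree ℕ ⊤ → Tree ℕ ⊤) → (∀ w → insertRightToLeft (f k w) ≡ g (insertRightToLeft w)) →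
               (∀ w → f k (reverse w) ≡ reverse (f k w)) → g (insertRightToLeft (reverse w)) ≡ insertLeftToRight (f k w)
      pruned f g p q = trans (sym (p (reverse w))) (trans (cong insertRightToLeft (q w)) (insertReverse (f k w)))

  ⋄-mono-⊑ : ∀ {p p′ q q′} → p ⊑ p′ → q ⊑ q′ → p ⋄ q ⊑ p′ ⋄ q′
  ⋄-mono-⊑ {s , s′} {t , t′} {u , u′} {v , v′} (a , b) (c , d) =
    subst₂ _≼_ (sym (lefts-over s u)) (sym (lefts-over t v)) (Pointwise.++⁺ a c) ,
    subst₂ _≼_ (sym (rights-under s′ u′)) (sym (rights-under t′ v′)) (Pointwise.++⁺ b d)

  -- Size sequences determine the trees, and rank functions

  length-lefts : ∀ t → length (lefts t) ≡ #nodes t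
  length-lefts (leaf _)     = refl
  length-lefts (node l _ r) = trans (length-++ (lefts l)) (cong₂ (λ m n → m + suc n) (length-lefts l) (length-lefts r))

  length-rights : ∀ t → length (rights t) ≡ #nodes t
  length-rights (leaf _)     = refl
  length-rights (node l _ r) = trans (length-++ (rights l)) (cong₂ (λ m n → m + suc n) (length-rights l) (length-rights r))

  -- Each entry is at most its position counted from `n`. It holds for `lefts` because the left
  -- subtree of a node consists of nodes that precede it in order; the offset `n` makes the
  -- induction go through concatenations.
  Below : ℕ → List ℕ → Set
  Below n []       = ⊤
  Below n (x ∷ xs) = x ≤ n × Below (suc n) xs

  Below-++ : ∀ {n} xs {ys} → Below n xs → Below (n + length xs) ys → Below n (xs ++ ys)
  Below-++ {n} []       {ys} _       q = subst (λ m → Below m ys) (+-identityʳ n) q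
  Below-++ {n} (x ∷ xs) {ys} (h , p) q = h , Below-++ xs p (subst (λ m → Below m ys) (+-suc n (length xs)) q)

  Below-lookup : ∀ {n} xs {y ys} → Below n (xs ++ y ∷ ys) → y ≤ n + length xs
  Below-lookup {n} []       (p , _) = ≤-trans p (m≤m+n n 0)
  Below-lookup {n} (x ∷ xs) (_ , p) = ≤-trans (Below-lookup xs p) (≤-reflexive (sym (+-suc n (length xs))))

  lefts-Below : ∀ n t → Below n (lefts t)
  lefts-Below n (leaf _)     = tt
  lefts-Below n (node l _ r) = Below-++ (lefts l) (lefts-Below n l)
    (≤-trans (≤-reflexive (sym (length-lefts l))) (m≤n+m _ n) , lefts-Below _ r)

  -- The root is the last entry equal to its own index.
  split-unique : ∀ {m m′} xs xs′ {ys ys′} → length xs ≤ m → length xs′ ≤ m′ → Below 0 ys → Below 0 ys′ →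
                 xs ++ m ∷ ys ≡ xs′ ++ m′ ∷ ys′ → length xs ≡ length xs′
  split-unique []       []         _ _  _ _ _ = refl
  split-unique []       (x ∷ xs′) _ p′ b _ eq with refl , refl ← ∷-injective eq = ⊥-elim (<⇒≱ p′ (Below-lookup xs′ b))
  split-unique (x ∷ xs) []         p _  _ b eq with refl , refl ← ∷-injective eq = ⊥-elim (<⇒≱ p (Below-lookup xs b))
  split-unique (x ∷ xs) (x′ ∷ xs′) p p′ b b′ eq =
    cong suc (split-unique xs xs′ (<⇒≤ p) (<⇒≤ p′) b b′ (proj₂ (∷-injective eq)))

  lefts-injective : ∀ s t → lefts s ≡ lefts t → s ≡ t
  lefts-injective (leaf _)     (leaf _)       _  = refl
  lefts-injective (leaf _)     (node l _ r)   eq with () ← trans (cong length eq) (trans (length-lefts (node l tt r)) (+-suc (#nodes l) _))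
  lefts-injective (node l _ r) (leaf _)       eq with () ← trans (sym (cong length eq)) (trans (length-lefts (node l tt r)) (+-suc (#nodes l) _))
  lefts-injective (node l _ r) (node l′ _ r′) eq with
    ++-cancel-length (lefts l) {lefts l′} (split-unique (lefts l) (lefts l′) (≤-reflexive (length-lefts l)) (≤-reflexive (length-lefts l′))
      (lefts-Below 0 r) (lefts-Below 0 r′) eq) eq
  ... | e₁ , e₂ = cong₂ (λ l r → node l tt r) (lefts-injective l l′ e₁) (lefts-injective r r′ (proj₂ (∷-injective e₂)))

  -- Serves to carry `lefts-injective` over to `rights`.
  reflect : BinaryTree → BinaryTree
  reflect (leaf _)     = leaf tt
  reflect (node l _ r) = node (reflect r) tt (reflect l)

  reflect-involutive : ∀ t → reflect (reflect t) ≡ t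
  reflect-involutive (leaf _)     = refl
  reflect-involutive (node l _ r) = cong₂ (λ l r → node l tt r) (reflect-involutive l) (reflect-involutive r)

  #nodes-reflect : ∀ t → #nodes (reflect t) ≡ #nodes t
  #nodes-reflect (leaf _)     = refl
  #nodes-reflect (node l _ r) = trans (cong₂ (λ m n → m + suc n) (#nodes-reflect r) (#nodes-reflect l))
    (trans (+-suc (#nodes r) (#nodes l)) (trans (cong suc (+-comm (#nodes r) (#nodes l))) (sym (+-suc (#nodes l) (#nodes r)))))

  rights-reflect : ∀ t → rights t ≡ reverse (lefts (reflect t))
  rights-reflect (leaf _)     = refl
  rights-reflect (node l _ r) = begin
    rights l ++ #nodes r ∷ rights r
      ≡⟨ cong₂ (λ xs ys → xs ++ #nodes r ∷ ys) (rights-reflect l) (rights-reflect r) ⟩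
    reverse (lefts (reflect l)) ++ #nodes r ∷ reverse (lefts (reflect r))
      ≡⟨ ++-assoc (reverse (lefts (reflect l))) (#nodes r ∷ []) _ ⟨
    (reverse (lefts (reflect l)) ++ #nodes r ∷ []) ++ reverse (lefts (reflect r))
      ≡⟨ cong (_++ reverse (lefts (reflect r))) (unfold-reverse (#nodes r) (lefts (reflect l))) ⟨
    reverse (#nodes r ∷ lefts (reflect l)) ++ reverse (lefts (reflect r))
      ≡⟨ reverse-++ (lefts (reflect r)) (#nodes r ∷ lefts (reflect l)) ⟨
    reverse (lefts (reflect r) ++ #nodes r ∷ lefts (reflect l))
      ≡⟨ cong (λ n → reverse (lefts (reflect r) ++ n ∷ lefts (reflect l))) (#nodes-reflect r) ⟨
    reverse (lefts (reflect r) ++ #nodes (reflect r) ∷ lefts (reflect l)) ∎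
    where open ≡-Reasoning

  rights-injective : ∀ s t → rights s ≡ rights t → s ≡ t
  rights-injective s t eq = trans (sym (reflect-involutive s)) (trans (cong reflect (lefts-injective (reflect s) (reflect t)
    (reverse-injective (trans (sym (rights-reflect s)) (trans eq (rights-reflect t)))))) (reflect-involutive t))

  ≼⇒sum≤ : ∀ {xs ys} → xs ≼ ys → sum xs ≤ sum ys
  ≼⇒sum≤ []       = z≤n
  ≼⇒sum≤ (p ∷ ps) = +-mono-≤ p (≼⇒sum≤ ps)

  ≼∧sum≥⇒≡ : ∀ {xs ys} → xs ≼ ys → sum ys ≤ sum xs → xs ≡ ys
  ≼∧sum≥⇒≡ []       _ = refl
  ≼∧sum≥⇒≡ {x ∷ xs} {y ∷ ys} (p ∷ ps) q with m≤n⇒m<n∨m≡n p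
  ... | inj₁ x<y  = ⊥-elim (<⇒≱ (+-mono-<-≤ x<y (≼⇒sum≤ ps)) q)
  ... | inj₂ refl = cong (x ∷_) (≼∧sum≥⇒≡ ps (+-cancelˡ-≤ x _ _ q))

  rank : TreePair → ℕ
  rank (s , t) = sum (lefts s) + sum (rights t)

  -- Pointwise comparable sequences with the same sum are equal, and equal sequences come from equal
  -- trees.
  rank-strict : ∀ {p q} → p ⊑ q → p ≢ q → rank p < rank q
  rank-strict {s , s′} {t , t′} (h , h′) p≢q = ≰⇒> λ le → p≢q (cong₂ _,_
    (lefts-injective s t (≼∧sum≥⇒≡ h (+-cancelʳ-≤ (sum (rights s′)) _ _ (≤-trans (+-monoʳ-≤ (sum (lefts t)) (≼⇒sum≤ h′)) le))))
    (rights-injective s′ t′ (≼∧sum≥⇒≡ h′ (+-cancelˡ-≤ (sum (lefts s)) _ _ (≤-trans (+-monoˡ-≤ (sum (rights t′)) (≼⇒sum≤ h)) le)))))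

  lefts-≤ : ∀ t → All (_≤ #nodes t) (lefts t)
  lefts-≤ (leaf _)     = []
  lefts-≤ (node l _ r) = Allₚ.++⁺ (All.map (λ p → ≤-trans p (m≤m+n _ _)) (lefts-≤ l))
    (m≤m+n _ _ ∷ All.map (λ p → ≤-trans p (≤-trans (n≤1+n _) (m≤n+m _ _))) (lefts-≤ r))

  rights-≤ : ∀ t → All (_≤ #nodes t) (rights t)
  rights-≤ (leaf _)     = []
  rights-≤ (node l _ r) = Allₚ.++⁺ (All.map (λ p → ≤-trans p (m≤m+n _ _)) (rights-≤ l))
    (≤-trans (n≤1+n _) (m≤n+m _ _) ∷ All.map (λ p → ≤-trans p (≤-trans (n≤1+n _) (m≤n+m _ _))) (rights-≤ r))

  sum-bound : ∀ {n xs} → All (_≤ n) xs → sum xs ≤ length xs * n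
  sum-bound []       = z≤n
  sum-bound (p ∷ ps) = +-mono-≤ p (sum-bound ps)

  -- In each tree with n nodes, n entries of size at most n. The bound is constant along `⊑`, so
  -- `corank` falls whenever `rank` rises.
  maxRank : TreePair → ℕ
  maxRank (s , t) = #nodes s * #nodes s + #nodes t * #nodes t

  rank≤maxRank : ∀ p → rank p ≤ maxRank p
  rank≤maxRank (s , t) = +-mono-≤
    (≤-trans (sum-bound (lefts-≤ s)) (≤-reflexive (cong (_* #nodes s) (length-lefts s))))
    (≤-trans (sum-bound (rights-≤ t)) (≤-reflexive (cong (_* #nodes t) (length-rights t))))

  ⊑⇒maxRank≡ : ∀ {p q} → p ⊑ q → maxRank p ≡ maxRank q
  ⊑⇒maxRank≡ {s , s′} {t , t′} (h , h′) = cong₂ (λ m n → m * m + n * n)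
    (trans (sym (length-lefts s)) (trans (Pointwise.Pointwise-length h) (length-lefts t)))
    (trans (sym (length-rights s′)) (trans (Pointwise.Pointwise-length h′) (length-rights t′)))

  corank : TreePair → ℕ
  corank p = maxRank p ∸ rank p

  corank-strict : ∀ {p q} → p ⊑ q → p ≢ q → corank q < corank p
  corank-strict {p} {q} h p≢q rewrite ⊑⇒maxRank≡ h = ∸-monoʳ-< (rank-strict h p≢q) (rank≤maxRank q)

  -- The canopy

  #nodes≡0 : ∀ (t : BinaryTree) → #nodes t ≡ 0 → t ≡ leaf tt
  #nodes≡0 (leaf _)     _  = refl
  #nodes≡0 (node l _ r) eq with () ← trans (sym (+-suc (#nodes l) (#nodes r))) eq

  dropLast-∷ʳ : ∀ {a} {A : Set a} (xs : List A) x → dropLast (xs ++ x ∷ []) ≡ xs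
  dropLast-∷ʳ []           x = refl
  dropLast-∷ʳ (y ∷ [])     x = refl
  dropLast-∷ʳ (y ∷ z ∷ xs) x = cong (y ∷_) (dropLast-∷ʳ (z ∷ xs) x)

  -- The sides of all leaves but the last, and of all leaves but the first.
  initSides tailSides : BinaryTree → List Bool
  initSides (leaf _)     = []
  initSides (node l _ r) = leafSides true l ++ initSides r
  tailSides (leaf _)     = []
  tailSides (node l _ r) = tailSides l ++ leafSides false r

  leafSides-init : ∀ t → leafSides false t ≡ initSides t ++ false ∷ []
  leafSides-init (leaf _)     = refl
  leafSides-init (node l _ r) = trans (cong (leafSides true l ++_) (leafSides-init r)) (sym (++-assoc (leafSides true l) (initSides r) _))

  leafSides-tail : ∀ t → leafSides true t ≡ true ∷ tailSides t
  leafSides-tail (leaf _)     = refl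
  leafSides-tail (node l _ r) = cong (_++ leafSides false r) (leafSides-tail l)

  tailSides-canopy : ∀ l r → tailSides (node l tt r) ≡ canopy (node l tt r) ++ false ∷ []
  tailSides-canopy l r rewrite leafSides-tail l | leafSides-init r | sym (++-assoc (tailSides l) (initSides r) (false ∷ [])) =
    cong (_++ false ∷ []) (sym (dropLast-∷ʳ (tailSides l ++ initSides r) false))

  initSides-canopy : ∀ l r → initSides (node l tt r) ≡ true ∷ canopy (node l tt r)
  initSides-canopy l r rewrite leafSides-tail l | leafSides-init r | sym (++-assoc (tailSides l) (initSides r) (false ∷ [])) =
    cong (true ∷_) (sym (dropLast-∷ʳ (tailSides l ++ initSides r) false))

  canopy-init : ∀ t → canopy t ≡ drop 1 (initSides t)
  canopy-init (leaf _)     = refl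
  canopy-init (node l _ r) = sym (cong (drop 1) (initSides-canopy l r))

  canopy-tail : ∀ t → canopy t ≡ dropLast (tailSides t)
  canopy-tail t = cong (dropLast ∘ drop 1) (leafSides-tail t)

  initSides-over : ∀ s t → initSides (s over t) ≡ initSides s ++ initSides t
  initSides-over (leaf _)     t = refl
  initSides-over (node l _ r) t = trans (cong (leafSides true l ++_) (initSides-over r t)) (sym (++-assoc (leafSides true l) (initSides r) _))

  tailSides-under : ∀ s t → tailSides (s under t) ≡ tailSides s ++ tailSides t
  tailSides-under s (leaf _)     = sym (++-identityʳ _)
  tailSides-under s (node l _ r) = trans (cong (_++ leafSides false r) (tailSides-under s l)) (++-assoc (tailSides s) (tailSides l) _)

  -- The extra letter is the first leaf of `t`, a left child, which the grafting makes an inner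
  -- leaf. In `canopy-under` it is the last leaf of `s`, a right child, so the canopies also differ
  -- at the junction.
  canopy-over : ∀ {l r l′ r′} → let s = node l tt r ; t = node l′ tt r′ in canopy (s over t) ≡ canopy s ++ true ∷ canopy t
  canopy-over {l} {r} {l′} {r′} = trans (canopy-init (node l tt r over node l′ tt r′))
    (cong (drop 1) (trans (initSides-over (node l tt r) (node l′ tt r′)) (cong₂ _++_ (initSides-canopy l r) (initSides-canopy l′ r′))))

  canopy-under : ∀ {l r l′ r′} → let s = node l tt r ; t = node l′ tt r′ in canopy (s under t) ≡ canopy s ++ false ∷ canopy t
  canopy-under {l} {r} {l′} {r′} = begin
    canopy (s under t)                                ≡⟨ canopy-tail (s under t) ⟩
    dropLast (tailSides (s under t))                  ≡⟨ cong dropLast (tailSides-under s t) ⟩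
    dropLast (tailSides s ++ tailSides t)             ≡⟨ cong₂ (λ xs ys → dropLast (xs ++ ys)) (tailSides-canopy l r) (tailSides-canopy l′ r′) ⟩
    dropLast ((canopy s ++ false ∷ []) ++ canopy t ++ false ∷ [])  ≡⟨ cong dropLast (++-assoc (canopy s ++ false ∷ []) (canopy t) _) ⟨
    dropLast (((canopy s ++ false ∷ []) ++ canopy t) ++ false ∷ [])  ≡⟨ dropLast-∷ʳ ((canopy s ++ false ∷ []) ++ canopy t) false ⟩
    (canopy s ++ false ∷ []) ++ canopy t              ≡⟨ ++-assoc (canopy s) (false ∷ []) (canopy t) ⟩
    canopy s ++ false ∷ canopy t                      ∎
    where
    open ≡-Reasoning
    s t : BinaryTree
    s = node l tt r
    t = node l′ tt r′

  length-leafSides : ∀ b t → length (leafSides b t) ≡ suc (#nodes t)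
  length-leafSides b (leaf _)     = refl
  length-leafSides b (node l _ r) = trans (length-++ (leafSides true l)) (cong₂ _+_ (length-leafSides true l) (length-leafSides false r))

  length-canopy : ∀ l r → suc (length (canopy (node l tt r))) ≡ #nodes (node l tt r)
  length-canopy l r = trans (cong length (sym (initSides-canopy l r)))
    (suc-injective (trans (+-comm 1 _) (trans (sym (length-++ (initSides t)))
      (trans (cong length (sym (leafSides-init t))) (length-leafSides false t)))))
    where
    t : BinaryTree
    t = node l tt r

  Pointwise-++⁻ : ∀ {a ℓ} {A : Set a} {R : A → A → Set ℓ} (xs xs′ : List A) {ys ys′} → length xs ≡ length xs′ →
                  Pointwise R (xs ++ ys) (xs′ ++ ys′) → Pointwise R xs xs′ × Pointwise R ys ys′
  Pointwise-++⁻ []       []         _  ps       = [] , ps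
  Pointwise-++⁻ (x ∷ xs) (x′ ∷ xs′) eq (p ∷ ps) =
    let (qs , rs) = Pointwise-++⁻ xs xs′ (suc-injective eq) ps in p ∷ qs , rs

  -- Adding a largest letter

  -- The position of a largest letter in a search tree: depth `j` on the right spine, with the rest
  -- of the spine as its left subtree.
  ins : {N : Set} → ℕ → N → Tree N ⊤ → Tree N ⊤
  ins zero    a t            = node t a (leaf tt)
  -- Depths beyond the spine stop at its end, so that `#nodes-ins` holds without a bound on `j`.
  ins (suc j) a (leaf _)     = node (leaf tt) a (leaf tt)
  ins (suc j) a (node l b r) = node l b (ins j a r)

  rightDepth : {N : Set} → Tree N ⊤ → ℕ
  rightDepth (leaf _)     = 0
  rightDepth (node l _ r) = suc (rightDepth r)

  rightDepth-shape : ∀ t → rightDepth (shape t) ≡ rightDepth t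
  rightDepth-shape (leaf _)     = refl
  rightDepth-shape (node l _ r) = cong suc (rightDepth-shape r)

  shape-ins : ∀ j a t → shape (ins j a t) ≡ ins j tt (shape t)
  shape-ins zero    a t            = refl
  shape-ins (suc j) a (leaf _)     = refl
  shape-ins (suc j) a (node l b r) = cong (node (shape l) tt) (shape-ins j a r)

  #nodes-ins : ∀ j (t : BinaryTree) → #nodes (ins j tt t) ≡ suc (#nodes t)
  #nodes-ins zero    t            = +-comm (#nodes t) 1
  #nodes-ins (suc j) (leaf _)     = refl
  #nodes-ins (suc j) (node l _ r) = trans (cong (λ n → #nodes l + suc n) (#nodes-ins j r)) (+-suc (#nodes l) (suc (#nodes r)))

  -- The last node in order ends the right spine and has no right subtree; replacing it by its left
  -- subtree gives `t`.
  node-ins : ∀ l r → ∃₂ λ j t → j ≤ rightDepth t × node l tt r ≡ ins j tt t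
  node-ins l (leaf _)       = 0 , l , z≤n , refl
  node-ins l (node l′ _ r) with j , t , j≤ , eq ← node-ins l′ r = suc j , node l tt t , s≤s j≤ , cong (node l tt) eq

  insert-max : ∀ {n} t → All (_< n) (labels t) → insert n t ≡ ins (rightDepth t) n t
  insert-max (leaf _)     _ = refl
  insert-max (node l b r) h with b<n ∷ h′ ← Allₚ.++⁻ʳ (labels l) h =
    trans (insert-≥ {l = l} (<⇒≤ b<n)) (cong (node l b) (insert-max r h′))

  insert-ins : ∀ {a n} → a < n → ∀ j t → j ≤ rightDepth t → insert a (ins j n t) ≡ ins j n (insert a t)
  insert-ins a<n zero    t            _       = insert-< {l = t} a<n
  insert-ins {a} {n} a<n (suc j) (node l b r) (s≤s j≤) with <-≤-connex a b
  ... | inj₁ a<b rewrite insert-< {l = l} {ins j n r} a<b | insert-< {l = l} {r} a<b = refl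
  ... | inj₂ b≤a rewrite insert-≥ {l = l} {ins j n r} b≤a | insert-≥ {l = l} {r} b≤a = cong (node l b) (insert-ins a<n j r j≤)

  rightDepth-insert : ∀ a t → rightDepth t ≤ rightDepth (insert a t) × rightDepth (insert a t) ≤ suc (rightDepth t)
  rightDepth-insert a (leaf _)     = z≤n , s≤s z≤n
  rightDepth-insert a (node l b r) with <-≤-connex a b
  ... | inj₁ a<b rewrite insert-< {l = l} {r} a<b = ≤-refl , n≤1+n _
  ... | inj₂ b≤a rewrite insert-≥ {l = l} {r} b≤a = let (p , q) = rightDepth-insert a r in s≤s p , s≤s q

  rightDepth-++ : ∀ v u → rightDepth (insertRightToLeft u) ≤ rightDepth (insertRightToLeft (v ++ u))
  rightDepth-++ []      u = ≤-refl
  rightDepth-++ (a ∷ v) u = ≤-trans (rightDepth-++ v u) (proj₁ (rightDepth-insert a (insertRightToLeft (v ++ u))))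

  -- The depth of `n` is fixed at its insertion, after the letters of `u`: the smaller letters of
  -- `v` that arrive later never come between it and the root.
  insertAll-max : ∀ {n} v u → All (_< n) (v ++ u) →
    insertRightToLeft (v ++ n ∷ u) ≡ ins (rightDepth (insertRightToLeft u)) n (insertRightToLeft (v ++ u))
  insertAll-max []      u h       = insert-max (insertRightToLeft u) (All-resp-↭ (↭-sym (labels-insertAll u)) h)
  insertAll-max (a ∷ v) u (p ∷ h) = trans (cong (insert a) (insertAll-max v u h)) (insert-ins p _ (insertRightToLeft (v ++ u)) (rightDepth-++ v u))

  -- Each insertion lengthens the right spine by at most one, so no intermediate length is skipped.
  suffix-of-depth : ∀ w {j} → j ≤ rightDepth (insertRightToLeft w) →
    ∃₂ λ v u → w ≡ v ++ u × rightDepth (insertRightToLeft u) ≡ j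
  suffix-of-depth w {j} j≤ with m≤n⇒m<n∨m≡n j≤
  ... | inj₂ refl = [] , w , refl , refl
  suffix-of-depth (a ∷ w) j≤ | inj₁ j<
    with v , u , refl , eq ← suffix-of-depth w (s≤s⁻¹ (≤-trans j< (proj₂ (rightDepth-insert a (insertRightToLeft w))))) = a ∷ v , u , refl , eq

  -- The last leaf of `t` becomes an inner leaf. It is a left child exactly when the new node ends
  -- the spine, since that leaf is then its whole left subtree.
  initSides-ins : ∀ j t → j ≤ rightDepth t → initSides (ins j tt t) ≡ initSides t ++ does (j ≟ rightDepth t) ∷ []
  initSides-ins zero    (leaf _)     _        = refl
  initSides-ins zero    (node l _ r) _        = trans (++-identityʳ _) (leafSides-init (node l tt r))
  initSides-ins (suc j) (node l _ r) (s≤s j≤) =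
    trans (cong (leafSides true l ++_) (initSides-ins j r j≤)) (sym (++-assoc (leafSides true l) (initSides r) _))

  canopy-ins : ∀ j l r → let t = node l tt r in j ≤ rightDepth t → canopy (ins j tt t) ≡ canopy t ++ does (j ≟ rightDepth t) ∷ []
  canopy-ins j l r j≤ = trans (canopy-init (ins j tt t)) (trans (cong (drop 1) (initSides-ins j t j≤))
    (cong (λ xs → drop 1 (xs ++ does (j ≟ rightDepth t) ∷ [])) (initSides-canopy l r)))
    where
    t : BinaryTree
    t = node l tt r

  -- The last letters of the canopies differ, so exactly one of the two new nodes ends the right
  -- spine of its tree.
  twin-ins : ∀ {i j l r l′ r′} → let s = node l tt r ; t = node l′ tt r′ in
    #nodes s ≡ #nodes t → i ≤ rightDepth s → j ≤ rightDepth t → IsTwin (ins i tt s , ins j tt t) →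
    IsTwin (s , t) × does (i ≟ rightDepth s) ≢ does (j ≟ rightDepth t)
  twin-ins {i} {j} {l} {r} {l′} {r′} eq i≤ j≤ (_ , ne) with
    Pointwise-++⁻ (canopy (node l tt r)) (canopy (node l′ tt r′))
      (suc-injective (trans (length-canopy l r) (trans eq (sym (length-canopy l′ r′)))))
      (subst₂ (Pointwise _≢_) (canopy-ins i l r i≤) (canopy-ins j l′ r′ j≤) ne)
  ... | ps , p ∷ [] = (eq , ps) , p

  IsPermutation-max : ∀ v u → IsPermutation (v ++ u) → IsPermutation (v ++ suc (length (v ++ u)) ∷ u)
  IsPermutation-max v u (d , r) = IsPermutation-resp-↭ (↭-sym (shift _ v u))
    ( All.map (λ (_ , a≤) eq → <⇒≢ (s≤s a≤) (sym eq)) r ∷ d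
    , (s≤s z≤n , ≤-refl) ∷ All.map (λ (p , q) → p , m≤n⇒m≤1+n q) r)

  IsPermutation-reverse : ∀ {w} → IsPermutation w → IsPermutation (reverse w)
  IsPermutation-reverse {w} = IsPermutation-resp-↭ (↭-sym (↭-reverse w))

  -- Every pair of twin binary trees comes from a permutation

  Attained : TreePair → Set
  Attained p = ∃ λ w → IsPermutation w × 𝖯ʷ w ≡ p

  Attained-swap : ∀ {p} → Attained p → Attained (swap× p)
  Attained-swap (w , h , eq) = reverse w , IsPermutation-reverse h , trans (𝖯ʷ-reverse w) (cong swap× eq)

  -- The letter n is added at a place where it has the right position in T_R; its
  -- position in T_L is then forced by the canopies.
  Attained-ins : ∀ {i j l r l′ r′} → let s = node l tt r ; t = node l′ tt r′ in
    Attained (s , t) → i ≡ rightDepth s → j < rightDepth t → Attained (ins i tt s , ins j tt t)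
  Attained-ins {i} {j} {l} {r} {l′} {r′} (w , h , eq) i≡ j< with
    ,-injective eq
  ... | eqˡ , eqʳ with suffix-of-depth w (≤-trans (<⇒≤ j<) (≤-reflexive (trans (cong rightDepth (sym eqʳ)) (rightDepth-shape _))))
  ... | v , u , refl , depth-u = v ++ n ∷ u , perm , cong₂ _,_ left right
    where
    n : ℕ
    n = suc (length (v ++ u))
    perm : IsPermutation (v ++ n ∷ u)
    perm = IsPermutation-max v u h
    w< : All (_< n) (v ++ u)
    w< = All.map (s≤s ∘ proj₂) (proj₂ h)
    right : shape (insertRightToLeft (v ++ n ∷ u)) ≡ ins j tt (node l′ tt r′)
    right = trans (cong shape (insertAll-max v u w<)) (trans (shape-ins _ n (insertRightToLeft (v ++ u))) (cong₂ (λ j t → ins j tt t) depth-u eqʳ))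
    i′ : ℕ
    i′ = rightDepth (insertRightToLeft (reverse v))
    eqˡ′ : shape (insertRightToLeft (reverse u ++ reverse v)) ≡ node l tt r
    eqˡ′ = trans (cong (shape ∘ insertRightToLeft) (sym (reverse-++ v u))) (trans (sym (𝖯ʷ-reverseˡ (v ++ u))) eqˡ)
    left′ : shape (insertLeftToRight (v ++ n ∷ u)) ≡ ins i′ tt (node l tt r)
    left′ = begin
      shape (insertLeftToRight (v ++ n ∷ u))                       ≡⟨ 𝖯ʷ-reverseˡ (v ++ n ∷ u) ⟩
      shape (insertRightToLeft (reverse (v ++ n ∷ u)))             ≡⟨ cong (shape ∘ insertRightToLeft) (reverse-++ v (n ∷ u)) ⟩
      shape (insertRightToLeft (reverse (n ∷ u) ++ reverse v))     ≡⟨ cong (λ x → shape (insertRightToLeft (x ++ reverse v))) (unfold-reverse n u) ⟩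
      shape (insertRightToLeft ((reverse u ++ n ∷ []) ++ reverse v)) ≡⟨ cong (shape ∘ insertRightToLeft) (++-assoc (reverse u) (n ∷ []) (reverse v)) ⟩
      shape (insertRightToLeft (reverse u ++ n ∷ reverse v))       ≡⟨ cong shape (insertAll-max (reverse u) (reverse v)
                                                                       (subst (All (_< n)) (reverse-++ v u) (All-resp-↭ (↭-sym (↭-reverse (v ++ u))) w<))) ⟩
      shape (ins i′ n (insertRightToLeft (reverse u ++ reverse v))) ≡⟨ shape-ins i′ n (insertRightToLeft (reverse u ++ reverse v)) ⟩
      ins i′ tt (shape (insertRightToLeft (reverse u ++ reverse v))) ≡⟨ cong (ins i′ tt) eqˡ′ ⟩
      ins i′ tt (node l tt r) ∎
      where open ≡-Reasoning
    i′≤ : i′ ≤ rightDepth (node l tt r)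
    i′≤ = ≤-trans (rightDepth-++ (reverse u) (reverse v))
      (≤-reflexive (trans (sym (rightDepth-shape (insertRightToLeft (reverse u ++ reverse v)))) (cong rightDepth eqˡ′)))
    same-size : #nodes (node l tt r) ≡ #nodes (node l′ tt r′)
    same-size = proj₁ (subst IsTwin eq (𝖯ʷ-twin (v ++ u) (proj₁ h)))
    i′≡ : i′ ≡ rightDepth (node l tt r)
    i′≡ with i′ ≟ rightDepth (node l tt r)
    ... | yes p = p
    -- The pair of the new word is twin as well; as `n` does not end the spine of the second tree,
    -- it must end that of the first.
    ... | no ¬p = ⊥-elim (proj₂ (twin-ins {i′} {j} {l} {r} {l′} {r′} same-size i′≤ (<⇒≤ j<)
                    (subst₂ (λ s t → IsTwin (s , t)) left′ right (𝖯ʷ-twin (v ++ n ∷ u) (proj₁ perm))))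
                    (trans (dec-false (i′ ≟ _) ¬p) (sym (dec-false (j ≟ _) (<⇒≢ j<)))))
    left : shape (insertLeftToRight (v ++ n ∷ u)) ≡ ins i tt (node l tt r)
    left = trans left′ (cong (λ k → ins k tt (node l tt r)) (trans i′≡ (sym i≡)))

  -- Induction by removing the largest letter from both trees. It ends the spine in exactly one of
  -- them; when that is the second tree, reversing the word exchanges the roles.
  twin⇒attained : ∀ n s t → #nodes s ≡ n → IsTwin (s , t) → Attained (s , t)
  twin⇒attained n (leaf _) t _ (eq , _) with refl ← #nodes≡0 t (sym eq) = [] , ([] , []) , refl
  twin⇒attained n (node l _ r) (leaf _) _ (eq , _) with () ← trans (sym (+-suc (#nodes l) (#nodes r))) eq
  twin⇒attained zero    (node l _ r) (node l′ _ r′) eq _ with () ← trans (sym (+-suc (#nodes l) (#nodes r))) eq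
  twin⇒attained (suc n) (node l _ r) (node l′ _ r′) eq twin with node-ins l r | node-ins l′ r′
  ... | i , s , i≤ , eqs | j , t , j≤ , eqt =
    subst₂ (λ s t → #nodes s ≡ suc n → IsTwin (s , t) → Attained (s , t)) (sym eqs) (sym eqt) (go s t i≤ j≤) eq twin
    where
    go : ∀ {i j} s t → i ≤ rightDepth s → j ≤ rightDepth t → #nodes (ins i tt s) ≡ suc n → IsTwin (ins i tt s , ins j tt t) →
         Attained (ins i tt s , ins j tt t)
    go {i} {j} s t i≤ j≤ eq twin with suc-injective (trans (sym (#nodes-ins i s)) eq)
                                    | suc-injective (trans (sym (#nodes-ins i s)) (trans (proj₁ twin) (#nodes-ins j t)))
    go (leaf _)     t            z≤n j≤ eq twin | _ | e with refl ← #nodes≡0 t (sym e) | z≤n ← j≤ =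
      1 ∷ [] , ([] ∷ [] , (≤-refl , ≤-refl) ∷ []) , refl
    go (node l _ r) (leaf _)     i≤  j≤ eq twin | _ | e with () ← trans (sym (+-suc (#nodes l) (#nodes r))) e
    go {i} {j} (node l _ r) (node l′ _ r′) i≤ j≤ eq twin | e₁ | e₂
      with twin-ins {i} {j} {l} {r} {l′} {r′} e₂ i≤ j≤ twin | i ≟ rightDepth (node l tt r) | j ≟ rightDepth (node l′ tt r′)
    ... | _     , ne | yes p | yes q = ⊥-elim (ne (trans (dec-true (i ≟ _) p) (sym (dec-true (j ≟ _) q))))
    ... | _     , ne | no p  | no q  = ⊥-elim (ne (trans (dec-false (i ≟ _) p) (sym (dec-false (j ≟ _) q))))
    ... | twin′ , _  | yes p | no q  = Attained-ins (twin⇒attained n _ _ e₁ twin′) p (≤∧≢⇒< j≤ q)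
    ... | twin′ , _  | no p  | yes q = Attained-swap (Attained-ins (Attained-swap (twin⇒attained n _ _ e₁ twin′)) q (≤∧≢⇒< i≤ p))

  abstract
    isTwin : (J : TwinPair) → IsTwin (value J)
    isTwin (p , [ h ]) = recompute (isTwin? p) h

    𝖯-surjective : ∀ J → ∃ λ σ → 𝖯 σ ≡ J
    𝖯-surjective J with twin⇒attained _ _ _ refl (isTwin J)
    ... | w , h , eq = (w , [ h ]) , value-injective eq

  -- Enumeration

  ∈-treesOfHeight : ∀ h t → #nodes t ≤ h → t ∈ treesOfHeight h
  ∈-treesOfHeight zero    (leaf _)     _ = here refl
  ∈-treesOfHeight (suc h) (leaf _)     _ = here refl
  ∈-treesOfHeight zero    (node l _ r) p with () ← ≤-trans (≤-reflexive (sym (+-suc (#nodes l) (#nodes r)))) p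
  ∈-treesOfHeight (suc h) (node l _ r) p = there (∈-cartesianProductWith⁺ (λ l r → node l tt r)
    (∈-treesOfHeight h l (≤-trans (m≤m+n _ _) p′)) (∈-treesOfHeight h r (≤-trans (m≤n+m _ (#nodes l)) p′)))
    where
    p′ : #nodes l + #nodes r ≤ h
    p′ = s≤s⁻¹ (≤-trans (≤-reflexive (sym (+-suc (#nodes l) (#nodes r)))) p)

  treesOfHeight-unique : ∀ h → Unique (treesOfHeight h)
  treesOfHeight-unique zero    = [] ∷ []
  treesOfHeight-unique (suc h) = All.tabulate leaf≢ ∷
    cartesianProductWith⁺ join node-injective (treesOfHeight-unique h) (treesOfHeight-unique h)
    where
    join : BinaryTree → BinaryTree → BinaryTree
    join l r = node l tt r
    leaf≢ : ∀ {t} → t ∈ cartesianProductWith join (treesOfHeight h) (treesOfHeight h) → leaf tt ≢ t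
    leaf≢ t∈ with _ , _ , _ , _ , refl ← ∈-cartesianProductWith⁻ join (treesOfHeight h) (treesOfHeight h) t∈ = λ ()

  ∈-trees : ∀ t → t ∈ trees (#nodes t)
  ∈-trees t = ∈-filter⁺ (λ s → #nodes s ≟ #nodes t) (∈-treesOfHeight _ t ≤-refl) refl

  value-twinPairs : ∀ n → map value (twinPairs n) ≡ filter isTwin? (cartesianProduct (trees n) (trees n))
  value-twinPairs n = value-refineAll _ _

  twinPairs-unique : ∀ n → Unique (twinPairs n)
  twinPairs-unique n = map⁻ (subst Unique (sym (value-twinPairs n)) (filter⁺ isTwin? (cartesianProduct⁺ trees-unique trees-unique)))
    where
    trees-unique : Unique (trees n)
    trees-unique = filter⁺ (λ t → #nodes t ≟ n) (treesOfHeight-unique n)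

  ∈-twinPairs : ∀ J → J ∈ twinPairs (size J)
  ∈-twinPairs J = ∈-value⁻ (subst (value J ∈_) (sym (value-twinPairs (size J)))
    (∈-filter⁺ isTwin? (∈-cartesianProduct⁺ (∈-trees (proj₁ (value J))) (subst (λ n → proj₂ (value J) ∈ trees n) (sym (proj₁ (isTwin J))) (∈-trees (proj₂ (value J))))) (isTwin J)))

  -- The monoid of pairs of twin binary trees

  abstract
    -- Permutations `u` and `v` realising the factors give `u / v`, which realises the grafted pair;
    -- the twin condition then comes from `𝖯ʷ-twin`.
    twin-⋄ : ∀ p q → IsTwin p → IsTwin q → IsTwin (p ⋄ q)
    twin-⋄ p q hp hq with twin⇒attained _ (proj₁ p) (proj₂ p) refl hp | twin⇒attained _ (proj₁ q) (proj₂ q) refl hq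
    ... | u , hu , refl | v , hv , refl = subst IsTwin (𝖯ʷ-/ v hu hv) (𝖯ʷ-twin (u / v) (proj₁ (/-isPermutation hu hv)))

  -- Here the factor is a bare pair of trees, with no permutation at hand, so canopies are compared:
  -- those of a product begin with those of its left factor.
  twin-⋄⁻ˡ : ∀ p q → #nodes (proj₁ p) ≡ #nodes (proj₂ p) → #nodes (proj₁ q) ≡ #nodes (proj₂ q) → IsTwin (p ⋄ q) → IsTwin p
  twin-⋄⁻ˡ (leaf _ , t)       _                   e _  _ with refl ← #nodes≡0 t (sym e) = refl , []
  twin-⋄⁻ˡ (node l _ r , leaf _) _                e _  _ with () ← trans (sym (+-suc (#nodes l) (#nodes r))) e
  twin-⋄⁻ˡ (node l _ r , node l′ _ r′) (leaf _ , t) e e′ h with refl ← #nodes≡0 t (sym e′) =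
    subst (λ s → IsTwin (s , node l′ tt r′)) (over-leaf (node l tt r)) h
  twin-⋄⁻ˡ (node l _ r , node l′ _ r′) (node l₁ _ r₁ , leaf _) e e′ h with () ← trans (sym (+-suc (#nodes l₁) (#nodes r₁))) e′
  twin-⋄⁻ˡ (node l _ r , node l′ _ r′) (node l₁ _ r₁ , node l₁′ _ r₁′) e e′ (_ , h) =
    e , proj₁ (Pointwise-++⁻ (canopy (node l tt r)) (canopy (node l′ tt r′))
          (suc-injective (trans (length-canopy l r) (trans e (sym (length-canopy l′ r′)))))
          (subst₂ (Pointwise _≢_) (canopy-over {l} {r} {l₁} {r₁}) (canopy-under {l′} {r′} {l₁′} {r₁′}) h))

  infixr 5 _∙_
  abstract
    _∙_ : TwinPair → TwinPair → TwinPair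
    J ∙ K = value J ⋄ value K , [ twin-⋄ (value J) (value K) (isTwin J) (isTwin K) ]

    value-∙ : ∀ J K → value (J ∙ K) ≡ value J ⋄ value K
    value-∙ J K = refl

  𝟏 : TwinPair
  𝟏 = 𝖯 εₚ

  infixl 7 _/ₚ_
  _/ₚ_ : Permutation → Permutation → Permutation
  σ /ₚ ν = value σ / value ν , [ /-isPermutation (isPermutation σ) (isPermutation ν) ]

  abstract
    𝖯-/ : ∀ σ ν → 𝖯 (σ /ₚ ν) ≡ 𝖯 σ ∙ 𝖯 ν
    𝖯-/ σ ν = value-injective (𝖯ʷ-/ (value ν) (isPermutation σ) (isPermutation ν))

    size-∙ : ∀ J K → size (J ∙ K) ≡ size J + size K
    size-∙ J K = #nodes-over (proj₁ (value J)) (proj₁ (value K))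

  size≡0 : ∀ J → size J ≡ 0 → J ≡ 𝟏
  size≡0 J eq = value-injective (cong₂ _,_ (#nodes≡0 _ eq) (#nodes≡0 _ (trans (sym (proj₁ (isTwin J))) eq)))

  abstract
    ∙-identityˡ : ∀ J → 𝟏 ∙ J ≡ J
    ∙-identityˡ J = value-injective (cong (proj₁ (value J) ,_) (leaf-under (proj₂ (value J))))

    ∙-identityʳ : ∀ J → J ∙ 𝟏 ≡ J
    ∙-identityʳ J = value-injective (cong (_, proj₂ (value J)) (over-leaf (proj₁ (value J))))

    ∙-assoc : ∀ J K L → (J ∙ K) ∙ L ≡ J ∙ (K ∙ L)
    ∙-assoc J K L = value-injective (cong₂ _,_ (over-assoc (proj₁ (value J)) (proj₁ (value K)) (proj₁ (value L))) (under-assoc (proj₂ (value J)) (proj₂ (value K)) (proj₂ (value L))))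

  -- A tree amounts to the list of left subtrees along its right spine, and `over` concatenates
  -- these lists; this is Levi's lemma for words.
  over-levi : ∀ (s s′ : BinaryTree) {t t′} → s over t ≡ s′ over t′ → #nodes s ≤ #nodes s′ → ∃ λ x → s′ ≡ s over x × t ≡ x over t′
  over-levi (leaf _)     s′            eq _  = s′ , refl , eq
  over-levi (node l _ r) (leaf _)      eq le with () ← ≤-trans (≤-reflexive (sym (+-suc (#nodes l) (#nodes r)))) le
  over-levi (node l _ r) (node l′ _ r′) eq le with node-injective eq
  ... | refl , eq′ with x , e₁ , e₂ ← over-levi r r′ eq′ (s≤s⁻¹ (+-cancelˡ-≤ (#nodes l) _ _ le)) = x , cong (node l tt) e₁ , e₂

  under-levi : ∀ {s s′} (t t′ : BinaryTree) → s under t ≡ s′ under t′ → #nodes s ≤ #nodes s′ → ∃ λ x → s′ ≡ s under x × t ≡ x under t′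
  under-levi t            (leaf _)       eq _  = t , sym eq , refl
  under-levi {s} {s′} (leaf _) (node l _ r) eq le = ⊥-elim (<⇒≱ (begin-strict
    #nodes s′                         <⟨ m<m+n (#nodes s′) (≤-trans (s≤s z≤n) (≤-reflexive (sym (+-suc (#nodes l) (#nodes r))))) ⟩
    #nodes s′ + #nodes (node l tt r)  ≡⟨ #nodes-under s′ (node l tt r) ⟨
    #nodes (s′ under node l tt r)     ≡⟨ cong #nodes eq ⟨
    #nodes s                          ∎) le)
    where open ≤-Reasoning
  under-levi (node l _ r) (node l′ _ r′) eq le with node-injective eq
  ... | eq′ , refl with x , e₁ , e₂ ← under-levi l l′ eq′ le = x , e₁ , cong (λ l → node l tt r) e₂

  abstract
    -- The middle factors `x` and `y` arise independently from the two coordinates. Counting nodes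
    -- shows that their sizes agree, and `twin-⋄⁻ˡ` applies because `(x , y)` is a left factor of
    -- `K`.
    ∙-levi : ∀ J J′ {K K′} → J ∙ K ≡ J′ ∙ K′ → size J ≤ size J′ → ∃ λ X → J′ ≡ J ∙ X × K ≡ X ∙ K′
    ∙-levi J J′ {K} {K′} eq le
      with over-levi (proj₁ (value J)) (proj₁ (value J′)) (proj₁ (,-injective (cong value eq))) le
         | under-levi (proj₂ (value K)) (proj₂ (value K′)) (proj₂ (,-injective (cong value eq)))
             (subst₂ _≤_ (proj₁ (isTwin J)) (proj₁ (isTwin J′)) le)
    ... | x , e₁ , e₂ | y , e₃ , e₄ = ((x , y) , [ twin ]) , value-injective (cong₂ _,_ e₁ e₃) , value-injective (cong₂ _,_ e₂ e₄)
      where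
      sizes : #nodes x ≡ #nodes y
      sizes = +-cancelˡ-≡ (size J) _ _ (begin
        size J + #nodes x                      ≡⟨ #nodes-over (proj₁ (value J)) x ⟨
        #nodes (proj₁ (value J) over x)        ≡⟨ cong #nodes e₁ ⟨
        size J′                                ≡⟨ proj₁ (isTwin J′) ⟩
        #nodes (proj₂ (value J′))              ≡⟨ cong #nodes e₃ ⟩
        #nodes (proj₂ (value J) under y)       ≡⟨ #nodes-under (proj₂ (value J)) y ⟩
        #nodes (proj₂ (value J)) + #nodes y    ≡⟨ cong (_+ #nodes y) (proj₁ (isTwin J)) ⟨
        size J + #nodes y ∎)
        where open ≡-Reasoning
      twin : IsTwin (x , y)
      twin = twin-⋄⁻ˡ (x , y) (value K′) sizes (proj₁ (isTwin K′)) (subst IsTwin (cong₂ _,_ e₂ e₄) (isTwin K))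

  -- Connectedness as irreducibility, and unique factorisation

  Irreducible : TwinPair → Set
  Irreducible J = ∀ K L → J ≡ K ∙ L → K ≡ 𝟏 ⊎ L ≡ 𝟏

  ∣/ₚ∣ : ∀ σ ν → ∣ σ /ₚ ν ∣ ≡ ∣ σ ∣ + ∣ ν ∣
  ∣/ₚ∣ σ ν = trans (length-++ (value σ)) (cong (∣ σ ∣ +_) (length-map _ (value ν)))

  ∣σ∣≡0⇒𝖯≡𝟏 : ∀ σ → ∣ σ ∣ ≡ 0 → 𝖯 σ ≡ 𝟏
  ∣σ∣≡0⇒𝖯≡𝟏 σ eq = size≡0 (𝖯 σ) (trans (size-𝖯 σ) eq)

  -- For permutations chosen over `K` and `L`, their `/ₚ` lies over `J` and is thus connected.
  connected⇒irreducible : ∀ {J} → ConnectedPair J → Irreducible J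
  connected⇒irreducible {J} conn K L eq = go (𝖯-surjective K) (𝖯-surjective L)
    where
    go : (∃ λ σ → 𝖯 σ ≡ K) → (∃ λ ν → 𝖯 ν ≡ L) → K ≡ 𝟏 ⊎ L ≡ 𝟏
    -- A factor equal to the whole permutation forces the other one to be empty, so the alternatives
    -- trade places.
    go (σ , p) (ν , q) = Sum.swap (Sum.map
      (λ e → trans (sym q) (∣σ∣≡0⇒𝖯≡𝟏 ν
        (+-cancelˡ-≡ ∣ σ ∣ _ _ (trans (sym (∣/ₚ∣ σ ν)) (trans (cong ∣_∣ (sym e)) (sym (+-identityʳ ∣ σ ∣)))))))
      (λ e → trans (sym p) (∣σ∣≡0⇒𝖯≡𝟏 σ (+-cancelʳ-≡ ∣ ν ∣ _ _ (trans (sym (∣/ₚ∣ σ ν)) (cong ∣_∣ (sym e))))))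
      (conn (σ /ₚ ν) (trans (𝖯-/ σ ν) (trans (cong₂ _∙_ p q) (sym eq))) σ ν refl))

  𝖯≡𝟏⇒[] : ∀ σ → 𝖯 σ ≡ 𝟏 → value σ ≡ []
  𝖯≡𝟏⇒[] σ eq with value σ | trans (sym (size-𝖯 σ)) (cong size eq)
  ... | [] | _ = refl

  -- A splitting `ν / π` of a permutation over `J` projects to the splitting `𝖯 ν ∙ 𝖯 π` of `J`, and
  -- only the empty permutation lies over `𝟏`.
  irreducible⇒connected : ∀ {J} → Irreducible J → ConnectedPair J
  irreducible⇒connected irr σ p ν π eq = Sum.swap (Sum.map
    (λ e → value-injective (sym (trans eq (trans (cong (_/ value π) (𝖯≡𝟏⇒[] ν e)) (map-id (value π))))))
    (λ e → value-injective (sym (trans eq (trans (cong (value ν /_) (𝖯≡𝟏⇒[] π e)) (++-identityʳ (value ν))))))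
    (irr (𝖯 ν) (𝖯 π) (trans (sym p) (trans 𝖯σ (𝖯-/ ν π)))))
    where
    𝖯σ : 𝖯 σ ≡ 𝖯 (ν /ₚ π)
    𝖯σ = cong 𝖯 {x = σ} {y = ν /ₚ π} (value-injective {v = σ} {w = ν /ₚ π} eq)

  ∏ : List TwinPair → TwinPair
  ∏ = foldr _∙_ 𝟏

  ∏-++ : ∀ Js Ks → ∏ (Js ++ Ks) ≡ ∏ Js ∙ ∏ Ks
  ∏-++ []       Ks = sym (∙-identityˡ (∏ Ks))
  ∏-++ (J ∷ Js) Ks = trans (cong (J ∙_) (∏-++ Js Ks)) (sym (∙-assoc J (∏ Js) (∏ Ks)))

  ∏-nonEmpty : ∀ {J} Js → NonEmpty J → ∏ (J ∷ Js) ≢ 𝟏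
  ∏-nonEmpty {J} Js p eq = <⇒≱ p (≤-trans (m≤m+n _ (size (∏ Js))) (≤-reflexive (trans (sym (size-∙ J (∏ Js))) (cong size eq))))

  Generator : TwinPair → Set
  Generator J = NonEmpty J × ConnectedPair J

  -- Levi's lemma gives `J′ ≡ J ∙ X`; as `J′` is irreducible and `J` nonempty, only `X ≡ 𝟏` remains.
  left-factor : ∀ {J J′} → Generator J → Generator J′ → ∀ {K K′} → J ∙ K ≡ J′ ∙ K′ → size J ≤ size J′ → J ≡ J′ × K ≡ K′
  left-factor {J} {J′} (p , _) (_ , conn) {K} {K′} eq le = go (∙-levi J J′ {K} {K′} eq le)
    where
    go : (∃ λ X → J′ ≡ J ∙ X × K ≡ X ∙ K′) → J ≡ J′ × K ≡ K′
    go (X , e₁ , e₂) = Sum.[ (λ e → ⊥-elim (<⇒≢ p (sym (cong size e))))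
                           , (λ e → trans (sym (∙-identityʳ J)) (trans (cong (J ∙_) (sym e)) (sym e₁))
                                  , trans e₂ (trans (cong (_∙ K′) e) (∙-identityˡ K′)))
                           ]′ (connected⇒irreducible {J′} conn J X e₁)

  ∏-injective : ∀ {Js Ks} → All Generator Js → All Generator Ks → ∏ Js ≡ ∏ Ks → Js ≡ Ks
  ∏-injective []       []       _  = refl
  ∏-injective {Ks = _ ∷ Ks} [] (h ∷ _) eq = ⊥-elim (∏-nonEmpty Ks (proj₁ h) (sym eq))
  ∏-injective {_ ∷ Js} (g ∷ _) [] eq = ⊥-elim (∏-nonEmpty Js (proj₁ g) eq)
  ∏-injective {J ∷ Js} {K ∷ Ks} (g ∷ gs) (h ∷ hs) eq = Sum.[
    (λ le → let (e , e′) = left-factor g h {∏ Js} {∏ Ks} eq le in cong₂ _∷_ e (∏-injective gs hs e′)) ,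
    (λ le → let (e , e′) = left-factor h g {∏ Ks} {∏ Js} (sym eq) le in cong₂ _∷_ (sym e) (∏-injective gs hs (sym e′))) ]′
    (≤-total (size J) (size K))

  splits : ℕ → List (TwinPair × TwinPair)
  splits n = concatMap (λ i → cartesianProduct (twinPairs i) (twinPairs (n ∸ i))) (upTo (suc n))

  ∈-splits : ∀ K L → (K , L) ∈ splits (size (K ∙ L))
  ∈-splits K L rewrite size-∙ K L = ∈-concat⁺′
    (∈-cartesianProduct⁺ (∈-twinPairs K) (subst (λ n → L ∈ twinPairs n) (sym (m+n∸m≡n (size K) (size L))) (∈-twinPairs L)))
    (∈-map⁺ _ (∈-upTo⁺ (s≤s (m≤m+n (size K) (size L)))))

  -- Sizes add under `∙`, so the possible factors form the finite list `splits (size J)` and a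
  -- search decides. This yields the case distinction on which `factorise` recurses.
  reducible? : ∀ J → (∃₂ λ K L → NonEmpty K × NonEmpty L × J ≡ K ∙ L) ⊎ Irreducible J
  reducible? J with any? (λ (K , L) → 0 <? size K ×-dec 0 <? size L ×-dec J ≟ⱼ (K ∙ L)) (splits (size J))
  ... | yes p = let ((K , L) , h) = Any.satisfied p in inj₁ (K , L , h)
  ... | no ¬p = inj₂ irr
    where
    irr : Irreducible J
    irr K L eq with 0 <? size K | 0 <? size L
    ... | yes p | yes q = ⊥-elim (¬p (lose (subst (λ J → (K , L) ∈ splits (size J)) (sym eq) (∈-splits K L)) (p , q , eq)))
    ... | no ¬q | _     = inj₁ (size≡0 K (n≤0⇒n≡0 (≮⇒≥ ¬q)))
    ... | yes _ | no ¬q = inj₂ (size≡0 L (n≤0⇒n≡0 (≮⇒≥ ¬q)))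

  Factorisation : TwinPair → Set
  Factorisation J = ∃ λ Js → All Generator Js × ∏ Js ≡ J

  factorise-empty : ∀ J → ¬ NonEmpty J → Factorisation J
  factorise-empty J ¬p = [] , [] , sym (size≡0 J (n≤0⇒n≡0 (≮⇒≥ ¬p)))

  factorise : ∀ n J → size J ≤ n → Factorisation J
  factorise zero    J le = factorise-empty J (≤⇒≯ le)
  factorise (suc n) J le = go (0 <? size J) (reducible? J)
    where
    go : Dec (NonEmpty J) → (∃₂ λ K L → NonEmpty K × NonEmpty L × J ≡ K ∙ L) ⊎ Irreducible J → Factorisation J
    go (no ¬p) _          = factorise-empty J ¬p
    go (yes p) (inj₂ irr) = J ∷ [] , (p , irreducible⇒connected irr) ∷ [] , ∙-identityʳ J
    go (yes _) (inj₁ (K , L , p , q , eq)) =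
      let Js , gs , e = factorise n K (s≤s⁻¹ (≤-trans (m<m+n (size K) q) le′))
          Ks , hs , f = factorise n L (s≤s⁻¹ (≤-trans (m<n+m (size L) p) le′))
      in Js ++ Ks , Allₚ.++⁺ gs hs , trans (∏-++ Js Ks) (trans (cong₂ _∙_ e f) (sym eq))
      where
      le′ : size K + size L ≤ suc n
      le′ = ≤-trans (≤-reflexive (trans (sym (size-∙ K L)) (cong size (sym eq)))) le

  -- Mirror images

  twin-swap : ∀ p → IsTwin p → IsTwin (swap× p)
  twin-swap p (e , h) = sym e , Pointwise.symmetric ≢-sym h

  -- Reversing a word exchanges the two orders of insertion, hence the two trees.
  mirrorⱼ : TwinPair → TwinPair
  mirrorⱼ J = swap× (value J) , [ twin-swap (value J) (isTwin J) ]

  𝖯-mirror : ∀ σ → 𝖯 (mirror σ) ≡ mirrorⱼ (𝖯 σ)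
  𝖯-mirror σ = value-injective (𝖯ʷ-reverse (value σ))

  mirror-involutive : ∀ σ → mirror (mirror σ) ≡ σ
  mirror-involutive σ = value-injective (reverse-involutive (value σ))

  size-mirrorⱼ : ∀ J → size (mirrorⱼ J) ≡ size J
  size-mirrorⱼ J = sym (proj₁ (isTwin J))

  mirrorⱼ-involutive : ∀ J → mirrorⱼ (mirrorⱼ J) ≡ J
  mirrorⱼ-involutive J = refl

  ≤ₚ-mirror : ∀ {u v} → Star _⋖_ u v → Star _⋖_ (reverse v) (reverse u)
  ≤ₚ-mirror ε       = ε
  ≤ₚ-mirror (p ◅ s) = ≤ₚ-mirror s ◅◅ (⋖-reverse p ◅ ε)

  ≤ᴮ-mirror : ∀ {J K} → J ≤ᴮ K → mirrorⱼ K ≤ᴮ mirrorⱼ J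
  ≤ᴮ-mirror (σ , ν , σ≤ν , refl , refl) = mirror ν , mirror σ , ≤ₚ-mirror σ≤ν , 𝖯-mirror ν , 𝖯-mirror σ

  connected-mirror : ∀ {J} → ConnectedPair J → AntiConnectedPair (mirrorⱼ J)
  connected-mirror conn σ eq = conn (mirror σ) (trans (𝖯-mirror σ) (cong mirrorⱼ eq))

  antiConnected-mirror : ∀ {J} → AntiConnectedPair J → ConnectedPair (mirrorⱼ J)
  antiConnected-mirror anti σ eq = subst Connected (mirror-involutive σ) (anti (mirror σ) (trans (𝖯-mirror σ) (cong mirrorⱼ eq)))

open TreeCombinatorics

-- Linear extension of maps into an algebra

module Evaluation {c ℓ} {R : CommutativeRing c ℓ} {M : Set} (_≟_ : DecidableEquality M) {b ℓᵇ} (B : AssociativeAlgebra R b ℓᵇ) where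
  private module R = CommutativeRing R
  open FreeModule R _≟_
  open AssociativeAlgebra B hiding (_-_)
  open IsLeftModule isLeftModule using (*ₗ-cong; *ₗ-zeroˡ; *ₗ-zeroʳ; *ₗ-distribˡ; *ₗ-distribʳ; *ₗ-assoc; *ₗ-identityˡ)
  open import Algebra.Properties.CommutativeSemigroup +-commutativeSemigroup using (x∙yz≈y∙xz)
  open import Relation.Binary.Reasoning.Setoid setoid

  ⟦_⟧ : (M → Carrier) → LinearCombination → Carrier
  ⟦ h ⟧ []            = 0#
  ⟦ h ⟧ ((k , a) ∷ t) = k • h a + ⟦ h ⟧ t

  -1•x+x≈0 : ∀ x → (R.- R.1#) • x + x ≈ 0#
  -1•x+x≈0 x = begin
    (R.- R.1#) • x + x           ≈⟨ +-congˡ (*ₗ-identityˡ x) ⟨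
    (R.- R.1#) • x + R.1# • x    ≈⟨ *ₗ-distribʳ x _ _ ⟨
    ((R.- R.1#) R.+ R.1#) • x    ≈⟨ *ₗ-cong (R.-‿inverseˡ R.1#) refl ⟩
    R.0# • x                     ≈⟨ *ₗ-zeroˡ x ⟩
    0#                           ∎

  -1•x≈-x : ∀ x → (R.- R.1#) • x ≈ - x
  -1•x≈-x x = begin
    (R.- R.1#) • x                ≈⟨ +-identityʳ _ ⟨
    (R.- R.1#) • x + 0#           ≈⟨ +-congˡ (-‿inverseʳ x) ⟨
    (R.- R.1#) • x + (x + - x)    ≈⟨ +-assoc _ _ _ ⟨
    ((R.- R.1#) • x + x) + - x    ≈⟨ +-congʳ (-1•x+x≈0 x) ⟩
    0# + - x                      ≈⟨ +-identityˡ _ ⟩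
    - x                           ∎

  module _ (h : M → Carrier) where

    ⟦⟧-++ : ∀ s t → ⟦ h ⟧ (s ++ t) ≈ ⟦ h ⟧ s + ⟦ h ⟧ t
    ⟦⟧-++ []      t = sym (+-identityˡ _)
    ⟦⟧-++ (_ ∷ s) t = trans (+-congˡ (⟦⟧-++ s t)) (sym (+-assoc _ _ _))

    ⟦⟧-⊛ : ∀ k t → ⟦ h ⟧ (k ⊛ t) ≈ k • ⟦ h ⟧ t
    ⟦⟧-⊛ k []            = sym (*ₗ-zeroʳ k)
    ⟦⟧-⊛ k ((l , a) ∷ t) = trans (+-cong (*ₗ-assoc k l (h a)) (⟦⟧-⊛ k t)) (sym (*ₗ-distribˡ k _ _))

    -- A basis element may recur in a list of terms; extracting its total coefficient leaves a list
    -- free of it.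
    remove : M → LinearCombination → LinearCombination
    remove a []            = []
    remove a ((k , b) ∷ t) with a ≟ b
    ... | yes _ = remove a t
    ... | no  _ = (k , b) ∷ remove a t

    length-remove : ∀ a t → length (remove a t) ≤ length t
    length-remove a []            = z≤n
    length-remove a ((k , b) ∷ t) with a ≟ b
    ... | yes _ = m≤n⇒m≤1+n (length-remove a t)
    ... | no  _ = s≤s (length-remove a t)

    ⟦⟧-remove : ∀ a t → ⟦ h ⟧ t ≈ coeff a t • h a + ⟦ h ⟧ (remove a t)
    ⟦⟧-remove a [] = sym (trans (+-identityʳ _) (*ₗ-zeroˡ (h a)))
    ⟦⟧-remove a ((k , b) ∷ t) with a ≟ b
    ... | yes ≡.refl = begin
      k • h a + ⟦ h ⟧ t                                    ≈⟨ +-congˡ (⟦⟧-remove a t) ⟩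
      k • h a + (coeff a t • h a + ⟦ h ⟧ (remove a t))     ≈⟨ +-assoc _ _ _ ⟨
      (k • h a + coeff a t • h a) + ⟦ h ⟧ (remove a t)     ≈⟨ +-congʳ (*ₗ-distribʳ (h a) _ _) ⟨
      (k R.+ coeff a t) • h a + ⟦ h ⟧ (remove a t)         ∎
    ... | no _ = begin
      k • h b + ⟦ h ⟧ t                                    ≈⟨ +-congˡ (⟦⟧-remove a t) ⟩
      k • h b + (coeff a t • h a + ⟦ h ⟧ (remove a t))     ≈⟨ x∙yz≈y∙xz _ _ _ ⟩
      coeff a t • h a + (k • h b + ⟦ h ⟧ (remove a t))     ≈⟨ +-congʳ (*ₗ-cong (R.+-identityˡ _) refl) ⟨
      (R.0# R.+ coeff a t) • h a + (k • h b + ⟦ h ⟧ (remove a t)) ∎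

    coeff-remove-≡ : ∀ a t → coeff a (remove a t) R.≈ R.0#
    coeff-remove-≡ a []            = R.refl
    coeff-remove-≡ a ((k , b) ∷ t) with a ≟ b in eq
    ... | yes _ = coeff-remove-≡ a t
    ... | no  _ rewrite eq = R.trans (R.+-identityˡ _) (coeff-remove-≡ a t)

    coeff-remove-≢ : ∀ {b a} t → b ≢ a → coeff b (remove a t) R.≈ coeff b t
    coeff-remove-≢ []            _ = R.refl
    coeff-remove-≢ {b} {a} ((k , a′) ∷ t) b≢a with a ≟ a′
    ... | no _ = R.+-congˡ (coeff-remove-≢ t b≢a)
    ... | yes ≡.refl with b ≟ a
    ...   | yes eq = ⊥-elim (b≢a eq)
    ...   | no _   = R.trans (coeff-remove-≢ t b≢a) (R.sym (R.+-identityˡ _))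

    remove-≋[] : ∀ a {t} → t ≋ [] → remove a t ≋ []
    remove-≋[] a {t} t≋ b with b ≟ a
    ... | yes ≡.refl = coeff-remove-≡ a t
    ... | no b≢a     = R.trans (coeff-remove-≢ t b≢a) (t≋ b)

    -- The terms at the first basis element add up to zero, and removing them leaves a shorter list
    -- whose coefficients still vanish.
    ⟦⟧-≋[] : ∀ t → t ≋ [] → ⟦ h ⟧ t ≈ 0#
    ⟦⟧-≋[] t = go (length t) t ≤-refl
      where
      go : ∀ n t → length t ≤ n → t ≋ [] → ⟦ h ⟧ t ≈ 0#
      go n       []            _  _  = refl
      go (suc n) t@((k , a) ∷ s) le t≋ = begin
        ⟦ h ⟧ t                                ≈⟨ ⟦⟧-remove a t ⟩
        coeff a t • h a + ⟦ h ⟧ (remove a t)   ≈⟨ +-cong (trans (*ₗ-cong (t≋ a) refl) (*ₗ-zeroˡ (h a))) (go n (remove a t) le′ (remove-≋[] a {t} t≋)) ⟩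
        0# + 0#                                ≈⟨ +-identityˡ 0# ⟩
        0#                                     ∎
        where
        le′ : length (remove a t) ≤ n
        le′ with a ≟ a
        ... | yes _ = ≤-trans (length-remove a s) (s≤s⁻¹ le)
        ... | no ne = ⊥-elim (ne ≡.refl)

    -- Turns an equality of values into the vanishing of one, the form in which independence is
    -- stated.
    ⟦⟧-difference : ∀ {s t} → ⟦ h ⟧ s ≈ ⟦ h ⟧ t → ⟦ h ⟧ (s ++ (R.- R.1#) ⊛ t) ≈ 0#
    ⟦⟧-difference {s} {t} eq = begin
      ⟦ h ⟧ (s ++ (R.- R.1#) ⊛ t)           ≈⟨ trans (⟦⟧-++ s _) (+-cong eq (⟦⟧-⊛ _ t)) ⟩
      ⟦ h ⟧ t + (R.- R.1#) • ⟦ h ⟧ t        ≈⟨ trans (+-comm _ _) (-1•x+x≈0 _) ⟩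
      0#                                    ∎

    ⟦⟧-difference⁻ : ∀ {s t} → ⟦ h ⟧ (s ++ (R.- R.1#) ⊛ t) ≈ 0# → ⟦ h ⟧ s ≈ ⟦ h ⟧ t
    ⟦⟧-difference⁻ {s} {t} eq = begin
      ⟦ h ⟧ s                                        ≈⟨ +-identityʳ _ ⟨
      ⟦ h ⟧ s + 0#                                   ≈⟨ +-congˡ (-1•x+x≈0 _) ⟨
      ⟦ h ⟧ s + ((R.- R.1#) • ⟦ h ⟧ t + ⟦ h ⟧ t)     ≈⟨ +-assoc _ _ _ ⟨
      (⟦ h ⟧ s + (R.- R.1#) • ⟦ h ⟧ t) + ⟦ h ⟧ t     ≈⟨ +-congʳ (trans (+-congˡ (sym (⟦⟧-⊛ _ t))) (trans (sym (⟦⟧-++ s _)) eq)) ⟩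
      0# + ⟦ h ⟧ t                                   ≈⟨ +-identityˡ _ ⟩
      ⟦ h ⟧ t                                        ∎

    module _ (_∙_ : M → M → M) where

      infixl 7 _⊠_
      _⊠_ : LinearCombination → LinearCombination → LinearCombination
      s ⊠ t = concatMap (λ (k , a) → map (λ (l , b) → k R.* l , a ∙ b) t) s

      ⟦⟧-⊠ : (∀ a b → h (a ∙ b) ≈ h a * h b) → ∀ s t → ⟦ h ⟧ (s ⊠ t) ≈ ⟦ h ⟧ s * ⟦ h ⟧ t
      ⟦⟧-⊠ h-∙ []            t = sym (zeroˡ _)
      ⟦⟧-⊠ h-∙ ((k , a) ∷ s) t = begin
        ⟦ h ⟧ (map (λ (l , b) → k R.* l , a ∙ b) t ++ s ⊠ t)  ≈⟨ ⟦⟧-++ (map (λ (l , b) → k R.* l , a ∙ b) t) (s ⊠ t) ⟩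
        ⟦ h ⟧ (map (λ (l , b) → k R.* l , a ∙ b) t) + ⟦ h ⟧ (s ⊠ t)  ≈⟨ +-cong (row t) (⟦⟧-⊠ h-∙ s t) ⟩
        (k • h a) * ⟦ h ⟧ t + ⟦ h ⟧ s * ⟦ h ⟧ t             ≈⟨ distribʳ _ _ _ ⟨
        (k • h a + ⟦ h ⟧ s) * ⟦ h ⟧ t                        ∎
        where
        row : ∀ t → ⟦ h ⟧ (map (λ (l , b) → k R.* l , a ∙ b) t) ≈ (k • h a) * ⟦ h ⟧ t
        row []            = sym (zeroʳ _)
        row ((l , b) ∷ t) = begin
          (k R.* l) • h (a ∙ b) + ⟦ h ⟧ (map (λ (l , b) → k R.* l , a ∙ b) t)
            ≈⟨ +-cong (trans (*ₗ-assoc k l _) (*ₗ-cong R.refl (trans (*ₗ-cong R.refl (h-∙ a b)) (sym (•-*-comm l (h a) (h b)))))) (row t) ⟩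
          k • (h a * (l • h b)) + (k • h a) * ⟦ h ⟧ t          ≈⟨ +-congʳ (•-*-assoc k _ _) ⟨
          (k • h a) * (l • h b) + (k • h a) * ⟦ h ⟧ t          ≈⟨ distribˡ _ _ _ ⟨
          (k • h a) * (l • h b + ⟦ h ⟧ t)                      ∎

-- A linear basis indexed by words makes an algebra free

module FreeCriterion {c ℓ} {R : CommutativeRing c ℓ} {a ℓᵃ x ℓˣ} (A : AssociativeAlgebra R a ℓᵃ) (X : Setoid x ℓˣ)
                     (ι : Func X (AssociativeAlgebra.setoid A)) where
  private
    module R = CommutativeRing R
    module A = AssociativeAlgebra A
    module X = Setoid X

  module _ {b ℓᵇ} (B : AssociativeAlgebra R b ℓᵇ) (f : Func X (AssociativeAlgebra.setoid B)) where
    open AssociativeAlgebra B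

    monomial : List X.Carrier → Carrier
    monomial = foldr (λ g y → Func.to f g * y) 1#

    monomial-cong : ∀ {u v} → Pointwise X._≈_ u v → monomial u ≈ monomial v
    monomial-cong []       = refl
    monomial-cong (p ∷ ps) = *-cong (Func.cong f p) (monomial-cong ps)

    monomial-++ : ∀ u v → monomial (u ++ v) ≈ monomial u * monomial v
    monomial-++ []      v = sym (*-identityˡ _)
    monomial-++ (g ∷ u) v = trans (*-congˡ (monomial-++ u v)) (sym (*-assoc _ _ _))

  module _ {M : Set} (_≟_ : DecidableEquality M) (_∙_ : M → M → M) (e : M) (word : M → List X.Carrier)
    (word-∙ : ∀ a b → Pointwise X._≈_ (word (a ∙ b)) (word a ++ word b))
    (word-e : Pointwise X._≈_ (word e) [])
    (word-surjective : ∀ g → ∃ λ a → Pointwise X._≈_ (word a) (g ∷ []))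
    where
    open FreeModule R _≟_ using (LinearCombination; _⊛_; _≋_)
    private module EA = Evaluation _≟_ A

    module _ (spanning : ∀ x → ∃ λ t → EA.⟦ (λ a → monomial A ι (word a)) ⟧ t A.≈ x)
             (independent : ∀ t → EA.⟦ (λ a → monomial A ι (word a)) ⟧ t A.≈ A.0# → t ≋ [])
      where

      free : ∀ {b ℓᵇ} → FreeOn b ℓᵇ A X (Func.to ι)
      free B f = φ , (isHomomorphism , on-generators) , (λ (hom , on-gen) → unique hom on-gen)
        where
        module B = AssociativeAlgebra B
        module EB = Evaluation _≟_ B
        open import Relation.Binary.Reasoning.Setoid B.setoid
        α : M → A.Carrier
        α a = monomial A ι (word a)
        β : M → B.Carrier
        β a = monomial B f (word a)
        span : A.Carrier → LinearCombination
        span x = proj₁ (spanning x)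
        ⟦span⟧ : ∀ x → EA.⟦ α ⟧ (span x) A.≈ x
        ⟦span⟧ x = proj₂ (spanning x)
        φ : A.Carrier → B.Carrier
        -- A chosen expansion is evaluated. By independence any other expansion gives the same value
        -- (`transfer`), so each law below follows from a convenient expansion.
        φ x = EB.⟦ β ⟧ (span x)
        transfer : ∀ {s t} → EA.⟦ α ⟧ s A.≈ EA.⟦ α ⟧ t → EB.⟦ β ⟧ s B.≈ EB.⟦ β ⟧ t
        transfer {s} {t} eq = EB.⟦⟧-difference⁻ β {s} {t} (EB.⟦⟧-≋[] β (s ++ (R.- R.1#) ⊛ t) (independent (s ++ (R.- R.1#) ⊛ t) (EA.⟦⟧-difference α {s} {t} eq)))
        φ-⟦⟧ : ∀ {x} t → EA.⟦ α ⟧ t A.≈ x → φ x B.≈ EB.⟦ β ⟧ t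
        φ-⟦⟧ {x} t eq = transfer {span x} {t} (A.trans (⟦span⟧ x) (A.sym eq))
        φ-α : ∀ {x} a → α a A.≈ x → φ x B.≈ β a
        φ-α a eq = B.trans (φ-⟦⟧ ((R.1# , a) ∷ []) (A.trans (A.+-identityʳ _) (A.trans (IsLeftModule.*ₗ-identityˡ A.isLeftModule _) eq)))
          (B.trans (B.+-identityʳ _) (IsLeftModule.*ₗ-identityˡ B.isLeftModule _))
        α-∙ : ∀ a b → α (a ∙ b) A.≈ α a A.* α b
        α-∙ a b = A.trans (monomial-cong A ι (word-∙ a b)) (monomial-++ A ι (word a) (word b))
        β-∙ : ∀ a b → β (a ∙ b) B.≈ β a B.* β b
        β-∙ a b = B.trans (monomial-cong B f (word-∙ a b)) (monomial-++ B f (word a) (word b))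
        φ-+ : ∀ x y → φ (x A.+ y) B.≈ φ x B.+ φ y
        φ-+ x y = B.trans (φ-⟦⟧ (span x ++ span y) (A.trans (EA.⟦⟧-++ α (span x) (span y)) (A.+-cong (⟦span⟧ x) (⟦span⟧ y))))
          (EB.⟦⟧-++ β (span x) (span y))
        φ-* : ∀ x y → φ (x A.* y) B.≈ φ x B.* φ y
        φ-* x y = B.trans (φ-⟦⟧ (EA._⊠_ α _∙_ (span x) (span y))
            (A.trans (EA.⟦⟧-⊠ α _∙_ α-∙ (span x) (span y)) (A.*-cong (⟦span⟧ x) (⟦span⟧ y))))
          (EB.⟦⟧-⊠ β _∙_ β-∙ (span x) (span y))
        φ-• : ∀ k x → φ (k A.• x) B.≈ k B.• φ x
        φ-• k x = B.trans (φ-⟦⟧ (k ⊛ span x) (A.trans (EA.⟦⟧-⊛ α k (span x)) (IsLeftModule.*ₗ-cong A.isLeftModule R.refl (⟦span⟧ x))))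
          (EB.⟦⟧-⊛ β k (span x))
        φ-cong : ∀ {x y} → x A.≈ y → φ x B.≈ φ y
        φ-cong {x} {y} eq = φ-⟦⟧ (span y) (A.trans (⟦span⟧ y) (A.sym eq))
        isHomomorphism : IsAlgebraHomomorphism A B φ
        isHomomorphism = record
          { isRingHomomorphism = record
            { isSemiringHomomorphism = record
              { isNearSemiringHomomorphism = record
                { +-isMonoidHomomorphism = record
                  { isMagmaHomomorphism = record { isRelHomomorphism = record { cong = φ-cong } ; homo = φ-+ }
                  ; ε-homo = φ-⟦⟧ [] A.refl }
                ; *-homo = φ-* }
              ; 1#-homo = B.trans (φ-α e (monomial-cong A ι word-e)) (monomial-cong B f word-e) }
            ; -‿homo = λ x → B.trans (φ-cong (A.sym (EA.-1•x≈-x x))) (B.trans (φ-• _ x) (EB.-1•x≈-x _)) }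
          ; •-homo = φ-• }
        on-generators : ∀ g → φ (Func.to ι g) B.≈ Func.to f g
        on-generators g = let a , eq = word-surjective g in
          B.trans (φ-α a (A.trans (monomial-cong A ι eq) (A.*-identityʳ _)))
                  (B.trans (monomial-cong B f eq) (B.*-identityʳ _))
        unique : ∀ {ψ} → IsAlgebraHomomorphism A B ψ → (∀ g → ψ (Func.to ι g) B.≈ Func.to f g) → ∀ x → φ x B.≈ ψ x
        unique {ψ} hom on-gen x = B.trans (B.sym (ψ-⟦⟧ (span x))) (ψ-cong (⟦span⟧ x))
          where
          open IsAlgebraHomomorphism hom
          open RingMorphisms.IsRingHomomorphism isRingHomomorphism using (+-homo; *-homo; 0#-homo; 1#-homo) renaming (⟦⟧-cong to ψ-cong)
          ψ-monomial : ∀ u → ψ (monomial A ι u) B.≈ monomial B f u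
          ψ-monomial []      = 1#-homo
          ψ-monomial (g ∷ u) = B.trans (*-homo _ _) (B.*-cong (on-gen g) (ψ-monomial u))
          ψ-⟦⟧ : ∀ t → ψ (EA.⟦ α ⟧ t) B.≈ EB.⟦ β ⟧ t
          ψ-⟦⟧ []            = 0#-homo
          ψ-⟦⟧ ((k , a) ∷ t) = B.trans (+-homo _ _) (B.+-cong
            (B.trans (•-homo k _) (IsLeftModule.*ₗ-cong B.isLeftModule R.refl (ψ-monomial (word a)))) (ψ-⟦⟧ t))

-- Unitriangular families

module Triangular {c ℓ} (R : CommutativeRing c ℓ) {M : Set} (_≟_ : DecidableEquality M)
  (T : M → FreeModule.LinearCombination R _≟_) (_⊑_ : M → M → Set) (_⊑?_ : ∀ a b → Dec (a ⊑ b)) (rank corank : M → ℕ)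
  (rank-strict : ∀ {a b} → a ⊑ b → a ≢ b → rank a < rank b)
  (corank-strict : ∀ {a b} → a ⊑ b → a ≢ b → corank b < corank a)
  (diagonal : ∀ a → CommutativeRing._≈_ R (FreeModule.coeff R _≟_ a (T a)) (CommutativeRing.1# R))
  (triangular : ∀ {a b} → ¬ a ⊑ b → CommutativeRing._≈_ R (FreeModule.coeff R _≟_ b (T a)) (CommutativeRing.0# R))
  where
  open CommutativeRing R hiding (_-_)
  open Sums R
  open FreeModule R _≟_
  open import Algebra.Properties.Ring ring using (-‿distribˡ-*)
  open import Relation.Binary.Reasoning.Setoid setoid

  -- The coefficient at b of the combination of the T a with the coefficients given by t.
  expand : M → LinearCombination → Carrier
  expand b t = eval (λ a → coeff b (T a)) t

  -- In the coefficient at `b` only indices `a` below `b` contribute. Those strictly below have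
  -- smaller rank, so their coefficients already vanish, and the diagonal leaves `coeff b t`.
  independent : ∀ t → (∀ b → expand b t ≈ 0#) → t ≋ []
  independent t h b = go (suc (rank b)) b (n<1+n _)
    where
    go : ∀ n b → rank b < n → coeff b t ≈ 0#
    go (suc n) b lt = begin
      coeff b t                                         ≈⟨ ∑-pick _≟_ (λ a → coeff a t) b L u (here ≡.refl) ⟨
      ∑ (λ a → ind (b ≟ a) * coeff a t) L               ≈⟨ ∑-cong L term ⟩
      ∑ (λ a → coeff a t * coeff b (T a)) L             ≈⟨ eval-support _ t L u (λ p∈ → ∈-deduplicate⁺ _≟_ {xs = b ∷ map proj₂ t} (there (∈-map⁺ proj₂ p∈))) ⟨
      expand b t                                        ≈⟨ h b ⟩
      0#                                                ∎
      where
      L : List M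
      -- `b` is added since it may be absent from `t`, yet its term has to be picked out of the sum.
      L = deduplicate _≟_ (b ∷ map proj₂ t)
      u : Unique L
      u = deduplicate-! _≟_ (b ∷ map proj₂ t)
      term : ∀ a → ind (b ≟ a) * coeff a t ≈ coeff a t * coeff b (T a)
      term a with b ≟ a
      ... | yes ≡.refl = trans (*-comm _ _) (*-congˡ (sym (diagonal b)))
      ... | no b≢a with a ⊑? b
      ...   | no a⋢b = trans (zeroˡ _) (sym (trans (*-congˡ (triangular a⋢b)) (zeroʳ _)))
      ...   | yes a⊑b = trans (zeroˡ _) (sym (trans (*-congʳ (go n a (<-≤-trans (rank-strict a⊑b (λ eq → b≢a (≡.sym eq))) (s≤s⁻¹ lt)))) (zeroˡ _)))

  -- `T a` is `a` plus strictly larger terms; each of these is expanded recursively and subtracted,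
  -- which ends because `corank` falls.
  spanning-basis : ∀ n a → corank a < n → ∃ λ q → ∀ b → expand b q ≈ δ b a
  spanning-basis (suc n) a lt = (1# , a) ∷ concatMap correction L , λ b → begin
      1# * coeff b (T a) + expand b (concatMap correction L)
        ≈⟨ +-cong (trans (*-identityˡ _) (trans (coeff≈eval b (T a))
             (eval-support (δ b) (T a) L u (λ p∈ → ∈-deduplicate⁺ _≟_ {xs = a ∷ map proj₂ (T a)} (there (∈-map⁺ proj₂ p∈))))))
             (∑-concatMap _ correction L) ⟩
      ∑ (λ a′ → coeff a′ (T a) * δ b a′) L + ∑ (λ a′ → expand b (correction a′)) L
        ≈⟨ ∑-+ _ _ L ⟨
      ∑ (λ a′ → coeff a′ (T a) * δ b a′ + expand b (correction a′)) L
        ≈⟨ ∑-cong L (term b) ⟩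
      ∑ (λ a′ → ind (a ≟ a′) * (coeff a′ (T a) * δ b a′)) L
        ≈⟨ ∑-pick _≟_ (λ a′ → coeff a′ (T a) * δ b a′) a L u (here ≡.refl) ⟩
      coeff a (T a) * δ b a
        ≈⟨ trans (*-congʳ (diagonal a)) (*-identityˡ _) ⟩
      δ b a ∎
    where
    L : List M
    L = deduplicate _≟_ (a ∷ map proj₂ (T a))
    u : Unique L
    u = deduplicate-! _≟_ (a ∷ map proj₂ (T a))
    -- Nothing is corrected at `a` itself, which is to survive, nor at indices not above `a`, where
    -- `T a` has coefficient zero.
    correction : M → LinearCombination
    correction a′ with a ≟ a′ | a ⊑? a′
    ... | yes _   | _       = []
    ... | no _    | no _    = []
    ... | no a≢a′ | yes a⊑a′ = (- coeff a′ (T a)) ⊛ proj₁ (spanning-basis n a′ (<-≤-trans (corank-strict a⊑a′ a≢a′) (s≤s⁻¹ lt)))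
    term : ∀ b a′ → coeff a′ (T a) * δ b a′ + expand b (correction a′) ≈ ind (a ≟ a′) * (coeff a′ (T a) * δ b a′)
    term b a′ with a ≟ a′ | a ⊑? a′
    ... | yes _   | _       = trans (+-identityʳ _) (sym (*-identityˡ _))
    ... | no _    | no a⋢a′ = trans (+-identityʳ _) (trans (*-congʳ (triangular a⋢a′)) (trans (zeroˡ _) (sym (zeroˡ _))))
    ... | no a≢a′ | yes a⊑a′ = let q , eq = spanning-basis n a′ (<-≤-trans (corank-strict a⊑a′ a≢a′) (s≤s⁻¹ lt)) in begin
      coeff a′ (T a) * δ b a′ + expand b ((- coeff a′ (T a)) ⊛ q)    ≈⟨ +-congˡ (trans (eval-⊛ _ _ q) (*-congˡ (eq b))) ⟩
      coeff a′ (T a) * δ b a′ + (- coeff a′ (T a)) * δ b a′          ≈⟨ +-congˡ (-‿distribˡ-* _ _) ⟨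
      coeff a′ (T a) * δ b a′ + - (coeff a′ (T a) * δ b a′)          ≈⟨ -‿inverseʳ _ ⟩
      0#                                                             ≈⟨ zeroˡ _ ⟨
      0# * (coeff a′ (T a) * δ b a′)                                 ∎

  spanning : ∀ t → ∃ λ q → ∀ b → expand b q ≈ coeff b t
  spanning t = concatMap (λ (k , a) → k ⊛ proj₁ (basis a)) t , λ b → begin
    expand b (concatMap (λ (k , a) → k ⊛ proj₁ (basis a)) t)    ≈⟨ ∑-concatMap _ _ t ⟩
    ∑ (λ (k , a) → expand b (k ⊛ proj₁ (basis a))) t            ≈⟨ ∑-cong t (λ (k , a) → trans (eval-⊛ _ k (proj₁ (basis a))) (*-congˡ (proj₂ (basis a) b))) ⟩
    eval (δ b) t                                                ≈⟨ coeff≈eval b t ⟨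
    coeff b t                                                   ∎
    where
    basis : ∀ a → ∃ λ q → ∀ b → expand b q ≈ δ b a
    basis a = spanning-basis (suc (corank a)) a (n<1+n _)

-- Coordinates of Baxter elements and of monomials

⊑⇒size≡ : ∀ {J K} → value J ⊑ value K → size J ≡ size K
⊑⇒size≡ {J} {K} (h , _) = ≡.trans (≡.sym (length-lefts (proj₁ (value J)))) (≡.trans (Pointwise.Pointwise-length h) (length-lefts (proj₁ (value K))))

≤ᴮ⇒size≡ : ∀ {J K} → J ≤ᴮ K → size J ≡ size K
≤ᴮ⇒size≡ {J} {K} h = ⊑⇒size≡ {J} {K} (≤ᴮ⇒⊑ h)

≤ᴮ-refl : ∀ J → J ≤ᴮ J
≤ᴮ-refl J = let (σ , eq) = 𝖯-surjective J in σ , σ , ε , eq , eq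

low-/ : ∀ σ ν → low ∣ σ ∣ (value σ / value ν) ≡ value σ
low-/ σ ν = ≡.trans (filter-++ (_≤? ∣ σ ∣) (value σ) _) (≡.trans (≡.cong₂ _++_
  (filter-all (_≤? ∣ σ ∣) (All.map proj₂ (proj₂ (isPermutation σ))))
  (filter-none (_≤? ∣ σ ∣) (Allₚ.map⁺ (All.map (λ p → <⇒≱ (m<m+n ∣ σ ∣ (proj₁ p))) (proj₂ (isPermutation ν))))))
  (++-identityʳ (value σ)))

high-/ : ∀ σ ν → map (_∸ ∣ σ ∣) (high ∣ σ ∣ (value σ / value ν)) ≡ value ν
high-/ σ ν = ≡.trans (≡.cong (map (_∸ ∣ σ ∣)) (≡.trans (filter-++ (∣ σ ∣ <?_) (value σ) _) (≡.cong₂ _++_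
  (filter-none (∣ σ ∣ <?_) (All.map (≤⇒≯ ∘ proj₂) (proj₂ (isPermutation σ))))
  (filter-all (∣ σ ∣ <?_) (Allₚ.map⁺ (All.map (λ p → m<m+n ∣ σ ∣ (proj₁ p)) (proj₂ (isPermutation ν))))))))
  (shift-unshift ∣ σ ∣ (value ν))

generatorWord : List (∃ Generator) → TwinPair
generatorWord u = ∏ (map proj₁ u)

module BaxterBasis {c ℓ} (R : CommutativeRing c ℓ) where
  open CommutativeRing R hiding (_-_)
  open Sums R
  open HopfAlgebras R
  open import Relation.Binary.Reasoning.Setoid setoid
  private
    module T = FreeModule R _≟ⱼ_
    module 𝐁 = AssociativeAlgebra Baxter

  -- Read off the combination that witnesses membership in the span; `coeff-coord` identifies it
  -- with an intrinsic coefficient at any permutation of the fibre.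
  coord : TwinPair → 𝐁.Carrier → Carrier
  coord J (_ , t , _) = T.coeff J t

  coeff-coord : ∀ π x → coeff π (proj₁ x) ≈ coord (𝖯 π) x
  coeff-coord π (x , t , p) = begin
    coeff π x                                        ≈⟨ p π ⟩
    coeff π (combination t)                          ≈⟨ coeff≈eval π (combination t) ⟩
    eval (δ π) (combination t)                       ≈⟨ eval-combination (δ π) t ⟩
    ∑ (λ (k , J) → k * eval (δ π) (𝐏 J)) t           ≈⟨ ∑-cong t (λ (k , J) → *-congˡ (coeff-𝐏 π J)) ⟩
    T.eval (T.δ (𝖯 π)) t                             ≈⟨ T.coeff≈eval (𝖯 π) t ⟨
    T.coeff (𝖯 π) t                                  ∎

  -- The coefficient of 𝐅 w, or 0 if the word w is not a permutation.
  coeffʷ : Word → LinearCombination → Carrier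
  coeffʷ w = eval (λ σ → ind (w ≟ʷ value σ))

  -- The letters up to `∣ σ ∣` and those beyond it recover the two shuffled words, so `w` occurs
  -- among the shuffles at most once.
  coeffʷ-shiftedShuffles : ∀ w σ ν →
    ∑ (λ π → ind (w ≟ʷ value π)) (shiftedShuffles σ ν) ≈
    ind (low ∣ σ ∣ w ≟ʷ value σ) * ind (map (_∸ ∣ σ ∣) (high ∣ σ ∣ w) ≟ʷ value ν)
  coeffʷ-shiftedShuffles w σ ν = begin
    ∑ (λ π → ind (w ≟ʷ value π)) (shiftedShuffles σ ν)
      ≡⟨ ∑-shiftedShuffles (λ z → ind (w ≟ʷ z)) σ ν ⟩
    ∑ (λ z → ind (w ≟ʷ z)) (shuffle (value σ) (map (k +ⁿ_) (value ν)))
      ≈⟨ ∑-ind _≟ʷ_ w _ (shuffle-unique k _ _ σ≤ ν>) (d₁ ×-dec d₂) to from ⟩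
    ind (d₁ ×-dec d₂)
      ≈⟨ ind-× d₁ d₂ ⟩
    ind d₁ * ind d₂ ∎
    where
    k : ℕ
    k = ∣ σ ∣
    d₁ : Dec (low k w ≡ value σ)
    d₁ = low k w ≟ʷ value σ
    d₂ : Dec (map (_∸ k) (high k w) ≡ value ν)
    d₂ = map (_∸ k) (high k w) ≟ʷ value ν
    σ≤ : All (_≤ k) (value σ)
    σ≤ = All.map proj₂ (proj₂ (isPermutation σ))
    ν> : All (k <_) (map (k +ⁿ_) (value ν))
    ν> = Allₚ.map⁺ (All.map (λ p → m<m+n k (proj₁ p)) (proj₂ (isPermutation ν)))
    to : low k w ≡ value σ × map (_∸ k) (high k w) ≡ value ν → w ∈ shuffle (value σ) (map (k +ⁿ_) (value ν))
    to (e₁ , e₂) = ≡.subst₂ (λ x y → w ∈ shuffle x y) e₁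
      (≡.trans (≡.sym (unshift-shift k w)) (≡.cong (map (k +ⁿ_)) e₂)) (∈-shuffle-low-high k w)
    from : w ∈ shuffle (value σ) (map (k +ⁿ_) (value ν)) → low k w ≡ value σ × map (_∸ k) (high k w) ≡ value ν
    from w∈ = let (e₁ , e₂) = shuffle-low k (value σ) _ σ≤ ν> w∈ in
      e₁ , ≡.trans (≡.cong (map (_∸ k)) e₂) (shift-unshift k (value ν))

  -- The cut of `w` is made at the size of the left factor, hence the hypothesis that all terms of
  -- `x` have one size. Arbitrary words are allowed so that the formula can be applied again to the
  -- restrictions.
  coeffʷ-⊙ : ∀ {k} w x y → All (λ p → ∣ proj₂ p ∣ ≡ k) x →
             coeffʷ w (x ⊙ y) ≈ coeffʷ (low k w) x * coeffʷ (map (_∸ k) (high k w)) y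
  coeffʷ-⊙ {k} w x y h = begin
    coeffʷ w (x ⊙ y)
      ≈⟨ eval-⊙ _ x y ⟩
    eval (λ σ → eval (λ ν → ∑ (λ π → ind (w ≟ʷ value π)) (shiftedShuffles σ ν)) y) x
      ≈⟨ eval-congʰ x (λ σ → trans (eval-congʰ y (coeffʷ-shiftedShuffles w σ)) (eval-*ʰ _ _ y)) ⟩
    eval (λ σ → ind (low ∣ σ ∣ w ≟ʷ value σ) * coeffʷ (map (_∸ ∣ σ ∣) (high ∣ σ ∣ w)) y) x
      ≈⟨ ∑-cong-∈ x (λ {p} p∈ → *-congˡ (reflexive
           (≡.cong (λ k → ind (low k w ≟ʷ value (proj₂ p)) * coeffʷ (map (_∸ k) (high k w)) y) (All.lookup h p∈)))) ⟩
    eval (λ σ → ind (low k w ≟ʷ value σ) * coeffʷ (map (_∸ k) (high k w)) y) x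
      ≈⟨ trans (∑-cong x (λ _ → sym (*-assoc _ _ _))) (∑-*ʳ _ _ x) ⟩
    coeffʷ (low k w) x * coeffʷ (map (_∸ k) (high k w)) y ∎

  -- Sums of 𝐏 J

  sum-𝐏 : ∀ Js → proj₁ (sumᴬ Baxter (map 𝐏ᴮ Js)) ≡ concatMap 𝐏 Js
  sum-𝐏 []       = ≡.refl
  sum-𝐏 (J ∷ Js) = ≡.cong (𝐏 J ++_) (sum-𝐏 Js)

  eval-sum-𝐏 : ∀ h Js → eval h (proj₁ (sumᴬ Baxter (map 𝐏ᴮ Js))) ≈ ∑ (λ J → ∑ h (fibre J)) Js
  eval-sum-𝐏 h Js = trans (reflexive (≡.cong (eval h) (sum-𝐏 Js)))
    (trans (∑-concatMap _ 𝐏 Js) (∑-cong Js (eval-𝐏 h)))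

  coeff-sum-𝐏 : ∀ {p} {P : Set p} π Js → Unique Js → (d : Dec P) → (P → 𝖯 π ∈ Js) → (𝖯 π ∈ Js → P) →
                coeff π (proj₁ (sumᴬ Baxter (map 𝐏ᴮ Js))) ≈ ind d
  coeff-sum-𝐏 π Js u d f g = begin
    coeff π (proj₁ (sumᴬ Baxter (map 𝐏ᴮ Js)))        ≈⟨ coeff≈eval π (proj₁ (sumᴬ Baxter (map 𝐏ᴮ Js))) ⟩
    eval (δ π) (proj₁ (sumᴬ Baxter (map 𝐏ᴮ Js)))     ≈⟨ eval-sum-𝐏 (δ π) Js ⟩
    ∑ (λ J → ∑ (δ π) (fibre J)) Js                   ≈⟨ ∑-cong Js (λ J → trans (sym (eval-𝐏 (δ π) J)) (coeff-𝐏 π J)) ⟩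
    ∑ (λ J → ind (𝖯 π ≟ⱼ J)) Js                      ≈⟨ ∑-ind _≟ⱼ_ (𝖯 π) Js u d f g ⟩
    ind d                                            ∎

  coeff-𝐄 : ∀ π J → coeff π (proj₁ (𝐄 J)) ≈ ind (J ≤ᴮ? 𝖯 π)
  coeff-𝐄 π J = coeff-sum-𝐏 π _ (filter⁺ (J ≤ᴮ?_) (twinPairs-unique (size J))) (J ≤ᴮ? 𝖯 π)
    (λ le → ∈-filter⁺ (J ≤ᴮ?_) (≡.subst (λ n → 𝖯 π ∈ twinPairs n) (≡.sym (≤ᴮ⇒size≡ le)) (∈-twinPairs (𝖯 π))) le)
    (λ π∈ → proj₂ (∈-filter⁻ (J ≤ᴮ?_) {xs = twinPairs (size J)} π∈))

  coeff-𝐇 : ∀ π J → coeff π (proj₁ (𝐇 J)) ≈ ind (𝖯 π ≤ᴮ? J)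
  coeff-𝐇 π J = coeff-sum-𝐏 π _ (filter⁺ (_≤ᴮ? J) (twinPairs-unique (size J))) (𝖯 π ≤ᴮ? J)
    (λ le → ∈-filter⁺ (_≤ᴮ? J) (≡.subst (λ n → 𝖯 π ∈ twinPairs n) (≤ᴮ⇒size≡ le) (∈-twinPairs (𝖯 π))) le)
    (λ π∈ → proj₂ (∈-filter⁻ (_≤ᴮ? J) {xs = twinPairs (size J)} π∈))

  𝐏-support : ∀ J → All (λ p → ∣ proj₂ p ∣ ≡ size J) (𝐏 J)
  𝐏-support J = Allₚ.map⁺ (All.tabulate (∣fibre∣ J))

  sum-𝐏-support : ∀ {n Js} → All (λ J → size J ≡ n) Js → All (λ p → ∣ proj₂ p ∣ ≡ n) (proj₁ (sumᴬ Baxter (map 𝐏ᴮ Js)))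
  sum-𝐏-support []                  = []
  sum-𝐏-support {n} {J ∷ Js} (p ∷ ps) = Allₚ.++⁺ (All.map (λ q → ≡.trans q p) (𝐏-support J)) (sum-𝐏-support ps)

  𝐄-support : ∀ J → All (λ p → ∣ proj₂ p ∣ ≡ size J) (proj₁ (𝐄 J))
  𝐄-support J = sum-𝐏-support (All.map (λ {K} le → ≡.sym (≤ᴮ⇒size≡ {J} {K} le)) (Allₚ.all-filter (J ≤ᴮ?_) (twinPairs (size J))))

  -- Every permutation occurring in `𝐄 J` has its pair above `J` for `≤ᴮ`, hence for `⊑`.
  coeffʷ-𝐄-0 : ∀ w J → ¬ value J ⊑ 𝖯ʷ w → coeffʷ w (proj₁ (𝐄 J)) ≈ 0#
  coeffʷ-𝐄-0 w J ⋢ = trans (eval-sum-𝐏 _ Ks) (trans (∑-cong-∈ Ks (λ {K} K∈ → trans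
    (∑-cong-∈ (fibre K) (λ {σ} σ∈ → ind-¬ (w ≟ʷ value σ) (λ eq → ⋢ (≡.subst (value J ⊑_)
      (≡.trans (≡.cong value (≡.sym (∈-fibre⁻ K σ∈))) (≡.cong 𝖯ʷ (≡.sym eq)))
      (≤ᴮ⇒⊑ {J} {K} (All.lookup (Allₚ.all-filter (J ≤ᴮ?_) (twinPairs (size J))) K∈))))))
    (∑-0 (fibre K)))) (∑-0 Ks))
    where
    Ks : List TwinPair
    Ks = filter (J ≤ᴮ?_) (twinPairs (size J))

  ind-1 : ∀ {p} {P : Set p} (d : Dec P) → P → ind d ≈ 1#
  ind-1 (yes _) _ = refl
  ind-1 (no ¬p) p = ⊥-elim (¬p p)

  coeffʷ-𝐄-1 : ∀ σ J → 𝖯 σ ≡ J → coeffʷ (value σ) (proj₁ (𝐄 J)) ≈ 1#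
  coeffʷ-𝐄-1 σ J eq = trans (sym (coeff≈eval σ (proj₁ (𝐄 J)))) (trans (coeff-𝐄 σ J)
    (ind-1 (J ≤ᴮ? 𝖯 σ) (≡.subst (J ≤ᴮ_) (≡.sym eq) (≤ᴮ-refl J))))

  -- Monomials in the 𝐄 J

  𝐄ᶠ : Func (generators Generator) 𝐁.setoid
  𝐄ᶠ = record { to = λ g → 𝐄 (proj₁ g) ; cong = λ eq → 𝐁.reflexive (≡.cong 𝐄 eq) }

  𝐄-monomial : List (∃ Generator) → 𝐁.Carrier
  𝐄-monomial = FreeCriterion.monomial Baxter (generators Generator) 𝐄ᶠ Baxter 𝐄ᶠ

  coeffʷ-𝐄-* : ∀ w J x → coeffʷ w (proj₁ (𝐄 J 𝐁.* x)) ≈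
               coeffʷ (low (size J) w) (proj₁ (𝐄 J)) * coeffʷ (map (_∸ size J) (high (size J) w)) (proj₁ x)
  coeffʷ-𝐄-* w J x = coeffʷ-⊙ w (proj₁ (𝐄 J)) (proj₁ x) (𝐄-support J)

  ⋄-unshift-⊑ : ∀ k w → 𝖯ʷ (low k w) ⋄ 𝖯ʷ (map (_∸ k) (high k w)) ⊑ 𝖯ʷ w
  ⋄-unshift-⊑ k w = ≡.subst (λ p → 𝖯ʷ (low k w) ⋄ p ⊑ 𝖯ʷ w)
    (≡.trans (≡.cong 𝖯ʷ (≡.sym (unshift-shift k w))) (𝖯ʷ-shift k (map (_∸ k) (high k w)))) (⋄-low-high-⊑ k w)

  -- If the small letters of `w` lay above `J` and the large ones above `K`, grafting would put
  -- `J ∙ K` below `w`. So one of the two factors of the coefficient vanishes.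
  coeffʷ-monomial-0 : ∀ w u → ¬ value (generatorWord u) ⊑ 𝖯ʷ w → coeffʷ w (proj₁ (𝐄-monomial u)) ≈ 0#
  coeffʷ-monomial-0 w []      ⋢ = trans (+-identityʳ _) (trans (*-identityˡ _)
    (ind-¬ (w ≟ʷ []) (λ eq → ⋢ (≡.subst (λ w → 𝖯ʷ [] ⊑ 𝖯ʷ w) (≡.sym eq) ⊑-refl))))
  coeffʷ-monomial-0 w (g ∷ u) ⋢ = trans (coeffʷ-𝐄-* w J (𝐄-monomial u))
    (go (value J ⊑? 𝖯ʷ (low k w)) (value K ⊑? 𝖯ʷ (map (_∸ k) (high k w))))
    where
    J K : TwinPair
    J = proj₁ g
    K = generatorWord u
    k : ℕ
    k = size J
    go : Dec (value J ⊑ 𝖯ʷ (low k w)) → Dec (value K ⊑ 𝖯ʷ (map (_∸ k) (high k w))) →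
         coeffʷ (low k w) (proj₁ (𝐄 J)) * coeffʷ (map (_∸ k) (high k w)) (proj₁ (𝐄-monomial u)) ≈ 0#
    go (no n)  _       = trans (*-congʳ (coeffʷ-𝐄-0 (low k w) J n)) (zeroˡ _)
    go (yes _) (no n)  = trans (*-congˡ (coeffʷ-monomial-0 (map (_∸ k) (high k w)) u n)) (zeroʳ _)
    go (yes p) (yes q) = ⊥-elim (⋢ (≡.subst (_⊑ 𝖯ʷ w) (≡.sym (value-∙ J K)) (⊑-trans (⋄-mono-⊑ p q) (⋄-unshift-⊑ k w))))

  -- The witness is a `/ₚ` of permutations chosen over the letters of the word. Cutting it gives
  -- these permutations back, so every factor is a diagonal coefficient; one witness suffices
  -- because coefficients are constant on fibres.
  coeffʷ-monomial-1 : ∀ u → ∃ λ σ → 𝖯 σ ≡ generatorWord u × coeffʷ (value σ) (proj₁ (𝐄-monomial u)) ≈ 1#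
  coeffʷ-monomial-1 []      = εₚ , ≡.refl , trans (+-identityʳ _) (*-identityˡ _)
  coeffʷ-monomial-1 (g ∷ u) = go (𝖯-surjective J) (coeffʷ-monomial-1 u)
    where
    J K : TwinPair
    J = proj₁ g
    K = generatorWord u
    go : (∃ λ σ → 𝖯 σ ≡ J) → (∃ λ σ → 𝖯 σ ≡ K × coeffʷ (value σ) (proj₁ (𝐄-monomial u)) ≈ 1#) →
         ∃ λ σ → 𝖯 σ ≡ J ∙ K × coeffʷ (value σ) (proj₁ (𝐄-monomial (g ∷ u))) ≈ 1#
    go (σ , p) (ν , q , coeff-ν) = σ /ₚ ν , ≡.trans (𝖯-/ σ ν) (≡.cong₂ _∙_ p q) , (begin
      coeffʷ w (proj₁ (𝐄-monomial (g ∷ u)))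
        ≈⟨ coeffʷ-𝐄-* w J (𝐄-monomial u) ⟩
      coeffʷ (low (size J) w) (proj₁ (𝐄 J)) * coeffʷ (map (_∸ size J) (high (size J) w)) (proj₁ (𝐄-monomial u))
        ≡⟨ ≡.cong (λ k → coeffʷ (low k w) (proj₁ (𝐄 J)) * coeffʷ (map (_∸ k) (high k w)) (proj₁ (𝐄-monomial u)))
             (≡.trans (≡.cong size (≡.sym p)) (size-𝖯 σ)) ⟩
      coeffʷ (low ∣ σ ∣ w) (proj₁ (𝐄 J)) * coeffʷ (map (_∸ ∣ σ ∣) (high ∣ σ ∣ w)) (proj₁ (𝐄-monomial u))
        ≡⟨ ≡.cong₂ (λ u′ v′ → coeffʷ u′ (proj₁ (𝐄 J)) * coeffʷ v′ (proj₁ (𝐄-monomial u))) (low-/ σ ν) (high-/ σ ν) ⟩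
      coeffʷ (value σ) (proj₁ (𝐄 J)) * coeffʷ (value ν) (proj₁ (𝐄-monomial u))
        ≈⟨ trans (*-cong (coeffʷ-𝐄-1 σ J p) coeff-ν) (*-identityˡ 1#) ⟩
      1# ∎)
      where
      w : Word
      w = value σ / value ν

  coord-coeffʷ : ∀ π x → coeffʷ (value π) (proj₁ x) ≈ coord (𝖯 π) x
  coord-coeffʷ π x = trans (sym (coeff≈eval π (proj₁ x))) (coeff-coord π x)

  coord-monomial-0 : ∀ {J} u → ¬ value (generatorWord u) ⊑ value J → coord J (𝐄-monomial u) ≈ 0#
  coord-monomial-0 {J} u ⋢ = let (π , eq) = 𝖯-surjective J in
    trans (reflexive (≡.cong (λ J → coord J (𝐄-monomial u)) (≡.sym eq)))
      (trans (sym (coord-coeffʷ π (𝐄-monomial u)))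
        (coeffʷ-monomial-0 (value π) u (λ h → ⋢ (≡.subst (value (generatorWord u) ⊑_) (≡.cong value eq) h))))

  coord-monomial-1 : ∀ u → coord (generatorWord u) (𝐄-monomial u) ≈ 1#
  coord-monomial-1 u = let (σ , eq , coeff-σ) = coeffʷ-monomial-1 u in
    trans (reflexive (≡.cong (λ J → coord J (𝐄-monomial u)) (≡.sym eq)))
      (trans (sym (coord-coeffʷ σ (𝐄-monomial u))) coeff-σ)

-- Twin pairs as words in the generators

_≈ᵍ_ : List (∃ Generator) → List (∃ Generator) → Set
_≈ᵍ_ = Pointwise (Setoid._≈_ (generators Generator))

map-proj₁⇒≈ᵍ : ∀ {u v} → map proj₁ u ≡ map proj₁ v → u ≈ᵍ v
map-proj₁⇒≈ᵍ {[]}    {[]}    _  = []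
map-proj₁⇒≈ᵍ {g ∷ u} {h ∷ v} eq = proj₁ (∷-injective eq) ∷ map-proj₁⇒≈ᵍ (proj₂ (∷-injective eq))

generatorWord-injective : ∀ u v → generatorWord u ≡ generatorWord v → u ≈ᵍ v
generatorWord-injective u v eq = map-proj₁⇒≈ᵍ (∏-injective (all-generators u) (all-generators v) eq)
  where
  all-generators : ∀ u → All Generator (map proj₁ u)
  all-generators u = Allₚ.map⁺ (All.universal proj₂ u)

generatorWord-++ : ∀ u v → generatorWord (u ++ v) ≡ generatorWord u ∙ generatorWord v
generatorWord-++ u v = ≡.trans (≡.cong ∏ (map-++ proj₁ u v)) (∏-++ (map proj₁ u) (map proj₁ v))

abstract
  word : TwinPair → List (∃ Generator)
  word J = All.toList (proj₁ (proj₂ (factorise (size J) J ≤-refl)))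

  generatorWord-word : ∀ J → generatorWord (word J) ≡ J
  generatorWord-word J = let (Js , gs , eq) = factorise (size J) J ≤-refl in ≡.trans (≡.cong ∏ (map-toList gs)) eq
    where
    map-toList : ∀ {Js} (gs : All Generator Js) → map proj₁ (All.toList gs) ≡ Js
    map-toList []       = ≡.refl
    map-toList (g ∷ gs) = ≡.cong (_ ∷_) (map-toList gs)

-- Both sides multiply out to `J ∙ K`, so unique factorisation identifies them.
word-∙ : ∀ J K → word (J ∙ K) ≈ᵍ (word J ++ word K)
word-∙ J K = generatorWord-injective (word (J ∙ K)) (word J ++ word K) (≡.trans (generatorWord-word (J ∙ K))
  (≡.sym (≡.trans (generatorWord-++ (word J) (word K)) (≡.cong₂ _∙_ (generatorWord-word J) (generatorWord-word K)))))

word-𝟏 : word 𝟏 ≈ᵍ []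
word-𝟏 = generatorWord-injective (word 𝟏) [] (generatorWord-word 𝟏)

word-surjective : ∀ g → ∃ λ J → word J ≈ᵍ (g ∷ [])
word-surjective g = generatorWord (g ∷ []) , generatorWord-injective (word (generatorWord (g ∷ []))) (g ∷ []) (generatorWord-word (generatorWord (g ∷ [])))

-- Freeness on the elementary elements

module BaxterFree {c ℓ} (R : CommutativeRing c ℓ) where
  open CommutativeRing R hiding (_-_)
  open Sums R
  open HopfAlgebras R
  open BaxterBasis R
  open import Relation.Binary.Reasoning.Setoid setoid
  private
    module T = FreeModule R _≟ⱼ_
    module 𝐁 = AssociativeAlgebra Baxter
    module EvalB = Evaluation {R = R} _≟ⱼ_ Baxter

  α : TwinPair → 𝐁.Carrier
  α J = 𝐄-monomial (word J)

  coord-α-0 : ∀ {J K} → ¬ value J ⊑ value K → coord K (α J) ≈ 0#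
  coord-α-0 {J} {K} ⋢ = coord-monomial-0 {K} (word J) (λ h → ⋢ (≡.subst (λ J → value J ⊑ value K) (generatorWord-word J) h))

  coord-α-1 : ∀ J → coord J (α J) ≈ 1#
  coord-α-1 J = trans (reflexive (≡.cong (λ K → coord K (α J)) (≡.sym (generatorWord-word J)))) (coord-monomial-1 (word J))

  ≢-value : ∀ {J K : TwinPair} → J ≢ K → value J ≢ value K
  ≢-value {J} {K} ne eq = ne (value-injective {v = J} {w = K} eq)

  open Triangular R _≟ⱼ_ (λ J → proj₁ (proj₂ (α J))) (λ J K → value J ⊑ value K) (λ J K → value J ⊑? value K)
    (λ J → rank (value J)) (λ J → corank (value J))
    (λ {J} {K} h ne → rank-strict h (≢-value {J} {K} ne)) (λ {J} {K} h ne → corank-strict h (≢-value {J} {K} ne))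
    coord-α-1 (λ {J} {K} → coord-α-0 {J} {K})

  coeff-⟦⟧ : ∀ π t → coeff π (proj₁ (EvalB.⟦ α ⟧ t)) ≈ expand (𝖯 π) t
  coeff-⟦⟧ π []            = refl
  coeff-⟦⟧ π ((k , J) ∷ t) = begin
    coeff π (k ⊛ proj₁ (α J) ++ proj₁ (EvalB.⟦ α ⟧ t))
      ≈⟨ ∑-++ _ (k ⊛ proj₁ (α J)) (proj₁ (EvalB.⟦ α ⟧ t)) ⟩
    coeff π (k ⊛ proj₁ (α J)) + coeff π (proj₁ (EvalB.⟦ α ⟧ t))
      ≈⟨ +-cong (trans (coeff≈eval π (k ⊛ proj₁ (α J))) (trans (eval-⊛ (δ π) k (proj₁ (α J)))
           (*-congˡ (trans (sym (coeff≈eval π (proj₁ (α J)))) (coeff-coord π (α J)))))) (coeff-⟦⟧ π t) ⟩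
    k * coord (𝖯 π) (α J) + expand (𝖯 π) t ∎

  𝐄-spanning : ∀ x → ∃ λ t → EvalB.⟦ α ⟧ t 𝐁.≈ x
  𝐄-spanning x = let (q , eq) = spanning (proj₁ (proj₂ x)) in
    q , λ π → trans (coeff-⟦⟧ π q) (trans (eq (𝖯 π)) (sym (coeff-coord π x)))

  𝐄-independent : ∀ t → EvalB.⟦ α ⟧ t 𝐁.≈ 𝐁.0# → t T.≋ []
  𝐄-independent t eq = independent t λ J → let (π , p) = 𝖯-surjective J in
    trans (reflexive (≡.cong (λ J → expand J t) (≡.sym p))) (trans (sym (coeff-⟦⟧ π t)) (eq π))

  𝐄-free : ∀ {b ℓᵇ} → FreeOn b ℓᵇ Baxter (generators Generator) (λ g → 𝐄 (proj₁ g))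
  𝐄-free = FreeCriterion.free Baxter (generators Generator) 𝐄ᶠ _≟ⱼ_ _∙_ 𝟏 word word-∙ word-𝟏 word-surjective 𝐄-spanning 𝐄-independent

-- Transport to the homogeneous elements by reversal

module _ {c ℓ} {R : CommutativeRing c ℓ} {a ℓᵃ} (A : AssociativeAlgebra R a ℓᵃ) where
  private module A = AssociativeAlgebra A

  -- The extension of `f` along `ι′` is that of `f` after `s` along `ι`, precomposed with the
  -- involution; a competing extension becomes comparable once composed with `Θ`.
  FreeOn-automorphism : ∀ {x ℓˣ y ℓʸ} (X : Setoid x ℓˣ) (Y : Setoid y ℓʸ) {ι : Setoid.Carrier X → A.Carrier} {ι′ : Setoid.Carrier Y → A.Carrier}
    (Θ : A.Carrier → A.Carrier) → IsAlgebraHomomorphism A A Θ → (∀ z → Θ (Θ z) A.≈ z) →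
    (s : Func X Y) (t : Func Y X) → (∀ j → Setoid._≈_ Y (Func.to s (Func.to t j)) j) →
    (∀ i → Θ (ι i) A.≈ ι′ (Func.to s i)) → (∀ j → Θ (ι′ j) A.≈ ι (Func.to t j)) →
    ∀ {b ℓᵇ} → FreeOn b ℓᵇ A X ι → FreeOn b ℓᵇ A Y ι′
  FreeOn-automorphism X Y {ι} {ι′} Θ Θ-hom Θ² s t st Θι Θι′ free B f =
    (λ z → φ (Θ z)) , (∘-hom φ-hom , on-generators) , (λ {ψ} (ψ-hom , on-gen) z → unique′ {ψ} ψ-hom on-gen z)
    where
    module B = AssociativeAlgebra B
    extension = free B (record { to = λ i → Func.to f (Func.to s i) ; cong = λ p → Func.cong f (Func.cong s p) })
    φ : A.Carrier → B.Carrier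
    φ = proj₁ extension
    φ-hom : IsAlgebraHomomorphism A B φ
    φ-hom = proj₁ (proj₁ (proj₂ extension))
    ⟦⟧-cong : ∀ {b ℓᵇ} {B : AssociativeAlgebra R b ℓᵇ} {ψ} → IsAlgebraHomomorphism A B ψ →
              ∀ {u v} → u A.≈ v → AssociativeAlgebra._≈_ B (ψ u) (ψ v)
    ⟦⟧-cong {B = B} hom = RingMorphisms.IsRingHomomorphism.⟦⟧-cong (IsAlgebraHomomorphism.isRingHomomorphism hom)
    ∘-hom : ∀ {ψ} → IsAlgebraHomomorphism A B ψ → IsAlgebraHomomorphism A B (λ z → ψ (Θ z))
    ∘-hom {ψ} hom = record
      { isRingHomomorphism = Composition.isRingHomomorphism B.trans (IsAlgebraHomomorphism.isRingHomomorphism Θ-hom) (IsAlgebraHomomorphism.isRingHomomorphism hom)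
      ; •-homo = λ k z → B.trans (⟦⟧-cong hom (IsAlgebraHomomorphism.•-homo Θ-hom k z)) (IsAlgebraHomomorphism.•-homo hom k (Θ z)) }
    on-generators : ∀ j → φ (Θ (ι′ j)) B.≈ Func.to f j
    on-generators j = B.trans (⟦⟧-cong φ-hom (Θι′ j)) (B.trans (proj₂ (proj₁ (proj₂ extension)) (Func.to t j)) (Func.cong f (st j)))
    unique′ : ∀ {ψ} → IsAlgebraHomomorphism A B ψ → (∀ j → ψ (ι′ j) B.≈ Func.to f j) → ∀ z → φ (Θ z) B.≈ ψ z
    unique′ {ψ} hom on-gen z = B.trans
      (proj₂ (proj₂ extension) {λ z → ψ (Θ z)} (∘-hom hom , λ i → B.trans (⟦⟧-cong hom (Θι i)) (on-gen (Func.to s i))) (Θ z))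
      (⟦⟧-cong hom (Θ² z))

module MirrorAutomorphism {c ℓ} (R : CommutativeRing c ℓ) where
  open CommutativeRing R hiding (_-_)
  open Sums R
  open HopfAlgebras R
  open BaxterBasis R
  open import Relation.Binary.Reasoning.Setoid setoid
  private module 𝐁 = AssociativeAlgebra Baxter

  θ : LinearCombination → LinearCombination
  θ = map (λ (k , σ) → k , mirror σ)

  eval-θ : ∀ h x → eval h (θ x) ≡ eval (h ∘ mirror) x
  eval-θ h x = ∑-map _ (λ (k , σ) → k , mirror σ) x

  δ-mirror : ∀ π σ → δ π (mirror σ) ≡ δ (mirror π) σ
  δ-mirror π σ = ind-⇔ (π ≟ₚ mirror σ) (mirror π ≟ₚ σ)
    (λ eq → ≡.trans (≡.cong mirror eq) (mirror-involutive σ)) (λ eq → ≡.trans (≡.sym (mirror-involutive π)) (≡.cong mirror eq))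

  coeff-θ : ∀ π x → coeff π (θ x) ≈ coeff (mirror π) x
  coeff-θ π x = begin
    coeff π (θ x)                 ≈⟨ coeff≈eval π (θ x) ⟩
    eval (δ π) (θ x)              ≡⟨ eval-θ (δ π) x ⟩
    eval (δ π ∘ mirror) x         ≈⟨ eval-congʰ x (λ σ → reflexive (δ-mirror π σ)) ⟩
    eval (δ (mirror π)) x         ≈⟨ coeff≈eval (mirror π) x ⟨
    coeff (mirror π) x            ∎

  -- Reversing a shuffle of u and v gives a shuffle of the reversals of u and v.
  ∑-shiftedShuffles-mirror : ∀ π σ ν → ∑ (δ π) (shiftedShuffles (mirror σ) (mirror ν)) ≈ ∑ (δ (mirror π)) (shiftedShuffles σ ν)
  ∑-shiftedShuffles-mirror π σ ν = begin
    ∑ (δ π) (shiftedShuffles (mirror σ) (mirror ν))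
      ≈⟨ coeffʷ-shiftedShuffles w (mirror σ) (mirror ν) ⟩
    ind (low ∣ mirror σ ∣ w ≟ʷ reverse (value σ)) * ind (map (_∸ ∣ mirror σ ∣) (high ∣ mirror σ ∣ w) ≟ʷ reverse (value ν))
      ≡⟨ ≡.cong (λ k → ind (low k w ≟ʷ reverse (value σ)) * ind (map (_∸ k) (high k w) ≟ʷ reverse (value ν))) (length-reverse (value σ)) ⟩
    ind (low k w ≟ʷ reverse (value σ)) * ind (map (_∸ k) (high k w) ≟ʷ reverse (value ν))
      ≡⟨ ≡.cong₂ _*_ (ind-reverse (low k w) (filter-reverse (_≤? k) w))
           (ind-reverse (map (_∸ k) (high k w)) (≡.trans (≡.cong (map (_∸ k)) (filter-reverse (k <?_) w)) (reverse-map (_∸ k) (high k w)))) ⟩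
    ind (low k (reverse w) ≟ʷ value σ) * ind (map (_∸ k) (high k (reverse w)) ≟ʷ value ν)
      ≈⟨ coeffʷ-shiftedShuffles (reverse w) σ ν ⟨
    ∑ (δ (mirror π)) (shiftedShuffles σ ν) ∎
    where
    w : Word
    w = value π
    k : ℕ
    k = ∣ σ ∣
    ind-reverse : ∀ (u : Word) {u′ v} → u′ ≡ reverse u → ind (u ≟ʷ reverse v) ≡ ind (u′ ≟ʷ v)
    ind-reverse u {u′} {v} eq = ind-⇔ (u ≟ʷ reverse v) (u′ ≟ʷ v)
      (λ e → ≡.trans eq (≡.trans (≡.cong reverse e) (reverse-involutive v)))
      (λ e → ≡.trans (≡.sym (reverse-involutive u)) (≡.cong reverse (≡.trans (≡.sym eq) e)))

  coeff-θ-⊙ : ∀ π x y → coeff π (θ (x ⊙ y)) ≈ coeff π (θ x ⊙ θ y)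
  coeff-θ-⊙ π x y = begin
    coeff π (θ (x ⊙ y))
      ≈⟨ coeff-θ π (x ⊙ y) ⟩
    coeff (mirror π) (x ⊙ y)
      ≈⟨ trans (coeff≈eval (mirror π) (x ⊙ y)) (eval-⊙ _ x y) ⟩
    eval (λ σ → eval (λ ν → ∑ (δ (mirror π)) (shiftedShuffles σ ν)) y) x
      ≈⟨ eval-congʰ x (λ σ → eval-congʰ y (λ ν → ∑-shiftedShuffles-mirror π σ ν)) ⟨
    eval (λ σ → eval (λ ν → ∑ (δ π) (shiftedShuffles (mirror σ) (mirror ν))) y) x
      ≈⟨ eval-congʰ x (λ σ → reflexive (eval-θ (λ ν → ∑ (δ π) (shiftedShuffles (mirror σ) ν)) y)) ⟨
    eval (λ σ → eval (λ ν → ∑ (δ π) (shiftedShuffles (mirror σ) ν)) (θ y)) x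
      ≡⟨ eval-θ (λ σ → eval (λ ν → ∑ (δ π) (shiftedShuffles σ ν)) (θ y)) x ⟨
    eval (λ σ → eval (λ ν → ∑ (δ π) (shiftedShuffles σ ν)) (θ y)) (θ x)
      ≈⟨ trans (coeff≈eval π (θ x ⊙ θ y)) (eval-⊙ _ (θ x) (θ y)) ⟨
    coeff π (θ x ⊙ θ y) ∎

  -- `mirror` carries fibres to fibres, and constancy on fibres is what places the reversed element
  -- back in the span.
  θ-fibreConstant : ∀ (x : 𝐁.Carrier) → FibreConstant (θ (proj₁ x))
  θ-fibreConstant x σ τ eq = trans (at σ) (trans (reflexive (≡.cong (λ J → coord (mirrorⱼ J) x) eq)) (sym (at τ)))
    where
    at : ∀ π → coeff π (θ (proj₁ x)) ≈ coord (mirrorⱼ (𝖯 π)) x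
    at π = trans (coeff-θ π (proj₁ x)) (trans (coeff-coord (mirror π) x) (reflexive (≡.cong (λ J → coord J x) (𝖯-mirror π))))

  abstract
    θ-spanned : ∀ (x : 𝐁.Carrier) → Spanned (θ (proj₁ x))
    θ-spanned x = constant⇒spanned (θ (proj₁ x)) (θ-fibreConstant x)

  Θ : 𝐁.Carrier → 𝐁.Carrier
  Θ x = θ (proj₁ x) , θ-spanned x

  Θ-involutive : ∀ x → Θ (Θ x) 𝐁.≈ x
  Θ-involutive x π = trans (coeff-θ π (θ (proj₁ x))) (trans (coeff-θ (mirror π) (proj₁ x))
    (reflexive (≡.cong (λ π → coeff π (proj₁ x)) (mirror-involutive π))))

  Θ-isHomomorphism : IsAlgebraHomomorphism Baxter Baxter Θ
  Θ-isHomomorphism = record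
    { isRingHomomorphism = record
      { isSemiringHomomorphism = record
        { isNearSemiringHomomorphism = record
          { +-isMonoidHomomorphism = record
            { isMagmaHomomorphism = record
              { isRelHomomorphism = record { cong = λ {x} {y} eq π → trans (coeff-θ π (proj₁ x)) (trans (eq (mirror π)) (sym (coeff-θ π (proj₁ y)))) }
              ; homo = λ x y π → reflexive (≡.cong (coeff π) (map-++ _ (proj₁ x) (proj₁ y))) }
            ; ε-homo = λ π → refl }
          ; *-homo = λ x y π → coeff-θ-⊙ π (proj₁ x) (proj₁ y) }
        ; 1#-homo = λ π → refl }
      ; -‿homo = λ x π → reflexive (≡.cong (coeff π) (≡.trans (≡.sym (map-∘ (proj₁ x))) (map-∘ (proj₁ x)))) }
    ; •-homo = λ k x π → reflexive (≡.cong (coeff π) (≡.trans (≡.sym (map-∘ (proj₁ x))) (map-∘ (proj₁ x)))) }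

  Θ-𝐄 : ∀ J → Θ (𝐄 J) 𝐁.≈ 𝐇 (mirrorⱼ J)
  Θ-𝐄 J π = trans (coeff-θ π (proj₁ (𝐄 J))) (trans (coeff-𝐄 (mirror π) J)
    (trans (reflexive (ind-⇔ (J ≤ᴮ? 𝖯 (mirror π)) (𝖯 π ≤ᴮ? mirrorⱼ J) to from)) (sym (coeff-𝐇 π (mirrorⱼ J)))))
    where
    to : J ≤ᴮ 𝖯 (mirror π) → 𝖯 π ≤ᴮ mirrorⱼ J
    to h = ≡.subst (_≤ᴮ mirrorⱼ J) (≡.trans (≡.cong mirrorⱼ (𝖯-mirror π)) (mirrorⱼ-involutive (𝖯 π))) (≤ᴮ-mirror h)
    from : 𝖯 π ≤ᴮ mirrorⱼ J → J ≤ᴮ 𝖯 (mirror π)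
    from h = ≡.subst₂ _≤ᴮ_ (mirrorⱼ-involutive J) (≡.sym (𝖯-mirror π)) (≤ᴮ-mirror h)

  Θ-𝐇 : ∀ J → Θ (𝐇 J) 𝐁.≈ 𝐄 (mirrorⱼ J)
  Θ-𝐇 J = 𝐁.trans {Θ (𝐇 J)} {Θ (Θ (𝐄 (mirrorⱼ J)))} {𝐄 (mirrorⱼ J)}
    (λ π → trans (coeff-θ π (proj₁ (𝐇 J))) (trans (sym (Θ-𝐄 (mirrorⱼ J) (mirror π))) (sym (coeff-θ π (proj₁ (Θ (𝐄 (mirrorⱼ J))))))))
    (Θ-involutive (𝐄 (mirrorⱼ J)))

  AntiGenerator : TwinPair → Set
  AntiGenerator J = NonEmpty J × AntiConnectedPair J

  mirror-generator : Func (generators Generator) (generators AntiGenerator)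
  mirror-generator = record
    { to = λ (J , p , conn) → mirrorⱼ J , ≡.subst (0 <_) (≡.sym (size-mirrorⱼ J)) p , connected-mirror {J} conn
    ; cong = ≡.cong mirrorⱼ }

  mirror-antiGenerator : Func (generators AntiGenerator) (generators Generator)
  mirror-antiGenerator = record
    { to = λ (J , p , anti) → mirrorⱼ J , ≡.subst (0 <_) (≡.sym (size-mirrorⱼ J)) p , antiConnected-mirror {J} anti
    ; cong = ≡.cong mirrorⱼ }

  𝐇-free : ∀ {b ℓᵇ} → FreeOn b ℓᵇ Baxter (generators AntiGenerator) (λ g → 𝐇 (proj₁ g))
  𝐇-free = FreeOn-automorphism Baxter (generators Generator) (generators AntiGenerator) Θ Θ-isHomomorphism Θ-involutive
    mirror-generator mirror-antiGenerator (λ j → mirrorⱼ-involutive (proj₁ j)) (λ i → Θ-𝐄 (proj₁ i)) (λ j → Θ-𝐇 (proj₁ j))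
    (BaxterFree.𝐄-free R)

theorem6p11 : ∀ {c ℓ₁ ℓ₂} (K : HeytingField c ℓ₁ ℓ₂) → CharacteristicZero (fieldRing K) → ∀ {b ℓᵇ} →
    FreeOn b ℓᵇ (HopfAlgebras.Baxter (fieldRing K))
    (generators (λ J → NonEmpty J × ConnectedPair J)) (λ g → HopfAlgebras.𝐄 (fieldRing K) (proj₁ g)) ×
    FreeOn b ℓᵇ (HopfAlgebras.Baxter (fieldRing K))
    (generators (λ J → NonEmpty J × AntiConnectedPair J)) (λ g → HopfAlgebras.𝐇 (fieldRing K) (proj₁ g))
theorem6p11 K _ = BaxterFree.𝐄-free (fieldRing K) , MirrorAutomorphism.𝐇-free (fieldRing K)
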